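{- Let $g$ be a Sturmian sequence over $\{0,1\}$ with associated sequence of lower Christoffel words $01=w_0,w_1,w_2,\ldots$, and let $n\ge 2$. Let $\nu$ be the unique integer with $|w_{\nu-1}|\le n\le |w_\nu|-1$, let $N=|w_\nu|$, $q=|w_\nu|_0$, let $w_\nu=w'_\nu w''_\nu$ be the standard factorization, and let $\epsilon$ be the sign of the permutation $x\mapsto |w_\nu|_1x$ of the set of nonzero residues modulo $N$. Then: (1) If $n=N-1$, then $V_n$ equals $\epsilon$ times the lower Christoffel word over the alphabet $\{ -|w'_\nu|_1<|w''_\nu|_1\}$ with $|w''_\nu|$ letters $-|w'_\nu|_1$ and $|w'_\nu|$ letters $|w''_\nu|_1$. (2) If $|w_{\nu-1}|\le n<N-1$, let $i=N-1-n$. Then $V_n$ equals $\epsilon(-1)^t$ times the word associated with the composition $(|w''_\nu|-i,\ i,\ |w'_\nu|-i)$ over the alphabet $\{ -|w'_\nu|_1<|w''_\nu|_1-|w'_\nu|_1<|w''_\nu|_1\}$, where $$t=\sum_{1\le j\le i}\big(N-j+d_j-(jq\bmod N)\big),$$ and $d_j$ denotes the number of $j'\in\{1,\ldots,j\}$ such that $j'q\bmod N$ is smaller than $jq\bmod N$.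
   Context: Words are finite sequences; a word whose letters are numbers is identified with the vector of its letters; positions, rows and columns are indexed from $0$. For a word $u$ over $\{0,1\}$, $|u|$ is its length, $|u|_0,|u|_1$ its numbers of $0$'s and $1$'s. A factor of an infinite sequence is a finite block of consecutive letters. A Sturmian sequence over $\{0,1\}$ is an infinite sequence having exactly $m+1$ distinct factors of length $m$ for each $m\ge0$; its slope is $s=\lim |u|_1/|u|_0$ over factors $u$ with $|u|\to\infty$. For coprime integers $p,q\ge 0$ with $p+q=M\ge1$ and an ordered alphabet $\{x<y\}$, the lower Christoffel word with $p$ letters $x$ and $q$ letters $y$ is $c_0\cdots c_{M-1}$ with $c_i=y$ if $\lfloor (i+1)q/M\rfloor>\lfloor iq/M\rfloor$ and $c_i=x$ otherwise; over $\{0<1\}$ its slope is $q/p$. Every lower Christoffel word $w$ over $\{0<1\}$ of length $\ge 2$ factors uniquely as $w=w'w''$ with $w',w''$ lower Christoffel words (standard factorization). The associated sequence of lower Christoffel words of $g$ is $w_0=01,w_1,\ldots$, where $w_k$ is the lower Christoffel word over $\{0<1\}$ whose slope is the $k$-th node ($k=0$ being the root $1/1$) on the infinite path in the Stern–Brocot tree from the root towards $s$. For $m\ge1$, $G_m$ is the $(m+1)\times m$ matrix whose rows are the $m+1$ factors of length $m$ of $g$ in decreasing lexicographic order ($0<1$) from top to bottom. For a $(k+1)\times k$ matrix $A$ with rows $L_0,\ldots,L_k$, $D(A)=(a_0,\ldots,a_k)$ with $a_i=(-1)^{k-i}\det(L_0,\ldots,\widehat{L_i},\ldots,L_k)$;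 $V_m=D(G_m)$ is the $m$-th determinantal vector of $g$. Word associated with a composition: for nonnegative integers $c_1,c_2,c_3$ with sum $m$, let $I_1=\{0,\ldots,c_1-1\}$, $I_2=\{c_1,\ldots,c_1+c_2-1\}$, $I_3=\{c_1+c_2,\ldots,m-1\}$, and let $\sigma$ be the permutation of $\{0,\ldots,m-1\}$ with $\sigma(i)=i+c_2+c_3$ on $I_1$, $\sigma(i)=i+c_3-c_1$ on $I_2$, $\sigma(i)=i-c_1-c_2$ on $I_3$. When $\sigma$ is a single $m$-cycle, the word associated with $(c_1,c_2,c_3)$ over an ordered alphabet $\{x<y<z\}$ is $\ell(0)\ell(\sigma(0))\cdots\ell(\sigma^{m-1}(0))$, where $\ell(i)=x,y,z$ according as $i\in I_1,I_2,I_3$ (such words are perfectly clustering). -}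

module Defs where

open import Data.Nat as ℕ using (ℕ; zero; suc; _+_; _*_; _∸_; _≤_; _<_; _<ᵇ_; _≤ᵇ_; _/_; _%_)
open import Data.Bool using (Bool; true; false; if_then_else_; _∧_)
open import Data.Fin as Fin using (Fin; toℕ)
open import Data.Integer as ℤ using (ℤ; +_; -1ℤ; 1ℤ; ∣_∣)
open import Data.List as List using (List; []; _∷_; upTo)
open import Data.Vec as Vec using (Vec; []; _∷_; lookup; tabulate; removeAt)
open import Data.Vec.Membership.Propositional using (_∈_)
open import Data.Product using (Σ; ∃; _×_; _,_)
open import Data.Sum using (_⊎_)
open import Data.Empty using (⊥)
open import Data.Nat.Coprimality using (Coprime)
open import Relation.Binary.PropositionalEquality using (_≡_; _≢_)
open import Function.Bundles using (_⇔_)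

divN : ℕ → ℕ → ℕ
divN a zero    = 0
divN a (suc m) = a / suc m

modN : ℕ → ℕ → ℕ
modN a zero    = a
modN a (suc m) = a % suc m

sumTo : ℕ → (ℕ → ℕ) → ℕ
sumTo zero    f = 0
sumTo (suc n) f = sumTo n f + f n

sumToℤ : ℕ → (ℕ → ℤ) → ℤ
sumToℤ zero    f = + 0
sumToℤ (suc n) f = sumToℤ n f ℤ.+ f n

negOnePow : ℕ → ℤ
negOnePow zero    = 1ℤ
negOnePow (suc k) = -1ℤ ℤ.* negOnePow k

-- (-1)^t for an integer t (depends only on the parity of t, i.e. of |t|)
negOnePowℤ : ℤ → ℤ
negOnePowℤ t = negOnePow ∣ t ∣

count : ℕ → List (Fin 2) → ℕ
count a []       = 0
count a (x ∷ xs) = (if toℕ x ℕ.≡ᵇ a then 1 else 0) + count a xs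

count0 : List (Fin 2) → ℕ
count0 = count 0

count1 : List (Fin 2) → ℕ
count1 = count 1

-- Lower Christoffel word with p letters x and q letters y (over x < y):
-- c_i = y iff floor((i+1)q/M) > floor(iq/M), M = p + q.
christoffel : {A : Set} → ℕ → ℕ → A → A → List A
christoffel p q x y =
  List.map (λ i → if divN (i * q) (p + q) <ᵇ divN (suc i * q) (p + q) then y else x)
           (upTo (p + q))

IsChristoffel : List (Fin 2) → Set
IsChristoffel w = Σ ℕ λ p → Σ ℕ λ q → Coprime p q × 1 ≤ p + q × w ≡ christoffel p q Fin.zero (Fin.suc Fin.zero)

Seq : Set
Seq = ℕ → Fin 2

factorAt : Seq → ℕ → (m : ℕ) → Vec (Fin 2) m
factorAt g k m = tabulate (λ j → g (k + toℕ j))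

IsFactor : Seq → {m : ℕ} → Vec (Fin 2) m → Set
IsFactor g {m} u = ∃ λ k → u ≡ factorAt g k m

Sturmian : Seq → Set
Sturmian g = (m : ℕ) → Σ (Vec (Vec (Fin 2) m) (suc m)) λ L →
  ((i j : Fin (suc m)) → lookup L i ≡ lookup L j → i ≡ j) ×
  ((u : Vec (Fin 2) m) → IsFactor g u ⇔ u ∈ L)

onesIn : Seq → ℕ → ℕ → ℕ
onesIn g k L = sumTo L (λ j → toℕ (g (k + j)))

zerosIn : Seq → ℕ → ℕ → ℕ
zerosIn g k L = L ∸ onesIn g k L

-- slope s = lim |u|_1/|u|_0.  "s > p/q" (q > 0): there is a rational a/b > p/q
-- such that every sufficiently long factor u has |u|_1/|u|_0 > a/b.
SlopeGt : Seq → ℕ → ℕ → Set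
SlopeGt g p q = Σ ℕ λ a → Σ ℕ λ b → 1 ≤ b × p * b < a * q ×
  (Σ ℕ λ M → (k L : ℕ) → M ≤ L → a * zerosIn g k L < onesIn g k L * b)

SlopeLt : Seq → ℕ → ℕ → Set
SlopeLt g p q = Σ ℕ λ a → Σ ℕ λ b → 1 ≤ b × a * q < p * b ×
  (Σ ℕ λ M → (k L : ℕ) → M ≤ L → onesIn g k L * b < a * zerosIn g k L)

data Dir : Set where
  L R : Dir

-- state: left bound a/b, right bound c/d
SBState : Set
SBState = ℕ × ℕ × ℕ × ℕ

sbStep : Dir → SBState → SBState
sbStep L (a , b , c , d) = (a , b , a + c , b + d)
sbStep R (a , b , c , d) = (a + c , b + d , c , d)

sbState : (ℕ → Dir) → ℕ → SBState
sbState dir zero    = (0 , 1 , 1 , 0)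
sbState dir (suc k) = sbStep (dir k) (sbState dir k)

-- numerator and denominator of the k-th node (k = 0: root 1/1)
nodeNum : (ℕ → Dir) → ℕ → ℕ
nodeNum dir k with sbState dir k
... | (a , b , c , d) = a + c

nodeDen : (ℕ → Dir) → ℕ → ℕ
nodeDen dir k with sbState dir k
... | (a , b , c , d) = b + d

Toward : Seq → Dir → ℕ → ℕ → Set
Toward g L p q = SlopeLt g p q
Toward g R p q = SlopeGt g p q

IsPathTowardSlope : Seq → (ℕ → Dir) → Set
IsPathTowardSlope g dir = (k : ℕ) → Toward g (dir k) (nodeNum dir k) (nodeDen dir k)

chrW : (ℕ → Dir) → ℕ → List (Fin 2)
chrW dir k = christoffel (nodeDen dir k) (nodeNum dir k) Fin.zero (Fin.suc Fin.zero)

_>lex_ : {m : ℕ} → Vec (Fin 2) m → Vec (Fin 2) m → Set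
[]       >lex []       = ⊥
(x ∷ u) >lex (y ∷ v) = (toℕ y < toℕ x) ⊎ (x ≡ y × u >lex v)

IsGMatrix : Seq → (m : ℕ) → Vec (Vec (Fin 2) m) (suc m) → Set
IsGMatrix g m rows =
  ((i : Fin m) → lookup rows (Fin.inject₁ i) >lex lookup rows (Fin.suc i)) ×
  ((u : Vec (Fin 2) m) → IsFactor g u ⇔ u ∈ rows)

sumFin : (n : ℕ) → (Fin n → ℤ) → ℤ
sumFin zero    f = + 0
sumFin (suc n) f = f Fin.zero ℤ.+ sumFin n (λ j → f (Fin.suc j))

det : (n : ℕ) → Vec (Vec ℤ n) n → ℤ
det zero    []        = 1ℤ
det (suc n) (r ∷ rs) =
  sumFin (suc n) (λ j → negOnePow (toℕ j) ℤ.* (lookup r j ℤ.* det n (Vec.map (λ row → removeAt row j) rs)))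

toℤMat : {a b : ℕ} → Vec (Vec (Fin 2) a) b → Vec (Vec ℤ a) b
toℤMat = Vec.map (Vec.map (λ x → + toℕ x))

Dvec : (k : ℕ) → Vec (Vec ℤ k) (suc k) → Vec ℤ (suc k)
Dvec k A = tabulate (λ i → negOnePow (k ∸ toℕ i) ℤ.* det k (removeAt A i))

inversions : ℕ → ℕ → ℕ
inversions N a = sumTo N (λ x → sumTo N (λ y →
  if (1 ≤ᵇ x) ∧ (x <ᵇ y) ∧ (modN (a * y) N <ᵇ modN (a * x) N) then 1 else 0))

multSign : ℕ → ℕ → ℤ
multSign N a = negOnePow (inversions N a)

compPerm : ℕ → ℕ → ℕ → ℕ → ℕ
compPerm c1 c2 c3 i =
  if i <ᵇ c1 then i + c2 + c3
  else if i <ᵇ c1 + c2 then (i ∸ c1) + c3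
  else i ∸ (c1 + c2)

iterate : (ℕ → ℕ) → ℕ → ℕ → ℕ
iterate f zero    x = x
iterate f (suc k) x = f (iterate f k x)

-- σ is a single m-cycle (m = c1+c2+c3): the orbit of 0 has m distinct elements
IsSingleCycle : ℕ → ℕ → ℕ → Set
IsSingleCycle c1 c2 c3 = (j k : ℕ) → j < c1 + c2 + c3 → k < c1 + c2 + c3 →
  iterate (compPerm c1 c2 c3) j 0 ≡ iterate (compPerm c1 c2 c3) k 0 → j ≡ k

compLetter : {A : Set} → ℕ → ℕ → A → A → A → ℕ → A
compLetter c1 c2 x y z i = if i <ᵇ c1 then x else if i <ᵇ c1 + c2 then y else z

compWord : {A : Set} → ℕ → ℕ → ℕ → A → A → A → List A
compWord c1 c2 c3 x y z =
  List.map (λ k → compLetter c1 c2 x y z (iterate (compPerm c1 c2 c3) k 0)) (upTo (c1 + c2 + c3))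

dCount : ℕ → ℕ → ℕ → ℕ
dCount N q j = sumTo (suc j) (λ j' → if (1 ≤ᵇ j') ∧ (modN (j' * q) N <ᵇ modN (j * q) N) then 1 else 0)

tExp : ℕ → ℕ → ℕ → ℤ
tExp N q i = sumToℤ i (λ j0 → let j = suc j0 in
  (+ N) ℤ.- (+ j) ℤ.+ (+ dCount N q j) ℤ.- (+ modN (j * q) N))

{-# OPTIONS --safe #-}
module Submission where

-- Let N = |w_ν|, a = |w_ν|₁ and b = |w'|, so that a b ≡ 1 mod N, and write j a = f j N + κ j with κ j < N.
-- The factors of g of length n < N are windows of the periodic word w_ν w_ν ⋯; listed in decreasing order
-- they have parameters k running through κ 0, …, κ n in increasing order, and the first j letters of the
-- window of parameter k contain f j + [k < κ j] ones. The determinantal vector V lies in the left kernel of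
-- G_n, so the entries of parameter below κ j sum to - f j S, where S is the sum of all entries. Hence V / S
-- consists of differences of f along the first-return map to {0, …, n} of j ↦ j + b mod N: this is the word.
-- For S, delete from G_{n+1} the row of parameter κ (n+1). The remaining minor is an entry of V for n+1 and,
-- expanded along its last column, a combination of the entries of V for n; the comparison gives
-- S_{n+1} = ± S_n, the sign counting the inversions of x ↦ a x whose larger index is n+1.
-- That the windows of w_ν w_ν ⋯ occur in g comes from the bispecial factors P: the complexity m + 1 forbids
-- all four words x P y to occur, and the slope decides which of 0 P 0 and 1 P 1 does.
open import Defs
open import Data.Bool using (true; false; if_then_else_; T; _∧_)
open import Data.Empty using (⊥; ⊥-elim)
open import Data.Fin as Fin using (Fin; zero; suc; toℕ; punchIn; punchOut; fromℕ; fromℕ<)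
import Data.Fin.Properties as Fin
open import Data.Integer as ℤ using (ℤ; +_; -_; -1ℤ; 0ℤ; 1ℤ)
import Data.Integer.Properties as ℤ
import Data.Integer.Tactic.RingSolver as ℤSolver
open import Data.List as List using (List; []; _∷_; _++_; [_]; applyUpTo; length; upTo)
import Data.List.Properties as List
open import Data.Nat as ℕ using (ℕ; zero; suc; _+_; _*_; _∸_; _/_; _%_; _≤_; _<_; _≤ᵇ_; _<ᵇ_; z≤n; s≤s; NonZero)
open import Data.Nat.Coprimality using (Coprime; coprime-+; coprime-divisor)
open import Data.Nat.Divisibility using (divides; ∣⇒≤)
import Data.Nat.DivMod as ℕ
import Data.Nat.Properties as ℕ
import Data.Nat.Tactic.RingSolver as ℕSolver
open import Data.Product using (∃; ∃₂; _×_; _,_; proj₁; proj₂)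
open import Data.Sum using (_⊎_; inj₁; inj₂)
open import Data.Unit using (⊤; tt)
open import Data.Vec as Vec using (Vec; []; _∷_; lookup; removeAt; tabulate; toList)
open import Data.Vec.Membership.Propositional using (_∈_)
open import Data.Vec.Membership.Propositional.Properties using (∈-lookup)
import Data.Vec.Properties as Vec
open import Data.Vec.Relation.Unary.Any using (index)
open import Data.Vec.Relation.Unary.Any.Properties using (lookup-index)
open import Algebra.Properties.Semiring.Sum ℤ.+-*-semiring
  using (sum; sum-cong-≗; sum-remove; sum-replicate-zero; ∑-comm; ∑-distrib-+; *-distribˡ-sum)
open import Algebra.Properties.Semiring.Sum ℕ.+-*-semiring
  using () renaming (sum to sumℕ; sum-remove to sumℕ-remove)
open import Function using (_∘_; case_of_)
open import Function.Bundles using (module Equivalence)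
open import Relation.Binary.Definitions using (tri<; tri≈; tri>)
open import Relation.Binary.PropositionalEquality
  using (_≡_; _≢_; refl; sym; trans; cong; cong₂; subst; subst₂; module ≡-Reasoning)
open import Relation.Nullary using (Dec; yes; no; ¬_; contradiction)
open import Relation.Nullary.Decidable using (_×-dec_)

-- The kernel relation says nothing about the scalar S, and no minor is evaluated directly. What
-- fixes S is that one entry of V is obtained in two ways. Put e = - f j if j is the index after n+1
-- in the order of the κ, and e = 1 if there is none. By the kernel relation the entry at n+1 is (f
-- (n+1) + e) S_{n+1}; by expansion of its minor it is ± (f (n+1) + e) S_n. The common factor is not
-- 0 because n+1 is the largest index, so it cancels, and the induction starts from the empty
-- determinant 1. At n = N-1 all inversions are counted and the sign is ε. For smaller n those with
-- larger index above n are missing, and t counts exactly these: q is -a modulo N, so the summand of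
-- t for j belongs to the index N-j. The Stern-Brocot bounds A/B and C/D of the node supply every
-- constant of the rotation: N = A+B+C+D, a = A+C, b = A+B, p = A, and a b = 1 + N p is a form of
-- the determinant C B = 1 + A D.

-- Determinants: expansion along columns and the kernel relation of maximal minors.

Matrix : ℕ → ℕ → Set
Matrix m n = Fin m → Fin n → ℤ

sgn : ∀ {n} → Fin n → ℤ
sgn i = negOnePow (toℕ i)

minor : ∀ {m n} → Fin (suc m) → Fin (suc n) → Matrix (suc m) (suc n) → Matrix m n
minor i j A i′ j′ = A (punchIn i i′) (punchIn j j′)

∣_∣ₘ : ∀ {n} → Matrix n n → ℤ
∣_∣ₘ {zero}  A = 1ℤ
∣_∣ₘ {suc n} A = sum λ j → sgn j ℤ.* (A zero j ℤ.* ∣ minor zero j A ∣ₘ)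

∣∣ₘ-cong : ∀ {n} {A B : Matrix n n} → (∀ i j → A i j ≡ B i j) → ∣ A ∣ₘ ≡ ∣ B ∣ₘ
∣∣ₘ-cong {zero}  A≗B = refl
∣∣ₘ-cong {suc n} A≗B = sum-cong-≗ λ j → cong (sgn j ℤ.*_)
  (cong₂ ℤ._*_ (A≗B zero j) (∣∣ₘ-cong λ i j′ → A≗B (suc i) (punchIn j j′)))

sumFin≡sum : ∀ {n} (f : Fin n → ℤ) → sumFin n f ≡ sum f
sumFin≡sum {zero}  f = refl
sumFin≡sum {suc n} f = cong (ℤ._+_ (f zero)) (sumFin≡sum (f ∘ suc))

lookup-removeAt : ∀ {a} {A : Set a} {n} (xs : Vec A (suc n)) i j →
  lookup (removeAt xs i) j ≡ lookup xs (punchIn i j)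
lookup-removeAt (x ∷ xs)     zero    j       = refl
lookup-removeAt (x ∷ y ∷ xs) (suc i) zero    = refl
lookup-removeAt (x ∷ y ∷ xs) (suc i) (suc j) = lookup-removeAt (y ∷ xs) i j

entries : ∀ {m n} → Vec (Vec ℤ n) m → Matrix m n
entries A i j = lookup (lookup A i) j

det≡∣entries∣ : ∀ n (A : Vec (Vec ℤ n) n) → det n A ≡ ∣ entries A ∣ₘ
det≡∣entries∣ zero    []       = refl
det≡∣entries∣ (suc n) (r ∷ rs) = trans
  (sumFin≡sum λ j → sgn j ℤ.* (lookup r j ℤ.* det n (Vec.map (λ row → removeAt row j) rs)))
  (sum-cong-≗ λ j → cong (λ x → sgn j ℤ.* (lookup r j ℤ.* x))
    (trans (det≡∣entries∣ n (Vec.map (λ row → removeAt row j) rs)) (∣∣ₘ-cong λ i j′ →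
      trans (cong (λ v → lookup v j′) (Vec.lookup-map i (λ row → removeAt row j) rs))
        (lookup-removeAt (lookup rs i) j j′))))

-- The index that column c receives once the column punchIn c j has been deleted.
flip : ∀ {n} → Fin (suc n) → Fin n → Fin n
flip zero    (suc j) = zero
flip zero    zero    = zero
flip (suc c) zero    = c
flip (suc c) (suc j) = suc (flip c j)

punchIn-flip : ∀ {n} (c : Fin (suc n)) j → punchIn (punchIn c j) (flip c j) ≡ c
punchIn-flip zero    zero    = refl
punchIn-flip zero    (suc j) = refl
punchIn-flip (suc c) zero    = refl
punchIn-flip (suc c) (suc j) = cong suc (punchIn-flip c j)

-- Both sides enumerate the columns other than `c` and `punchIn c j`, deleted in the two possible
-- orders.
punchIn-comm : ∀ {n} (c : Fin (suc (suc n))) j k →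
  punchIn (punchIn c j) (punchIn (flip c j) k) ≡ punchIn c (punchIn j k)
punchIn-comm zero    zero    k       = refl
punchIn-comm zero    (suc j) k       = refl
punchIn-comm (suc c) zero    k       = refl
punchIn-comm (suc c) (suc j) zero    = refl
punchIn-comm (suc c) (suc j) (suc k) = cong suc (punchIn-comm c j k)

-- Deleting a column lowers the index of another one only if that one is further right, so the two
-- orders of deleting a pair of columns have opposite signs.
sgn-flip : ∀ {n} (c : Fin (suc n)) j → sgn (punchIn c j) ℤ.* sgn (flip c j) ≡ - (sgn c ℤ.* sgn j)
sgn-flip zero    zero    = refl
sgn-flip zero    (suc j) = lemma (sgn j)
  where
  lemma : ∀ x → (-1ℤ ℤ.* (-1ℤ ℤ.* x)) ℤ.* 1ℤ ≡ - (1ℤ ℤ.* (-1ℤ ℤ.* x))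
  lemma = ℤSolver.solve-∀
sgn-flip (suc c) zero    = lemma (sgn c)
  where
  lemma : ∀ x → 1ℤ ℤ.* x ≡ - ((-1ℤ ℤ.* x) ℤ.* 1ℤ)
  lemma = ℤSolver.solve-∀
sgn-flip (suc c) (suc j) = begin
  (-1ℤ ℤ.* x) ℤ.* (-1ℤ ℤ.* y)           ≡⟨ lemma x y ⟩
  x ℤ.* y                               ≡⟨ sgn-flip c j ⟩
  - (sgn c ℤ.* sgn j)                   ≡⟨ cong -_ (lemma (sgn c) (sgn j)) ⟨
  - ((-1ℤ ℤ.* sgn c) ℤ.* (-1ℤ ℤ.* sgn j)) ∎
  where
  open ≡-Reasoning
  x = sgn (punchIn c j)
  y = sgn (flip c j)
  lemma : ∀ x y → (-1ℤ ℤ.* x) ℤ.* (-1ℤ ℤ.* y) ≡ x ℤ.* y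
  lemma = ℤSolver.solve-∀

-- The definition expands along the first row. Its terms outside column `c` are expanded further, by
-- induction, along the column that `c` has become in the minor; exchanging the two sums then
-- collects them by rows.
∣∣ₘ-expandColumn : ∀ {n} (A : Matrix (suc n) (suc n)) c →
  ∣ A ∣ₘ ≡ sum λ i → sgn i ℤ.* (sgn c ℤ.* (A i c ℤ.* ∣ minor i c A ∣ₘ))
∣∣ₘ-expandColumn {zero}  A zero = cong (ℤ._+ 0ℤ) (cong (1ℤ ℤ.*_) (sym (ℤ.*-identityˡ (A zero zero ℤ.* 1ℤ))))
∣∣ₘ-expandColumn {suc n} A c = begin
  sum (λ j → sgn j ℤ.* (A zero j ℤ.* ∣ minor zero j A ∣ₘ))
    ≡⟨ sum-remove {i = c} (λ j → sgn j ℤ.* (A zero j ℤ.* ∣ minor zero j A ∣ₘ)) ⟩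
  sgn c ℤ.* (A zero c ℤ.* ∣ minor zero c A ∣ₘ) ℤ.+
  sum (λ j → sgn (punchIn c j) ℤ.* (A zero (punchIn c j) ℤ.* ∣ minor zero (punchIn c j) A ∣ₘ))
    ≡⟨ cong₂ ℤ._+_ (sym (ℤ.*-identityˡ (sgn c ℤ.* (A zero c ℤ.* ∣ minor zero c A ∣ₘ)))) others ⟩
  1ℤ ℤ.* (sgn c ℤ.* (A zero c ℤ.* ∣ minor zero c A ∣ₘ)) ℤ.+
  sum (λ i → sgn (suc i) ℤ.* (sgn c ℤ.* (A (suc i) c ℤ.* ∣ minor (suc i) c A ∣ₘ))) ∎
  where
  open ≡-Reasoning
  M : Fin (suc n) → Fin (suc n) → ℤ
  M i j = ∣ (λ i′ k → A (suc (punchIn i i′)) (punchIn c (punchIn j k))) ∣ₘ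
  term : Fin (suc n) → Fin (suc n) → ℤ
  term i j = sgn (suc i) ℤ.* (sgn c ℤ.* (A (suc i) c ℤ.* (sgn j ℤ.* (A zero (punchIn c j) ℤ.* M i j))))
  reassoc : ∀ s s′ sᵢ sc sj a a′ m → s ℤ.* s′ ≡ - (sc ℤ.* sj) →
    s ℤ.* (a ℤ.* (sᵢ ℤ.* (s′ ℤ.* (a′ ℤ.* m)))) ≡ (-1ℤ ℤ.* sᵢ) ℤ.* (sc ℤ.* (a′ ℤ.* (sj ℤ.* (a ℤ.* m))))
  reassoc s s′ sᵢ sc sj a a′ m eq =
    trans (before s s′ sᵢ a a′ m) (trans (cong (ℤ._* (a ℤ.* (sᵢ ℤ.* (a′ ℤ.* m)))) eq) (after sᵢ sc sj a a′ m))
    where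
    before : ∀ s s′ sᵢ a a′ m → s ℤ.* (a ℤ.* (sᵢ ℤ.* (s′ ℤ.* (a′ ℤ.* m)))) ≡ (s ℤ.* s′) ℤ.*
        (a ℤ.* (sᵢ ℤ.* (a′ ℤ.* m)))
    before = ℤSolver.solve-∀
    after : ∀ sᵢ sc sj a a′ m → (- (sc ℤ.* sj)) ℤ.* (a ℤ.* (sᵢ ℤ.* (a′ ℤ.* m))) ≡ (-1ℤ ℤ.* sᵢ) ℤ.*
        (sc ℤ.* (a′ ℤ.* (sj ℤ.* (a ℤ.* m))))
    after = ℤSolver.solve-∀
  expandMinor : ∀ j → sgn (punchIn c j) ℤ.* (A zero (punchIn c j) ℤ.* ∣ minor zero (punchIn c j) A ∣ₘ) ≡ sum
      (λ i → term i j)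
  expandMinor j = begin
    s ℤ.* (a ℤ.* ∣ minor zero (punchIn c j) A ∣ₘ)
      ≡⟨ cong (λ x → s ℤ.* (a ℤ.* x)) (∣∣ₘ-expandColumn (minor zero (punchIn c j) A) (flip c j)) ⟩
    s ℤ.* (a ℤ.* sum X) ≡⟨ cong (s ℤ.*_) (*-distribˡ-sum a X) ⟩
    s ℤ.* sum (λ i → a ℤ.* X i) ≡⟨ *-distribˡ-sum s (λ i → a ℤ.* X i) ⟩
    sum (λ i → s ℤ.* (a ℤ.* X i)) ≡⟨ sum-cong-≗ (λ i → trans (cong (λ x → s ℤ.* (a ℤ.* x)) (X≡ i))
          (reassoc s (sgn (flip c j)) (sgn i) (sgn c) (sgn j) a (A (suc i) c) (M i j) (sgn-flip c j))) ⟩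
    sum (λ i → term i j) ∎
    where
    s = sgn (punchIn c j)
    a = A zero (punchIn c j)
    X : Fin (suc n) → ℤ
    X i = sgn i ℤ.* (sgn (flip c j) ℤ.* (A (suc i) (punchIn (punchIn c j) (flip c j)) ℤ.* ∣ minor i (flip c j)
        (minor zero (punchIn c j) A) ∣ₘ))
    X≡ : ∀ i → X i ≡ sgn i ℤ.* (sgn (flip c j) ℤ.* (A (suc i) c ℤ.* M i j))
    X≡ i = cong (λ x → sgn i ℤ.* (sgn (flip c j) ℤ.* x)) (cong₂ ℤ._*_ (cong (A (suc i)) (punchIn-flip c j))
      (∣∣ₘ-cong λ i′ k → cong (A (suc (punchIn i i′))) (punchIn-comm c j k)))
  collect : ∀ i → sgn (suc i) ℤ.* (sgn c ℤ.* (A (suc i) c ℤ.* ∣ minor (suc i) c A ∣ₘ)) ≡ sum (λ j → term i j)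
  collect i = begin
    x ℤ.* (y ℤ.* (z ℤ.* sum row)) ≡⟨ cong (λ s → x ℤ.* (y ℤ.* s)) (*-distribˡ-sum z row) ⟩
    x ℤ.* (y ℤ.* sum (λ j → z ℤ.* row j)) ≡⟨ cong (x ℤ.*_) (*-distribˡ-sum y (λ j → z ℤ.* row j)) ⟩
    x ℤ.* sum (λ j → y ℤ.* (z ℤ.* row j)) ≡⟨ *-distribˡ-sum x (λ j → y ℤ.* (z ℤ.* row j)) ⟩
    sum (λ j → term i j) ∎
    where
    x = sgn (suc i)
    y = sgn c
    z = A (suc i) c
    row : Fin (suc n) → ℤ
    row j = sgn j ℤ.* (A zero (punchIn c j) ℤ.* M i j)
  others : sum (λ j → sgn (punchIn c j) ℤ.* (A zero (punchIn c j) ℤ.* ∣ minor zero (punchIn c j) A ∣ₘ))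
    ≡ sum (λ i → sgn (suc i) ℤ.* (sgn c ℤ.* (A (suc i) c ℤ.* ∣ minor (suc i) c A ∣ₘ)))
  others = begin
    sum (λ j → sgn (punchIn c j) ℤ.* (A zero (punchIn c j) ℤ.* ∣ minor zero (punchIn c j) A ∣ₘ))
      ≡⟨ sum-cong-≗ expandMinor ⟩
    sum (λ j → sum (λ i → term i j)) ≡⟨ ∑-comm (λ j i → term i j) ⟩
    sum (λ i → sum (λ j → term i j)) ≡⟨ sum-cong-≗ collect ⟨
    sum (λ i → sgn (suc i) ℤ.* (sgn c ℤ.* (A (suc i) c ℤ.* ∣ minor (suc i) c A ∣ₘ))) ∎

dropRow : ∀ {m n} → Fin (suc m) → Matrix (suc m) n → Matrix m n
dropRow i A i′ = A (punchIn i i′)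

-- The left side expands, along its first column, the matrix A with its column c repeated in front.
alternating-minors-kernel : ∀ n (A : Matrix (suc n) n) c →
  sum (λ i → sgn i ℤ.* (A i c ℤ.* ∣ dropRow i A ∣ₘ)) ≡ 0ℤ
alternating-minors-kernel (suc n) A c = begin
  1ℤ ℤ.* (a₀ ℤ.* ∣ dropRow zero A ∣ₘ) ℤ.+ sum (λ i → sgn (suc i) ℤ.* (A (suc i) c ℤ.* ∣ dropRow (suc i) A ∣ₘ))
    ≡⟨ cong₂ ℤ._+_ (trans (ℤ.*-identityˡ (a₀ ℤ.* ∣ dropRow zero A ∣ₘ)) first)
        (trans (sum-cong-≗ expandRow) (∑-distrib-+ (λ i → - diagonal i) (λ i → sum (λ j → term i j)))) ⟩
  sum diagonal ℤ.+ (sum (λ i → - diagonal i) ℤ.+ sum (λ i → sum (λ j → term i j)))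
    ≡⟨ ℤ.+-assoc (sum diagonal) _ _ ⟨
  (sum diagonal ℤ.+ sum (λ i → - diagonal i)) ℤ.+ sum (λ i → sum (λ j → term i j))
    ≡⟨ cong₂ ℤ._+_ (trans (sym (∑-distrib-+ diagonal (λ i → - diagonal i)))
        (trans (sum-cong-≗ (λ i → ℤ.+-inverseʳ (diagonal i))) (sum-replicate-zero (suc n))))
         (trans (∑-comm term) (trans (sum-cong-≗ zeroColumn) (sum-replicate-zero n))) ⟩
  0ℤ ∎
  where
  open ≡-Reasoning
  a₀ = A zero c
  M : Fin (suc n) → Fin (suc n) → ℤ
  M i j = ∣ (λ i′ k → A (suc (punchIn i i′)) (punchIn j k)) ∣ₘ
  -- These terms arise twice with opposite signs: from the minor without row `zero`, expanded along
  -- column `c`, and as the column `c` terms of the other minors, expanded along row `zero`.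
  diagonal : Fin (suc n) → ℤ
  diagonal i = a₀ ℤ.* (sgn i ℤ.* (sgn c ℤ.* (A (suc i) c ℤ.* M i c)))
  term : Fin (suc n) → Fin n → ℤ
  term i j = (sgn (suc i) ℤ.* A (suc i) c) ℤ.* (sgn (punchIn c j) ℤ.* (A zero (punchIn c j) ℤ.* M i (punchIn c j)))
  first : a₀ ℤ.* ∣ dropRow zero A ∣ₘ ≡ sum diagonal
  first = trans (cong (a₀ ℤ.*_) (∣∣ₘ-expandColumn (dropRow zero A) c))
      (*-distribˡ-sum a₀ (λ i → sgn i ℤ.* (sgn c ℤ.* (A (suc i) c ℤ.* M i c))))
  doubled : ∀ i → (sgn (suc i) ℤ.* A (suc i) c) ℤ.* (sgn c ℤ.* (a₀ ℤ.* M i c)) ≡ - diagonal i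
  doubled i = lemma (sgn i) (A (suc i) c) (sgn c) a₀ (M i c)
    where
    lemma : ∀ s a s′ a₀ m → ((-1ℤ ℤ.* s) ℤ.* a) ℤ.* (s′ ℤ.* (a₀ ℤ.* m)) ≡ - (a₀ ℤ.* (s ℤ.* (s′ ℤ.* (a ℤ.* m))))
    lemma = ℤSolver.solve-∀
  expandRow : ∀ i → sgn (suc i) ℤ.* (A (suc i) c ℤ.* ∣ dropRow (suc i) A ∣ₘ) ≡ - diagonal i ℤ.+ sum (term i)
  expandRow i = begin
    sgn (suc i) ℤ.* (A (suc i) c ℤ.* sum row) ≡⟨ ℤ.*-assoc (sgn (suc i)) (A (suc i) c) (sum row) ⟨
    (sgn (suc i) ℤ.* A (suc i) c) ℤ.* sum row ≡⟨ *-distribˡ-sum (sgn (suc i) ℤ.* A (suc i) c) row ⟩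
    sum (λ j → (sgn (suc i) ℤ.* A (suc i) c) ℤ.* row j) ≡⟨ sum-remove {i = c}
        (λ j → (sgn (suc i) ℤ.* A (suc i) c) ℤ.* row j) ⟩
    (sgn (suc i) ℤ.* A (suc i) c) ℤ.* row c ℤ.+ sum (term i) ≡⟨ cong (ℤ._+ sum (term i)) (doubled i) ⟩
    - diagonal i ℤ.+ sum (term i) ∎
    where
    row : Fin (suc n) → ℤ
    row j = sgn j ℤ.* (A zero j ℤ.* M i j)
  -- Deleting row `zero` and column `punchIn c j` leaves a smaller matrix with one row too many, in
  -- which `c` has become column `flip c j`; the sum is a multiple of the same relation for it.
  zeroColumn : ∀ j → sum (λ i → term i j) ≡ 0ℤ
  zeroColumn j = begin
    sum (λ i → term i j)
      ≡⟨ sum-cong-≗ (λ i → trans (rearrange (sgn i) (A (suc i) c) (sgn (punchIn c j)) (A zero (punchIn c j))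
          (M i (punchIn c j)))
           (cong (λ x → (- (sgn (punchIn c j) ℤ.* A zero (punchIn c j))) ℤ.*
               (sgn i ℤ.* (A (suc i) x ℤ.* M i (punchIn c j)))) (sym (punchIn-flip c j)))) ⟩
    sum (λ i → (- (sgn (punchIn c j) ℤ.* A zero (punchIn c j))) ℤ.* (sgn i ℤ.* (B i (flip c j) ℤ.* ∣ dropRow i B ∣ₘ)))
      ≡⟨ *-distribˡ-sum (- (sgn (punchIn c j) ℤ.* A zero (punchIn c j)))
          (λ i → sgn i ℤ.* (B i (flip c j) ℤ.* ∣ dropRow i B ∣ₘ)) ⟨
    (- (sgn (punchIn c j) ℤ.* A zero (punchIn c j))) ℤ.* sum (λ i → sgn i ℤ.* (B i (flip c j) ℤ.* ∣ dropRow i B ∣ₘ))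
      ≡⟨ cong ((- (sgn (punchIn c j) ℤ.* A zero (punchIn c j))) ℤ.*_) (alternating-minors-kernel n B (flip c j)) ⟩
    (- (sgn (punchIn c j) ℤ.* A zero (punchIn c j))) ℤ.* 0ℤ ≡⟨ ℤ.*-zeroʳ
        (- (sgn (punchIn c j) ℤ.* A zero (punchIn c j))) ⟩
    0ℤ ∎
    where
    B : Matrix (suc n) n
    B i k = A (suc i) (punchIn (punchIn c j) k)
    rearrange : ∀ s a s′ a′ m → ((-1ℤ ℤ.* s) ℤ.* a) ℤ.* (s′ ℤ.* (a′ ℤ.* m)) ≡ (- (s′ ℤ.* a′)) ℤ.* (s ℤ.* (a ℤ.* m))
    rearrange = ℤSolver.solve-∀

-- The vector D of the theorem, with the sign (-1)^(n-i) written as a product to avoid subtraction.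
cofactors : ∀ {n} → Matrix (suc n) n → Fin (suc n) → ℤ
cofactors {n} A i = negOnePow n ℤ.* (sgn i ℤ.* ∣ dropRow i A ∣ₘ)

cofactors-kernel : ∀ {n} (A : Matrix (suc n) n) c → sum (λ i → cofactors A i ℤ.* A i c) ≡ 0ℤ
cofactors-kernel {n} A c = begin
  sum (λ i → cofactors A i ℤ.* A i c)
    ≡⟨ sum-cong-≗ (λ i → rearrange (negOnePow n) (sgn i) ∣ dropRow i A ∣ₘ (A i c)) ⟩
  sum (λ i → negOnePow n ℤ.* (sgn i ℤ.* (A i c ℤ.* ∣ dropRow i A ∣ₘ)))
    ≡⟨ *-distribˡ-sum (negOnePow n) (λ i → sgn i ℤ.* (A i c ℤ.* ∣ dropRow i A ∣ₘ)) ⟨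
  negOnePow n ℤ.* sum (λ i → sgn i ℤ.* (A i c ℤ.* ∣ dropRow i A ∣ₘ))
    ≡⟨ cong (negOnePow n ℤ.*_) (alternating-minors-kernel n A c) ⟩
  negOnePow n ℤ.* 0ℤ ≡⟨ ℤ.*-zeroʳ (negOnePow n) ⟩
  0ℤ ∎
  where
  open ≡-Reasoning
  rearrange : ∀ x y z w → (x ℤ.* (y ℤ.* z)) ℤ.* w ≡ x ℤ.* (y ℤ.* (w ℤ.* z))
  rearrange = ℤSolver.solve-∀

dropLastColumn : ∀ {m n} → Matrix m (suc n) → Matrix m n
dropLastColumn {n = n} A i j = A i (punchIn (fromℕ n) j)

toℕ-punchIn-fromℕ : ∀ {n} (j : Fin n) → toℕ (punchIn (fromℕ n) j) ≡ toℕ j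
toℕ-punchIn-fromℕ zero    = refl
toℕ-punchIn-fromℕ (suc j) = cong suc (toℕ-punchIn-fromℕ j)

-- The factor (-1)^n in `cofactors` is the sign of the last column. Hence a square determinant is
-- the pairing of its last column with the vector D of the rest.
∣∣ₘ-expandLastColumn : ∀ {n} (A : Matrix (suc n) (suc n)) →
  ∣ A ∣ₘ ≡ sum λ i → cofactors (dropLastColumn A) i ℤ.* A i (fromℕ n)
∣∣ₘ-expandLastColumn {n} A = trans (∣∣ₘ-expandColumn A (fromℕ n)) (sum-cong-≗ λ i → trans
  (cong (λ k → sgn i ℤ.* (negOnePow k ℤ.* (A i (fromℕ n) ℤ.* ∣ minor i (fromℕ n) A ∣ₘ))) (Fin.toℕ-fromℕ n))
  (rearrange (sgn i) (negOnePow n) (A i (fromℕ n)) ∣ minor i (fromℕ n) A ∣ₘ))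
  where
  rearrange : ∀ x y z w → x ℤ.* (y ℤ.* (z ℤ.* w)) ≡ (y ℤ.* (x ℤ.* w)) ℤ.* z
  rearrange = ℤSolver.solve-∀

cofactors-cong : ∀ {n} {A B : Matrix (suc n) n} → (∀ i j → A i j ≡ B i j) → ∀ i → cofactors A i ≡ cofactors B i
cofactors-cong {n} A≗B i = cong (λ d → negOnePow n ℤ.* (sgn i ℤ.* d)) (∣∣ₘ-cong λ i′ j → A≗B (punchIn i i′) j)

-- Thresholds, ranks and division with remainder.

below : ℕ → ℕ → ℕ
below k t = if k <ᵇ t then 1 else 0

below-< : ∀ {k t} → k < t → below k t ≡ 1
below-< {k} {t} k<t with k <ᵇ t in eq
... | true  = refl
... | false = ⊥-elim (subst T eq (ℕ.<⇒<ᵇ k<t))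

below-≥ : ∀ {k t} → t ≤ k → below k t ≡ 0
below-≥ {k} {t} t≤k with k <ᵇ t in eq
... | true  = contradiction t≤k (ℕ.<⇒≱ (ℕ.<ᵇ⇒< k t (subst T (sym eq) _)))
... | false = refl

Increasing : ∀ {n} → (Fin n → ℕ) → Set
Increasing x = ∀ {i i′} → i Fin.< i′ → x i < x i′

increasing-mono-≤ : ∀ {n} {x : Fin n → ℕ} → Increasing x → ∀ {i i′} → i Fin.≤ i′ → x i ≤ x i′
increasing-mono-≤ {x = x} inc {i} {i′} i≤i′ with Fin.<-cmp i i′
... | tri< i<i′ _ _ = ℕ.<⇒≤ (inc i<i′)
... | tri≈ _ i≡i′ _ = ℕ.≤-reflexive (cong x i≡i′)
... | tri> _ _ i>i′ = contradiction i≤i′ (ℕ.<⇒≱ i>i′)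

sumℕ-zero : ∀ {n} (x : Fin n → ℕ) → (∀ i → x i ≡ 0) → sumℕ x ≡ 0
sumℕ-zero {zero}  x x≡0 = refl
sumℕ-zero {suc n} x x≡0 = cong₂ _+_ (x≡0 zero) (sumℕ-zero (x ∘ suc) (x≡0 ∘ suc))

rank : ∀ {n} (x : Fin n → ℕ) → Increasing x → ∀ m → sumℕ (λ i → below (x i) (x m)) ≡ toℕ m
rank {suc n} x inc zero    = sumℕ-zero (λ i → below (x i) (x zero)) λ i → below-≥ (increasing-mono-≤ inc z≤n)
rank {suc n} x inc (suc m) = cong₂ _+_ (below-< (inc (s≤s z≤n))) (rank (x ∘ suc) (inc ∘ s≤s) m)

divMod-unique : ∀ {x q r} N .⦃ _ : NonZero N ⦄ → x ≡ r + q * N → r < N → x % N ≡ r × x / N ≡ q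
divMod-unique {q = q} {r} N refl r<N =
  trans (ℕ.[m+kn]%n≡m%n r q N) (ℕ.m<n⇒m%n≡m r<N) ,
  (begin
    (r + q * N) / N   ≡⟨ ℕ.+-distrib-/ r (q * N)
        (subst (_< N) (sym (cong₂ _+_ (ℕ.m<n⇒m%n≡m r<N) (ℕ.m*n%n≡0 q N)))
        (subst (_< N) (sym (ℕ.+-identityʳ r)) r<N)) ⟩
    r / N + q * N / N ≡⟨ cong₂ _+_ (ℕ.m<n⇒m/n≡0 r<N) (ℕ.m*n/n≡m q N) ⟩
    q ∎)
  where open ≡-Reasoning

punchIn-mono-< : ∀ {n} (m : Fin (suc n)) {i i′} → i Fin.< i′ → punchIn m i Fin.< punchIn m i′
punchIn-mono-< m {i} {i′} i<i′ = ℕ.≤∧≢⇒< (Fin.punchIn-mono-≤ m i i′ (ℕ.<⇒≤ i<i′))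
  λ eq → ℕ.<-irrefl (cong toℕ (Fin.punchIn-injective m i i′ (Fin.toℕ-injective eq))) i<i′

punchIn-< : ∀ {n} (m : Fin (suc n)) i → ¬ (punchIn m i Fin.< m) → m Fin.< punchIn m i
punchIn-< m i ≮ = ℕ.≤∧≢⇒< (ℕ.≮⇒≥ ≮) (λ eq → Fin.punchInᵢ≢i m i (sym (Fin.toℕ-injective eq)))

-- The matrix attached to the multiples of a modulo N, and its determinantal vector.

module Rotation (N a b p : ℕ) ⦃ _ : NonZero N ⦄ (ab≡1+Np : a * b ≡ 1 + N * p) where

  f κ : ℕ → ℕ
  f j = j * a / N
  κ j = j * a % N

  κ<N : ∀ j → κ j < N
  κ<N j = ℕ.m%n<n (j * a) N

  κ+fN : ∀ j → j * a ≡ κ j + f j * N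
  κ+fN j = ℕ.m≡m%n+[m/n]*n (j * a) N

  f-zero : f 0 ≡ 0
  f-zero = ℕ.0/n≡0 N

  κ-zero : κ 0 ≡ 0
  κ-zero = ℕ.m*n%n≡0 0 N

  κb : ∀ {i} → i < N → κ i * b % N ≡ i
  κb {i} i<N = begin
    κ i * b % N                     ≡⟨ ℕ.[m+kn]%n≡m%n (κ i * b) (f i * b) N ⟨
    (κ i * b + f i * b * N) % N     ≡⟨ cong (_% N) (factor (κ i) (f i) b N) ⟩
    (κ i + f i * N) * b % N         ≡⟨ cong (λ x → x * b % N) (κ+fN i) ⟨
    i * a * b % N                   ≡⟨ cong (_% N)
        (trans (ℕ.*-assoc i a b) (trans (cong (i *_) ab≡1+Np) (expand i N p))) ⟩
    (i + i * p * N) % N             ≡⟨ ℕ.[m+kn]%n≡m%n i (i * p) N ⟩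
    i % N                           ≡⟨ ℕ.m<n⇒m%n≡m i<N ⟩
    i ∎
    where
    open ≡-Reasoning
    factor : ∀ k f b N → k * b + f * b * N ≡ (k + f * N) * b
    factor = ℕSolver.solve-∀
    expand : ∀ i N p → i * (1 + N * p) ≡ i + i * p * N
    expand = ℕSolver.solve-∀

  κ-injective : ∀ {i j} → i < N → j < N → κ i ≡ κ j → i ≡ j
  κ-injective i<N j<N eq = trans (sym (κb i<N)) (trans (cong (λ k → k * b % N) eq) (κb j<N))

  -- Row `i` of the matrix has parameter `κ (J i)`. Prefix counts do not increase with the
  -- parameter, so increasing parameters are what lexicographically decreasing rows require.
  record Enumeration (n : ℕ) (J : Fin (suc n) → ℕ) : Set where
    field
      sorted     : Increasing (κ ∘ J)
      bounded    : ∀ i → J i ≤ n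
      surjective : ∀ {j} → j ≤ n → ∃ λ i → J i ≡ j

  open Enumeration

  remove : ∀ {n J m} → suc n < N → Enumeration (suc n) J → J m ≡ suc n → Enumeration n (J ∘ punchIn m)
  remove {n} {J} {m} n<N E Jm≡1+n = record
    { sorted     = λ i<i′ → sorted E (punchIn-mono-< m i<i′)
    ; bounded    = λ i → ℕ.≤-pred (ℕ.≤∧≢⇒< (bounded E (punchIn m i)) λ eq →
        Fin.punchInᵢ≢i m i (J-injective (trans eq (sym Jm≡1+n))))
    ; surjective = λ {j} j≤n → let i , Ji≡j = surjective E (ℕ.m≤n⇒m≤1+n j≤n)
                                   m≢i = λ m≡i → ℕ.<⇒≢ (s≤s j≤n) (trans (sym Ji≡j) (trans (cong J (sym m≡i)) Jm≡1+n))
                               in punchOut m≢i , trans (cong J (Fin.punchIn-punchOut m≢i)) Ji≡j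
    }
    where
    J-injective : ∀ {i i′} → J i ≡ J i′ → i ≡ i′
    J-injective {i} {i′} eq with Fin.<-cmp i i′
    ... | tri< i<i′ _ _ = contradiction (cong κ eq) (ℕ.<⇒≢ (sorted E i<i′))
    ... | tri≈ _ i≡i′ _ = i≡i′
    ... | tri> _ _ i′<i = contradiction (cong κ (sym eq)) (ℕ.<⇒≢ (sorted E i′<i))

  sum-enumeration : ∀ {n J} → n < N → Enumeration n J → ∀ F → sumℕ (F ∘ J) ≡ sumTo (suc n) F
  sum-enumeration {zero} {J} n<N E F = trans (ℕ.+-identityʳ (F (J zero))) (cong F (ℕ.n≤0⇒n≡0 (bounded E zero)))
  sum-enumeration {suc n} {J} n<N E F with surjective E {suc n} ℕ.≤-refl
  ... | m , Jm≡1+n = begin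
    sumℕ (F ∘ J)                             ≡⟨ sumℕ-remove {i = m} (F ∘ J) ⟩
    F (J m) + sumℕ (F ∘ J ∘ punchIn m)       ≡⟨ cong₂ _+_ (cong F Jm≡1+n)
        (sum-enumeration (ℕ.<-trans (ℕ.n<1+n n) n<N) (remove n<N E Jm≡1+n) F) ⟩
    F (suc n) + sumTo (suc n) F              ≡⟨ ℕ.+-comm (F (suc n)) (sumTo (suc n) F) ⟩
    sumTo (suc n) F + F (suc n) ∎
    where open ≡-Reasoning

  position : ∀ {n J} → n < N → Enumeration n J → ∀ m → sumTo (suc n) (λ x → below (κ x) (κ (J m))) ≡ toℕ m
  position {J = J} n<N E m = trans (sym (sum-enumeration n<N E (λ x → below (κ x) (κ (J m)))))
      (rank (κ ∘ J) (sorted E) m)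

  -- The number of ones among the first j letters of the row with parameter k.
  prefix : ℕ → ℕ → ℕ
  prefix k j = f j + below k (κ j)

  rows : ∀ {n} → (Fin (suc n) → ℕ) → Matrix (suc n) n
  rows J i c = + prefix (κ (J i)) (suc (toℕ c)) ℤ.- + prefix (κ (J i)) (toℕ c)

  V : ∀ {n} → (Fin (suc n) → ℕ) → Fin (suc n) → ℤ
  V J = cofactors (rows J)

  S : ∀ {n} → (Fin (suc n) → ℕ) → ℤ
  S J = sum (V J)

  partial : ∀ {n} → (Fin (suc n) → ℕ) → ℕ → ℤ
  partial J θ = sum λ i → V J i ℤ.* + below (κ (J i)) θ

  V-prefix : ∀ {n} (J : Fin (suc n) → ℕ) j → sum
      (λ i → V J i ℤ.* + prefix (κ (J i)) j) ≡ + f j ℤ.* S J ℤ.+ partial J (κ j)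
  V-prefix J j = begin
    sum (λ i → V J i ℤ.* (+ f j ℤ.+ + below (κ (J i)) (κ j)))
      ≡⟨ sum-cong-≗ (λ i → distrib (V J i) (+ f j) (+ below (κ (J i)) (κ j))) ⟩
    sum (λ i → + f j ℤ.* V J i ℤ.+ V J i ℤ.* + below (κ (J i)) (κ j))
      ≡⟨ ∑-distrib-+ (λ i → + f j ℤ.* V J i) (λ i → V J i ℤ.* + below (κ (J i)) (κ j)) ⟩
    sum (λ i → + f j ℤ.* V J i) ℤ.+ partial J (κ j)
      ≡⟨ cong (ℤ._+ partial J (κ j)) (*-distribˡ-sum (+ f j) (V J)) ⟨
    + f j ℤ.* S J ℤ.+ partial J (κ j) ∎
    where
    open ≡-Reasoning
    distrib : ∀ x y z → x ℤ.* (y ℤ.+ z) ≡ y ℤ.* x ℤ.+ x ℤ.* z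
    distrib = ℤSolver.solve-∀

  sum-difference : ∀ {n} (J : Fin (suc n) → ℕ) j →
    sum (λ i → V J i ℤ.* (+ prefix (κ (J i)) (suc j) ℤ.- + prefix (κ (J i)) j))
      ≡ sum (λ i → V J i ℤ.* + prefix (κ (J i)) (suc j)) ℤ.- sum (λ i → V J i ℤ.* + prefix (κ (J i)) j)
  sum-difference J j = begin
    sum (λ i → V J i ℤ.* (x i ℤ.- y i)) ≡⟨ sum-cong-≗ (λ i → distrib (V J i) (x i) (y i)) ⟩
    sum (λ i → V J i ℤ.* x i ℤ.+ -1ℤ ℤ.* (V J i ℤ.* y i)) ≡⟨ ∑-distrib-+ (λ i → V J i ℤ.* x i)
        (λ i → -1ℤ ℤ.* (V J i ℤ.* y i)) ⟩
    sum (λ i → V J i ℤ.* x i) ℤ.+ sum (λ i → -1ℤ ℤ.* (V J i ℤ.* y i)) ≡⟨ cong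
        (ℤ._+_ (sum (λ i → V J i ℤ.* x i))) (*-distribˡ-sum -1ℤ (λ i → V J i ℤ.* y i)) ⟨
    sum (λ i → V J i ℤ.* x i) ℤ.+ -1ℤ ℤ.* sum (λ i → V J i ℤ.* y i) ≡⟨ cong (ℤ._+_ (sum (λ i → V J i ℤ.* x i)))
        (ℤ.-1*i≡-i (sum (λ i → V J i ℤ.* y i))) ⟩
    sum (λ i → V J i ℤ.* x i) ℤ.- sum (λ i → V J i ℤ.* y i) ∎
    where
    open ≡-Reasoning
    x y : Fin _ → ℤ
    x i = + prefix (κ (J i)) (suc j)
    y i = + prefix (κ (J i)) j
    distrib : ∀ x y z → x ℤ.* (y ℤ.- z) ≡ x ℤ.* y ℤ.+ -1ℤ ℤ.* (x ℤ.* z)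
    distrib = ℤSolver.solve-∀

  -- Each column of `rows J` is the difference of two consecutive prefix counts, so the kernel
  -- relations telescope from the empty prefix. The columns reach only up to `n`; the count for
  -- `suc n` escapes, and its pairing with `V J` is what `V-removed` needs.
  V-prefix≡0 : ∀ {n} (J : Fin (suc n) → ℕ) j → j ≤ n → sum (λ i → V J i ℤ.* + prefix (κ (J i)) j) ≡ 0ℤ
  V-prefix≡0 {n} J zero _ = trans (sum-cong-≗ {suc n} {λ i → V J i ℤ.* + prefix (κ (J i)) 0} {λ _ → 0ℤ} (λ i → trans
    (cong (λ x → V J i ℤ.* + x) (cong₂ _+_ f-zero (cong (below (κ (J i))) κ-zero))) (ℤ.*-zeroʳ (V J i))))
        (sum-replicate-zero (suc n))
  V-prefix≡0 {n} J (suc j) j<n = begin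
    Σ′ (suc j) ≡⟨ lemma (Σ′ (suc j)) (Σ′ j) ⟩
    (Σ′ (suc j) ℤ.- Σ′ j) ℤ.+ Σ′ j ≡⟨ cong (ℤ._+ Σ′ j) (sum-difference J j) ⟨
    sum (λ i → V J i ℤ.* (+ prefix (κ (J i)) (suc j) ℤ.- + prefix (κ (J i)) j)) ℤ.+ Σ′ j
      ≡⟨ cong (λ c → sum (λ i → V J i ℤ.* (+ prefix (κ (J i)) (suc c) ℤ.- + prefix (κ (J i)) c)) ℤ.+ Σ′ j)
          (Fin.toℕ-fromℕ< j<n) ⟨
    sum (λ i → V J i ℤ.* rows J i (fromℕ< j<n)) ℤ.+ Σ′ j
      ≡⟨ cong₂ ℤ._+_ (cofactors-kernel (rows J) (fromℕ< j<n)) (V-prefix≡0 J j (ℕ.<⇒≤ j<n)) ⟩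
    0ℤ ∎
    where
    open ≡-Reasoning
    Σ′ : ℕ → ℤ
    Σ′ j = sum (λ i → V J i ℤ.* + prefix (κ (J i)) j)
    lemma : ∀ x y → x ≡ (x ℤ.- y) ℤ.+ y
    lemma = ℤSolver.solve-∀

  partial≡-fS : ∀ {n} (J : Fin (suc n) → ℕ) j → j ≤ n → partial J (κ j) ≡ - + f j ℤ.* S J
  partial≡-fS J j j≤n = begin
    partial J (κ j) ≡⟨ lemma (+ f j) (S J) (partial J (κ j)) ⟩
    (+ f j ℤ.* S J ℤ.+ partial J (κ j)) ℤ.+ - + f j ℤ.* S J ≡⟨ cong (ℤ._+ - + f j ℤ.* S J)
        (trans (sym (V-prefix J j)) (V-prefix≡0 J j j≤n)) ⟩
    0ℤ ℤ.+ - + f j ℤ.* S J ≡⟨ ℤ.+-identityˡ _ ⟩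
    - + f j ℤ.* S J ∎
    where
    open ≡-Reasoning
    lemma : ∀ f s p → p ≡ (f ℤ.* s ℤ.+ p) ℤ.+ - f ℤ.* s
    lemma = ℤSolver.solve-∀

  record Separates {n} (J : Fin (suc n) → ℕ) (m : Fin (suc n)) (θ : ℕ) : Set where
    field
      below-θ : ∀ i → i Fin.≤ m → κ (J i) < θ
      above-θ : ∀ i → m Fin.< i → θ ≤ κ (J i)

  open Separates

  -- Raising the threshold from `κ (J m)` to `θ` admits row `m` and no other: `below` is strict, so
  -- it excludes `m` at its own parameter.
  partial-step : ∀ {n J m θ} → Enumeration n J → Separates J m θ →
    partial J θ ≡ partial J (κ (J m)) ℤ.+ V J m
  partial-step {n} {J} {m} {θ} E sep = begin
    partial J θ
      ≡⟨ sum-remove {i = m} (λ i → V J i ℤ.* + below (κ (J i)) θ) ⟩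
    V J m ℤ.* + below (κ (J m)) θ ℤ.+ sum (λ i → V J (punchIn m i) ℤ.* + below (κ (J (punchIn m i))) θ)
      ≡⟨ cong₂ ℤ._+_ (trans (cong (λ x → V J m ℤ.* + x) (below-< (below-θ sep m ℕ.≤-refl))) (ℤ.*-identityʳ (V J m)))
                     (sum-cong-≗ λ i → cong (λ x → V J (punchIn m i) ℤ.* + x) (same i)) ⟩
    V J m ℤ.+ rest
      ≡⟨ ℤ.+-comm (V J m) rest ⟩
    rest ℤ.+ V J m
      ≡⟨ cong (ℤ._+ V J m) (trans (cong (ℤ._+ rest)
          (trans (cong (λ x → V J m ℤ.* + x) (below-≥ {κ (J m)} ℕ.≤-refl)) (ℤ.*-zeroʳ (V J m))))
          (ℤ.+-identityˡ rest)) ⟨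
    (V J m ℤ.* + below (κ (J m)) (κ (J m)) ℤ.+ rest) ℤ.+ V J m
      ≡⟨ cong (ℤ._+ V J m) (sum-remove {i = m} (λ i → V J i ℤ.* + below (κ (J i)) (κ (J m)))) ⟨
    partial J (κ (J m)) ℤ.+ V J m ∎
    where
    open ≡-Reasoning
    rest : ℤ
    rest = sum (λ i → V J (punchIn m i) ℤ.* + below (κ (J (punchIn m i))) (κ (J m)))
    same : ∀ i → below (κ (J (punchIn m i))) θ ≡ below (κ (J (punchIn m i))) (κ (J m))
    same i with punchIn m i Fin.<? m
    ... | yes i<m = trans (below-< (below-θ sep _ (ℕ.<⇒≤ i<m))) (sym (below-< (sorted E i<m)))
    ... | no  i≮m = trans (below-≥ (above-θ sep _ (punchIn-< m i i≮m)))
        (sym (below-≥ (ℕ.<⇒≤ (sorted E (punchIn-< m i i≮m)))))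

  -- θ ends the gap above κ (J m), and e S is the sum of the V J i with κ (J i) < θ.
  record Next {n} (J : Fin (suc n) → ℕ) (m : Fin (suc n)) (θ : ℕ) (e : ℤ) : Set where
    field
      separates : Separates J m θ
      partial-θ : partial J θ ≡ e ℤ.* S J

  open Next

  V≡ : ∀ {n J m θ e} → Enumeration n J → Next J m θ e → V J m ≡ (+ f (J m) ℤ.+ e) ℤ.* S J
  V≡ {n} {J} {m} {θ} {e} E next = begin
    V J m ≡⟨ lemma (partial J (κ (J m))) (V J m) ⟩
    (partial J (κ (J m)) ℤ.+ V J m) ℤ.- partial J (κ (J m)) ≡⟨ cong₂ ℤ._-_
        (trans (sym (partial-step E (separates next))) (partial-θ next)) (partial≡-fS J (J m) (bounded E m)) ⟩
    e ℤ.* S J ℤ.- - + f (J m) ℤ.* S J ≡⟨ lemma′ e (S J) (+ f (J m)) ⟩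
    (+ f (J m) ℤ.+ e) ℤ.* S J ∎
    where
    open ≡-Reasoning
    lemma : ∀ x y → y ≡ (x ℤ.+ y) ℤ.- x
    lemma = ℤSolver.solve-∀
    lemma′ : ∀ e s f → e ℤ.* s ℤ.- - f ℤ.* s ≡ (f ℤ.+ e) ℤ.* s
    lemma′ = ℤSolver.solve-∀

  next-suc : ∀ {n J m m⁺} → Enumeration n J → toℕ m⁺ ≡ suc (toℕ m) → Next J m (κ (J m⁺)) (- + f (J m⁺))
  next-suc {J = J} {m⁺ = m⁺} E m⁺≡1+m = record
    { separates = record
      { below-θ = λ i i≤m → sorted E (subst (_ ℕ.<_) (sym m⁺≡1+m) (s≤s i≤m))
      ; above-θ = λ i m<i → increasing-mono-≤ {x = κ ∘ J} (sorted E) (subst (ℕ._≤ _) (sym m⁺≡1+m) m<i) }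
    ; partial-θ = partial≡-fS J (J m⁺) (bounded E m⁺) }

  partial-N : ∀ {n} (J : Fin (suc n) → ℕ) → partial J N ≡ 1ℤ ℤ.* S J
  partial-N J = trans (sum-cong-≗ λ i → trans (cong (λ x → V J i ℤ.* + x) (below-< (κ<N (J i))))
      (ℤ.*-identityʳ (V J i))) (sym (ℤ.*-identityˡ (S J)))

  -- No parameter follows that of the last row. The threshold `N` exceeds all of them, so the
  -- partial sum is all of `S J`, whence the value 1.
  next-last : ∀ {n J m} → toℕ m ≡ n → Next {n} J m N 1ℤ
  next-last {n} {J} m≡n = record
    { separates = record
      { below-θ = λ i _ → κ<N (J i)
      ; above-θ = λ i m<i → contradiction (ℕ.≤-pred (Fin.toℕ<n i)) (ℕ.<⇒≱ (subst (ℕ._< toℕ i) m≡n m<i)) }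
    ; partial-θ = partial-N J }

  rows-remove : ∀ {n} (J : Fin (suc (suc n)) → ℕ) m i j →
    dropLastColumn (dropRow m (rows J)) i j ≡ rows (J ∘ punchIn m) i j
  rows-remove J m i j = cong (λ c → + prefix (κ (J (punchIn m i))) (suc c) ℤ.- + prefix (κ (J (punchIn m i))) c)
      (toℕ-punchIn-fromℕ j)

  -- Without row `m` and the last column, the matrix for `suc n` is the matrix for `n`. The minor is
  -- therefore the pairing of the smaller `V` with the last column, a difference of two prefix
  -- counts of which the second is annihilated.
  V-removed : ∀ {n J m θ e} → Enumeration (suc n) J → J m ≡ suc n → Separates J m θ →
    partial (J ∘ punchIn m) θ ≡ e ℤ.* S (J ∘ punchIn m) →
    V J m ≡ negOnePow (suc n) ℤ.* (sgn m ℤ.* ((+ f (J m) ℤ.+ e) ℤ.* S (J ∘ punchIn m)))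
  V-removed {n} {J} {m} {θ} {e} E Jm≡1+n sep pθ = cong (λ x → negOnePow (suc n) ℤ.* (sgn m ℤ.* x)) (begin
    ∣ dropRow m (rows J) ∣ₘ
      ≡⟨ ∣∣ₘ-expandLastColumn (dropRow m (rows J)) ⟩
    sum (λ i → cofactors (dropLastColumn (dropRow m (rows J))) i ℤ.* rows J (punchIn m i) (fromℕ n))
      ≡⟨ sum-cong-≗ (λ i → cong₂ ℤ._*_ (cofactors-cong (rows-remove J m) i)
           (cong (λ c → + prefix (κ (J′ i)) (suc c) ℤ.- + prefix (κ (J′ i)) c) (Fin.toℕ-fromℕ n))) ⟩
    sum (λ i → V J′ i ℤ.* (+ prefix (κ (J′ i)) (suc n) ℤ.- + prefix (κ (J′ i)) n))
      ≡⟨ sum-difference J′ n ⟩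
    sum (λ i → V J′ i ℤ.* + prefix (κ (J′ i)) (suc n)) ℤ.- sum (λ i → V J′ i ℤ.* + prefix (κ (J′ i)) n)
      ≡⟨ cong₂ ℤ._-_ (V-prefix J′ (suc n)) (V-prefix≡0 J′ n ℕ.≤-refl) ⟩
    (+ f (suc n) ℤ.* S J′ ℤ.+ partial J′ (κ (suc n))) ℤ.- 0ℤ
      ≡⟨ ℤ.+-identityʳ _ ⟩
    + f (suc n) ℤ.* S J′ ℤ.+ partial J′ (κ (suc n))
      ≡⟨ cong₂ (λ x y → + f x ℤ.* S J′ ℤ.+ y) (sym Jm≡1+n) (trans partial≡ pθ) ⟩
    + f (J m) ℤ.* S J′ ℤ.+ e ℤ.* S J′
      ≡⟨ ℤ.*-distribʳ-+ (S J′) (+ f (J m)) e ⟨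
    (+ f (J m) ℤ.+ e) ℤ.* S J′ ∎)
    where
    open ≡-Reasoning
    J′ = J ∘ punchIn m
    -- Row `m` is gone, and no other parameter lies between `κ (suc n)` and `θ`.
    partial≡ : partial J′ (κ (suc n)) ≡ partial J′ θ
    partial≡ = sum-cong-≗ λ i → cong (λ x → V J′ i ℤ.* + x)
        (trans (cong (λ x → below (κ (J′ i)) (κ x)) (sym Jm≡1+n)) (same i))
      where
      same : ∀ i → below (κ (J′ i)) (κ (J m)) ≡ below (κ (J′ i)) θ
      same i with punchIn m i Fin.<? m
      ... | yes i<m = trans (below-< (sorted E i<m)) (sym (below-< (below-θ sep _ (ℕ.<⇒≤ i<m))))
      ... | no  i≮m = trans (below-≥ (ℕ.<⇒≤ (sorted E (punchIn-< m i i≮m))))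
          (sym (below-≥ (above-θ sep _ (punchIn-< m i i≮m))))

  module _ {n J m} (n<N : suc n < N) (E : Enumeration (suc n) J) (Jm≡1+n : J m ≡ suc n) where

    private
      J′ = J ∘ punchIn m

    cancel : ∀ {θ} e → .⦃ _ : ℤ.NonZero (+ f (J m) ℤ.+ e) ⦄ → Next J m θ e → partial J′ θ ≡ e ℤ.* S J′ →
      S J ≡ negOnePow (suc n) ℤ.* (sgn m ℤ.* S J′)
    cancel e next pθ = ℤ.*-cancelˡ-≡ (+ f (J m) ℤ.+ e) _ _ (begin
      y ℤ.* S J ≡⟨ V≡ E next ⟨
      V J m ≡⟨ V-removed {e = e} E Jm≡1+n (separates next) pθ ⟩
      negOnePow (suc n) ℤ.* (sgn m ℤ.* (y ℤ.* S J′)) ≡⟨ lemma (negOnePow (suc n)) (sgn m) y (S J′) ⟩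
      y ℤ.* (negOnePow (suc n) ℤ.* (sgn m ℤ.* S J′)) ∎)
      where
      open ≡-Reasoning
      y = + f (J m) ℤ.+ e
      lemma : ∀ x z y s → x ℤ.* (z ℤ.* (y ℤ.* s)) ≡ y ℤ.* (x ℤ.* (z ℤ.* s))
      lemma = ℤSolver.solve-∀

    -- If the quotients agreed, the larger remainder of `J m⁺` would make `J m⁺ * a` exceed
    -- `J m * a`, although `J m` is the largest index.
    f-next : ∀ m⁺ → toℕ m⁺ ≡ suc (toℕ m) → + f (J m) ℤ.+ - + f (J m⁺) ≢ 0ℤ
    f-next m⁺ m⁺≡1+m eq = ℕ.<⇒≱ (sorted E m<m⁺) (ℕ.+-cancelʳ-≤ (f (J m) * N) (κ (J m⁺)) (κ (J m)) (begin
      κ (J m⁺) + f (J m) * N  ≡⟨ cong (λ x → κ (J m⁺) + x * N)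
          (ℤ.+-injective (ℤ.i-j≡0⇒i≡j (+ f (J m)) (+ f (J m⁺)) eq)) ⟩
      κ (J m⁺) + f (J m⁺) * N ≡⟨ κ+fN (J m⁺) ⟨
      J m⁺ * a                ≤⟨ ℕ.*-monoˡ-≤ a (subst (J m⁺ ≤_) (sym Jm≡1+n) (bounded E m⁺)) ⟩
      J m * a                 ≡⟨ κ+fN (J m) ⟩
      κ (J m) + f (J m) * N ∎))
      where
      open ℕ.≤-Reasoning
      m<m⁺ : m Fin.< m⁺
      m<m⁺ = subst (toℕ m ℕ.<_) (sym m⁺≡1+m) (ℕ.n<1+n (toℕ m))

    S-remove : S J ≡ negOnePow (suc n) ℤ.* (sgn m ℤ.* S J′)
    S-remove with toℕ m ℕ.≟ suc n
    ... | yes m≡1+n = cancel 1ℤ ⦃ subst ℤ.NonZero (cong +_ (ℕ.+-comm 1 (f (J m)))) _ ⦄ (next-last m≡1+n)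
        (partial-N J′)
    -- `J m⁺` is not the removed index, so it still occurs in `J′`, where the partial sum at its
    -- parameter is given by the same formula.
    ... | no  m≢1+n = cancel (- + f (J m⁺)) ⦃ ℤ.≢-nonZero (f-next m⁺ m⁺≡1+m) ⦄ (next-suc E m⁺≡1+m)
        (subst (λ j → partial J′ (κ j) ≡ - + f j ℤ.* S J′) Ji≡
        (partial≡-fS J′ (J′ i) (bounded (remove n<N E Jm≡1+n) i)))
      where
      1+m<2+n : suc (toℕ m) < suc (suc n)
      1+m<2+n = s≤s (ℕ.≤∧≢⇒< (ℕ.≤-pred (Fin.toℕ<n m)) m≢1+n)
      m⁺ : Fin (suc (suc n))
      m⁺ = fromℕ< 1+m<2+n
      m⁺≡1+m : toℕ m⁺ ≡ suc (toℕ m)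
      m⁺≡1+m = Fin.toℕ-fromℕ< 1+m<2+n
      m≢m⁺ : m ≢ m⁺
      m≢m⁺ eq = ℕ.<⇒≢ (ℕ.n<1+n (toℕ m)) (trans (cong toℕ eq) m⁺≡1+m)
      i : Fin (suc n)
      i = punchOut m≢m⁺
      Ji≡ : J′ i ≡ J m⁺
      Ji≡ = cong J (Fin.punchIn-punchOut m≢m⁺)

-- Finite sums and powers of -1.

sumTo-cong : ∀ n {F G : ℕ → ℕ} → (∀ x → x < n → F x ≡ G x) → sumTo n F ≡ sumTo n G
sumTo-cong zero    F≗G = refl
sumTo-cong (suc n) F≗G = cong₂ _+_ (sumTo-cong n λ x x<n → F≗G x (ℕ.m<n⇒m<1+n x<n)) (F≗G n (ℕ.n<1+n n))

sumTo-zero : ∀ n {F : ℕ → ℕ} → (∀ x → x < n → F x ≡ 0) → sumTo n F ≡ 0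
sumTo-zero zero    F≗0 = refl
sumTo-zero (suc n) F≗0 = cong₂ _+_ (sumTo-zero n λ x x<n → F≗0 x (ℕ.m<n⇒m<1+n x<n)) (F≗0 n (ℕ.n<1+n n))

sumTo-one : ∀ n → sumTo n (λ _ → 1) ≡ n
sumTo-one zero    = refl
sumTo-one (suc n) = trans (cong (_+ 1) (sumTo-one n)) (ℕ.+-comm n 1)

sumTo-distrib-+ : ∀ n (F G : ℕ → ℕ) → sumTo n (λ x → F x + G x) ≡ sumTo n F + sumTo n G
sumTo-distrib-+ zero    F G = refl
sumTo-distrib-+ (suc n) F G = trans (cong (_+ (F n + G n)) (sumTo-distrib-+ n F G))
    (interchange (sumTo n F) (sumTo n G) (F n) (G n))
  where
  interchange : ∀ a b c d → a + b + (c + d) ≡ a + c + (b + d)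
  interchange = ℕSolver.solve-∀

sumTo-++ : ∀ m n (F : ℕ → ℕ) → sumTo (m + n) F ≡ sumTo m F + sumTo n (λ x → F (m + x))
sumTo-++ m zero    F = trans (cong (λ k → sumTo k F) (ℕ.+-identityʳ m)) (sym (ℕ.+-identityʳ _))
sumTo-++ m (suc n) F = begin
  sumTo (m + suc n) F                                   ≡⟨ cong (λ k → sumTo k F) (ℕ.+-suc m n) ⟩
  sumTo (m + n) F + F (m + n)                           ≡⟨ cong (_+ F (m + n)) (sumTo-++ m n F) ⟩
  sumTo m F + sumTo n (λ x → F (m + x)) + F (m + n)     ≡⟨ ℕ.+-assoc (sumTo m F) _ _ ⟩
  sumTo m F + (sumTo n (λ x → F (m + x)) + F (m + n)) ∎
  where open ≡-Reasoning

sumTo-suc : ∀ n (F : ℕ → ℕ) → sumTo (suc n) F ≡ F 0 + sumTo n (F ∘ suc)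
sumTo-suc n F = sumTo-++ 1 n F

sumTo-reverse : ∀ n (F : ℕ → ℕ) → sumTo n F ≡ sumTo n (λ x → F (n ∸ suc x))
sumTo-reverse zero    F = refl
sumTo-reverse (suc n) F = begin
  sumTo n F + F n                              ≡⟨ ℕ.+-comm (sumTo n F) (F n) ⟩
  F n + sumTo n F                              ≡⟨ cong (_+_ (F n)) (sumTo-reverse n F) ⟩
  F n + sumTo n (λ x → F (n ∸ suc x))          ≡⟨ sumTo-suc n (λ x → F (suc n ∸ suc x)) ⟨
  sumTo (suc n) (λ x → F (suc n ∸ suc x)) ∎
  where open ≡-Reasoning

sumTo-comm : ∀ m n (F : ℕ → ℕ → ℕ) → sumTo m (λ x → sumTo n (F x)) ≡ sumTo n (λ y → sumTo m (λ x → F x y))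
sumTo-comm zero    n F = sym (sumTo-zero n λ _ _ → refl)
sumTo-comm (suc m) n F = trans (cong (_+ sumTo n (F m)) (sumTo-comm m n F))
    (sym (sumTo-distrib-+ n (λ y → sumTo m (λ x → F x y)) (F m)))

negOnePow-+ : ∀ m n → negOnePow (m + n) ≡ negOnePow m ℤ.* negOnePow n
negOnePow-+ zero    n = sym (ℤ.*-identityˡ (negOnePow n))
negOnePow-+ (suc m) n = trans (cong (-1ℤ ℤ.*_) (negOnePow-+ m n)) (sym (ℤ.*-assoc -1ℤ (negOnePow m) (negOnePow n)))

negOnePow-square : ∀ m → negOnePow m ℤ.* negOnePow m ≡ 1ℤ
negOnePow-square zero    = refl
negOnePow-square (suc m) = trans (lemma (negOnePow m)) (negOnePow-square m)
  where
  lemma : ∀ x → (-1ℤ ℤ.* x) ℤ.* (-1ℤ ℤ.* x) ≡ x ℤ.* x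
  lemma = ℤSolver.solve-∀

modN≡% : ∀ x N .⦃ _ : NonZero N ⦄ → modN x N ≡ x % N
modN≡% x (suc N) = refl

divN≡/ : ∀ x N .⦃ _ : NonZero N ⦄ → divN x N ≡ x / N
divN≡/ x (suc N) = refl

-- The sign of S as an inversion count, and the exponent t.

module RotationSign (N a b p q : ℕ) ⦃ _ : NonZero N ⦄ (ab≡1+Np : a * b ≡ 1 + N * p) (a+q≡N : a + q ≡ N) where

  open Rotation N a b p ab≡1+Np

  inversion? : ℕ → ℕ → ℕ
  inversion? x y = if (1 ≤ᵇ x) ∧ (x <ᵇ y) ∧ (modN (a * y) N <ᵇ modN (a * x) N) then 1 else 0

  inversionsAt : ℕ → ℕ
  inversionsAt y = sumTo N λ x → inversion? x y

  modN≡κ : ∀ x → modN (a * x) N ≡ κ x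
  modN≡κ x = trans (modN≡% (a * x) N) (cong (_% N) (ℕ.*-comm a x))

  inversion?-≥ : ∀ {x y} → y ≤ x → inversion? x y ≡ 0
  inversion?-≥ {zero}  y≤x = refl
  inversion?-≥ {suc x} {y} y≤x with suc x <ᵇ y in eq
  ... | false = refl
  ... | true  = contradiction y≤x (ℕ.<⇒≱ (ℕ.<ᵇ⇒< (suc x) y (subst T (sym eq) _)))

  inversion?-< : ∀ {x y} → x < y → y < N → inversion? x y + below (κ x) (κ y) ≡ 1
  -- `κ 0 = 0` is below every other value, in accordance with the count 0 that `inversion?` assigns
  -- to `x = 0`.
  inversion?-< {zero}  {y} x<y y<N = below-<
      (ℕ.≤∧≢⇒< (subst (_≤ κ y) (sym κ-zero) z≤n) (λ eq → ℕ.<⇒≢ x<y (κ-injective (ℕ.<-trans x<y y<N) y<N eq)))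
  inversion?-< {suc x} {y} x<y y<N with suc x <ᵇ y in eq
  ... | false = ⊥-elim (subst T eq (ℕ.<⇒<ᵇ x<y))
  ... | true  = trans (cong (_+ below (κ (suc x)) (κ y)) (cong₂ below (modN≡κ y) (modN≡κ (suc x)))) dichotomy
    where
    dichotomy : below (κ y) (κ (suc x)) + below (κ (suc x)) (κ y) ≡ 1
    dichotomy with ℕ.<-cmp (κ y) (κ (suc x))
    ... | tri< < _ _ = cong₂ _+_ (below-< <) (below-≥ (ℕ.<⇒≤ <))
    ... | tri≈ _ ≡ _ = contradiction (κ-injective y<N (ℕ.<-trans x<y y<N) ≡) (ℕ.<⇒≢ x<y ∘ sym)
    ... | tri> _ _ > = cong₂ _+_ (below-≥ (ℕ.<⇒≤ >)) (below-< >)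

  inversionsAt-+ : ∀ {y} → y < N → inversionsAt y + sumTo y (λ x → below (κ x) (κ y)) ≡ y
  inversionsAt-+ {y} y<N = begin
    sumTo N (λ x → inversion? x y) + B
      ≡⟨ cong (λ k → sumTo k (λ x → inversion? x y) + B) (ℕ.m+[n∸m]≡n (ℕ.<⇒≤ y<N)) ⟨
    sumTo (y + (N ∸ y)) (λ x → inversion? x y) + B
      ≡⟨ cong (_+ B) (sumTo-++ y (N ∸ y) (λ x → inversion? x y)) ⟩
    sumTo y (λ x → inversion? x y) + sumTo (N ∸ y) (λ x → inversion? (y + x) y) + B
      ≡⟨ cong (_+ B) (trans (cong (_+_ (sumTo y (λ x → inversion? x y)))
          (sumTo-zero (N ∸ y) λ x _ → inversion?-≥ (ℕ.m≤m+n y x))) (ℕ.+-identityʳ _)) ⟩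
    sumTo y (λ x → inversion? x y) + B
      ≡⟨ sumTo-distrib-+ y _ _ ⟨
    sumTo y (λ x → inversion? x y + below (κ x) (κ y))
      ≡⟨ sumTo-cong y (λ x x<y → inversion?-< x<y y<N) ⟩
    sumTo y (λ _ → 1) ≡⟨ sumTo-one y ⟩
    y ∎
    where
    open ≡-Reasoning
    B = sumTo y (λ x → below (κ x) (κ y))

  -- The step `S-remove` contributes the exponent `suc n` plus the position `m` of `suc n`. That
  -- position counts the smaller indices with smaller κ, so `suc n` minus `m`, which has the same
  -- parity, is the number of inversions whose larger index is `suc n`.
  S≡inversions : ∀ {n J} → n < N → Enumeration n J → S J ≡ negOnePow (sumTo (suc n) inversionsAt)
  S≡inversions {zero} {J} _ E = sym (cong negOnePow (sumTo-zero N λ x _ → inversion?-≥ {x} z≤n))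
  S≡inversions {suc n} {J} n<N E with Enumeration.surjective E {suc n} ℕ.≤-refl
  ... | m , Jm≡1+n = begin
    S J ≡⟨ S-remove n<N E Jm≡1+n ⟩
    negOnePow (suc n) ℤ.* (sgn m ℤ.* S (J ∘ punchIn m))
      ≡⟨ cong₂ (λ x y → negOnePow x ℤ.* (sgn m ℤ.* y)) (sym I+m≡1+n)
          (S≡inversions (ℕ.<-trans (ℕ.n<1+n n) n<N) (remove n<N E Jm≡1+n)) ⟩
    negOnePow (I + toℕ m) ℤ.* (sgn m ℤ.* s) ≡⟨ cong (ℤ._* (sgn m ℤ.* s)) (negOnePow-+ I (toℕ m)) ⟩
    (negOnePow I ℤ.* sgn m) ℤ.* (sgn m ℤ.* s) ≡⟨ rearrange (negOnePow I) (sgn m) s ⟩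
    (sgn m ℤ.* sgn m) ℤ.* (s ℤ.* negOnePow I) ≡⟨ cong (ℤ._* (s ℤ.* negOnePow I)) (negOnePow-square (toℕ m)) ⟩
    1ℤ ℤ.* (s ℤ.* negOnePow I) ≡⟨ ℤ.*-identityˡ (s ℤ.* negOnePow I) ⟩
    s ℤ.* negOnePow I ≡⟨ negOnePow-+ (sumTo (suc n) inversionsAt) I ⟨
    negOnePow (sumTo (suc n) inversionsAt + I) ∎
    where
    open ≡-Reasoning
    I = inversionsAt (suc n)
    s = negOnePow (sumTo (suc n) inversionsAt)
    rearrange : ∀ i m s → (i ℤ.* m) ℤ.* (m ℤ.* s) ≡ (m ℤ.* m) ℤ.* (s ℤ.* i)
    rearrange = ℤSolver.solve-∀
    rank-m : sumTo (suc n) (λ x → below (κ x) (κ (suc n))) ≡ toℕ m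
    rank-m = begin
      sumTo (suc n) (λ x → below (κ x) (κ (suc n)))
        ≡⟨ trans (cong (_+_ (sumTo (suc n) (λ x → below (κ x) (κ (suc n))))) (below-≥ {κ (suc n)} ℕ.≤-refl))
            (ℕ.+-identityʳ _) ⟨
      sumTo (suc (suc n)) (λ x → below (κ x) (κ (suc n)))
        ≡⟨ cong (λ j → sumTo (suc (suc n)) (λ x → below (κ x) (κ j))) Jm≡1+n ⟨
      sumTo (suc (suc n)) (λ x → below (κ x) (κ (J m)))
        ≡⟨ position n<N E m ⟩
      toℕ m ∎
    I+m≡1+n : I + toℕ m ≡ suc n
    I+m≡1+n = trans (cong (_+_ I) (sym rank-m)) (inversionsAt-+ n<N)

  κ-orbit : ∀ {k} → k < N → κ (k * b % N) ≡ k
  κ-orbit = Rotation.κb N b a p (trans (ℕ.*-comm b a) ab≡1+Np)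

  orbit : ∀ {n} → Fin (suc n) → ℕ
  orbit m = toℕ m * b % N

  orbit-enumeration : ∀ {n} → suc n ≡ N → Enumeration n orbit
  orbit-enumeration {n} refl = record
    { sorted     = λ {i} {i′} i<i′ → subst₂ _<_ (sym (κ-orbit (Fin.toℕ<n i))) (sym (κ-orbit (Fin.toℕ<n i′))) i<i′
    ; bounded    = λ i → ℕ.≤-pred (ℕ.m%n<n (toℕ i * b) N)
    ; surjective = λ {j} j≤n → fromℕ< (κ<N j) , trans (cong (λ k → k * b % N) (Fin.toℕ-fromℕ< (κ<N j))) (κb (s≤s j≤n))
    }

  -- For `n = N - 1` the κ-order is the orbit of 0 under adding `b`; smaller `n` are reached by
  -- deleting the largest index `i` times.
  enumeration : ∀ i {n} → i + suc n ≡ N → ∃ (Enumeration n)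
  enumeration zero    eq = orbit , orbit-enumeration eq
  enumeration (suc i) {n} eq with enumeration i (trans (ℕ.+-suc i (suc n)) eq)
  ... | J , E with Enumeration.surjective E ℕ.≤-refl
  ... | m , Jm≡1+n = J ∘ punchIn m , remove (subst (suc n <_) eq (s≤s (ℕ.m≤n+m (suc n) i))) E Jm≡1+n

  count-κ : ∀ {k} → k < N → sumTo N (λ x → below (κ x) k) ≡ k
  count-κ {k} k<N = go N refl
    where
    go : ∀ M → M ≡ N → sumTo M (λ x → below (κ x) k) ≡ k
    go zero    0≡N = contradiction (subst (k <_) (sym 0≡N) k<N) λ()
    go (suc n) eq = trans (cong (λ t → sumTo (suc n) (λ x → below (κ x) t)) (sym κJm≡k))
      (trans (position (subst (n <_) eq (ℕ.n<1+n n)) (orbit-enumeration eq) m) (Fin.toℕ-fromℕ< k<1+n))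
      where
      k<1+n = subst (k <_) (sym eq) k<N
      m : Fin (suc n)
      m = fromℕ< k<1+n
      κJm≡k : κ (orbit m) ≡ k
      κJm≡k = trans (κ-orbit (subst (toℕ m <_) eq (Fin.toℕ<n m))) (Fin.toℕ-fromℕ< k<1+n)

  modN-q : ∀ {l y} → l + y ≡ N → modN (l * q) N ≡ κ y
  modN-q {l} {y} l+y≡N = begin
    modN (l * q) N            ≡⟨ modN≡% (l * q) N ⟩
    l * q % N                 ≡⟨ ℕ.[m+kn]%n≡m%n (l * q) a N ⟨
    (l * q + a * N) % N       ≡⟨ cong (λ M → (l * q + a * M) % N) l+y≡N ⟨
    (l * q + a * (l + y)) % N ≡⟨ cong (_% N) (lemma l q a y) ⟩
    (y * a + l * (a + q)) % N ≡⟨ cong (λ M → (y * a + l * M) % N) a+q≡N ⟩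
    (y * a + l * N) % N       ≡⟨ ℕ.[m+kn]%n≡m%n (y * a) l N ⟩
    κ y ∎
    where
    open ≡-Reasoning
    lemma : ∀ l q a y → l * q + a * (l + y) ≡ y * a + l * (a + q)
    lemma = ℕSolver.solve-∀

  dCount≡ : ∀ {l y} → l + y ≡ N → dCount N q l ≡ sumTo l (λ x → below (κ (y + x)) (κ y))
  dCount≡ {l} {y} l+y≡N = trans (sumTo-suc l _) (trans
    (sumTo-cong l (λ x x<l → cong₂ below (modN-q {suc x} {y + (l ∸ suc x)} (complement x x<l)) (modN-q {l} l+y≡N)))
    (sym (sumTo-reverse l (λ x → below (κ (y + x)) (κ y)))))
    where
    complement : ∀ x → x < l → suc x + (y + (l ∸ suc x)) ≡ N
    complement x x<l = begin
      suc x + (y + (l ∸ suc x)) ≡⟨ lemma (suc x) y (l ∸ suc x) ⟩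
      suc x + (l ∸ suc x) + y   ≡⟨ cong (_+ y) (ℕ.m+[n∸m]≡n x<l) ⟩
      l + y                     ≡⟨ l+y≡N ⟩
      N ∎
      where
      open ≡-Reasoning
      lemma : ∀ x y z → x + (y + z) ≡ x + z + y
      lemma = ℕSolver.solve-∀

  -- `κ y` is the number of all `x` with `κ x < κ y`. Those above `y` are the ones that `dCount`
  -- sees, in reverse order, because `q ≡ - a` modulo `N`; those below `y` are the non-inversions
  -- `c`. Since `y = N - l` is the sum of its inversions and of `c`, only the inversions remain.
  tExp-term : ∀ {l y} → l + y ≡ N → y < N →
    + N ℤ.- + l ℤ.+ + dCount N q l ℤ.- + modN (l * q) N ≡ + inversionsAt y
  tExp-term {l} {y} l+y≡N y<N = begin
    + N ℤ.- + l ℤ.+ + dCount N q l ℤ.- + modN (l * q) N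
      ≡⟨ cong₂ (λ M k → + M ℤ.- + l ℤ.+ + dCount N q l ℤ.- + k) (sym l+I+c≡N) (trans (modN-q {l} l+y≡N) κy≡) ⟩
    (+ l ℤ.+ (+ I ℤ.+ + c)) ℤ.- + l ℤ.+ + dCount N q l ℤ.- (+ c ℤ.+ + dCount N q l)
      ≡⟨ lemma (+ l) (+ I) (+ c) (+ dCount N q l) ⟩
    + I ∎
    where
    open ≡-Reasoning
    I = inversionsAt y
    c = sumTo y (λ x → below (κ x) (κ y))
    l+I+c≡N : l + (I + c) ≡ N
    l+I+c≡N = trans (cong (_+_ l) (inversionsAt-+ y<N)) l+y≡N
    κy≡ : κ y ≡ c + dCount N q l
    κy≡ = begin
      κ y ≡⟨ count-κ (κ<N y) ⟨
      sumTo N (λ x → below (κ x) (κ y)) ≡⟨ cong (λ M → sumTo M (λ x → below (κ x) (κ y)))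
          (trans (ℕ.+-comm y l) l+y≡N) ⟨
      sumTo (y + l) (λ x → below (κ x) (κ y)) ≡⟨ sumTo-++ y l (λ x → below (κ x) (κ y)) ⟩
      c + sumTo l (λ x → below (κ (y + x)) (κ y)) ≡⟨ cong (_+_ c) (dCount≡ {l} l+y≡N) ⟨
      c + dCount N q l ∎
    lemma : ∀ l I c d → (l ℤ.+ (I ℤ.+ c)) ℤ.- l ℤ.+ d ℤ.- (c ℤ.+ d) ≡ I
    lemma = ℤSolver.solve-∀

  tExp≡ : ∀ i {n} → i + suc n ≡ N → tExp N q i ≡ + sumTo i (λ x → inversionsAt (suc n + x))
  tExp≡ zero    _  = refl
  tExp≡ (suc i) {n} eq = begin
    tExp N q i ℤ.+ (+ N ℤ.- + suc i ℤ.+ + dCount N q (suc i) ℤ.- + modN (suc i * q) N)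
      ≡⟨ cong₂ ℤ._+_ (tExp≡ i {suc n} (trans (ℕ.+-suc i (suc n)) eq))
          (tExp-term {suc i} {suc n} eq (subst (suc n <_) eq (s≤s (ℕ.m≤n+m (suc n) i)))) ⟩
    + (sumTo i (λ x → inversionsAt (suc (suc n) + x)) + inversionsAt (suc n))
      ≡⟨ cong +_ (trans (ℕ.+-comm _ (inversionsAt (suc n))) (trans
           (cong₂ _+_ (cong inversionsAt (sym (ℕ.+-identityʳ (suc n))))
               (sumTo-cong i λ x _ → cong inversionsAt (sym (ℕ.+-suc (suc n) x))))
           (sym (sumTo-suc i (λ x → inversionsAt (suc n + x)))))) ⟩
    + sumTo (suc i) (λ x → inversionsAt (suc n + x)) ∎
    where open ≡-Reasoning

  -- The inversions split by their larger index: up to `n` they give `S J`, above `n` they give the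
  -- exponent t. Multiplying the total sign by that of t again leaves the first part.
  S≡sign : ∀ i {n J} → i + suc n ≡ N → Enumeration n J → S J ≡ multSign N a ℤ.* negOnePowℤ (tExp N q i)
  S≡sign i {n} {J} eq E = begin
    S J ≡⟨ S≡inversions (subst (suc n ≤_) eq (ℕ.m≤n+m (suc n) i)) E ⟩
    negOnePow s ≡⟨ lemma (negOnePow s) (negOnePow t) (negOnePow-square t) ⟩
    (negOnePow s ℤ.* negOnePow t) ℤ.* negOnePow t ≡⟨ cong (ℤ._* negOnePow t) (negOnePow-+ s t) ⟨
    negOnePow (s + t) ℤ.* negOnePow t ≡⟨ cong (λ x → negOnePow x ℤ.* negOnePow t) s+t≡ ⟨
    multSign N a ℤ.* negOnePow t ≡⟨ cong (λ x → multSign N a ℤ.* negOnePowℤ x) (tExp≡ i eq) ⟨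
    multSign N a ℤ.* negOnePowℤ (tExp N q i) ∎
    where
    open ≡-Reasoning
    s = sumTo (suc n) inversionsAt
    t = sumTo i (λ x → inversionsAt (suc n + x))
    s+t≡ : inversions N a ≡ s + t
    s+t≡ = trans (sumTo-comm N N inversion?)
        (trans (cong (λ M → sumTo M inversionsAt) (trans (sym eq) (ℕ.+-comm i (suc n))))
        (sumTo-++ (suc n) i inversionsAt))
    lemma : ∀ x y → y ℤ.* y ≡ 1ℤ → x ≡ (x ℤ.* y) ℤ.* y
    lemma x y y²≡1 = sym (trans (ℤ.*-assoc x y y) (trans (cong (x ℤ.*_) y²≡1) (ℤ.*-identityʳ x)))

-- Three-interval exchanges as first-return maps of a rotation.

compPerm-I₁ : ∀ {c₁ c₂ c₃ j} → j < c₁ → compPerm c₁ c₂ c₃ j ≡ j + c₂ + c₃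
compPerm-I₁ {c₁} {j = j} j<c₁ with j <ᵇ c₁ in eq
... | true  = refl
... | false = ⊥-elim (subst T eq (ℕ.<⇒<ᵇ j<c₁))

compPerm-I₂ : ∀ {c₁ c₂ c₃ j} → c₁ ≤ j → j < c₁ + c₂ → compPerm c₁ c₂ c₃ j ≡ (j ∸ c₁) + c₃
compPerm-I₂ {c₁} {c₂} {j = j} c₁≤j j<c₁+c₂ with j <ᵇ c₁ in eq
... | true  = contradiction c₁≤j (ℕ.<⇒≱ (ℕ.<ᵇ⇒< j c₁ (subst T (sym eq) _)))
... | false with j <ᵇ c₁ + c₂ in eq′
...   | true  = refl
...   | false = ⊥-elim (subst T eq′ (ℕ.<⇒<ᵇ j<c₁+c₂))

compPerm-I₃ : ∀ {c₁ c₂ c₃ j} → c₁ + c₂ ≤ j → compPerm c₁ c₂ c₃ j ≡ j ∸ (c₁ + c₂)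
compPerm-I₃ {c₁} {c₂} {j = j} c₁+c₂≤j with j <ᵇ c₁ in eq
... | true  = contradiction (ℕ.≤-trans (ℕ.m≤m+n c₁ c₂) c₁+c₂≤j) (ℕ.<⇒≱ (ℕ.<ᵇ⇒< j c₁ (subst T (sym eq) _)))
... | false with j <ᵇ c₁ + c₂ in eq′
...   | true  = contradiction c₁+c₂≤j (ℕ.<⇒≱ (ℕ.<ᵇ⇒< j (c₁ + c₂) (subst T (sym eq′) _)))
...   | false = refl

module _ {A : Set} {x y z : A} where

  compLetter-I₁ : ∀ {c₁ c₂ j} → j < c₁ → compLetter c₁ c₂ x y z j ≡ x
  compLetter-I₁ {c₁} {j = j} j<c₁ with j <ᵇ c₁ in eq
  ... | true  = refl
  ... | false = ⊥-elim (subst T eq (ℕ.<⇒<ᵇ j<c₁))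

  compLetter-I₂ : ∀ {c₁ c₂ j} → c₁ ≤ j → j < c₁ + c₂ → compLetter c₁ c₂ x y z j ≡ y
  compLetter-I₂ {c₁} {c₂} {j = j} c₁≤j j<c₁+c₂ with j <ᵇ c₁ in eq
  ... | true  = contradiction c₁≤j (ℕ.<⇒≱ (ℕ.<ᵇ⇒< j c₁ (subst T (sym eq) _)))
  ... | false with j <ᵇ c₁ + c₂ in eq′
  ...   | true  = refl
  ...   | false = ⊥-elim (subst T eq′ (ℕ.<⇒<ᵇ j<c₁+c₂))

  compLetter-I₃ : ∀ {c₁ c₂ j} → c₁ + c₂ ≤ j → compLetter c₁ c₂ x y z j ≡ z
  compLetter-I₃ {c₁} {c₂} {j = j} c₁+c₂≤j with j <ᵇ c₁ in eq
  ... | true  = contradiction (ℕ.≤-trans (ℕ.m≤m+n c₁ c₂) c₁+c₂≤j) (ℕ.<⇒≱ (ℕ.<ᵇ⇒< j c₁ (subst T (sym eq) _)))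
  ... | false with j <ᵇ c₁ + c₂ in eq′
  ...   | true  = contradiction c₁+c₂≤j (ℕ.<⇒≱ (ℕ.<ᵇ⇒< j (c₁ + c₂) (subst T (sym eq′) _)))
  ...   | false = refl

-- The rotation by b permutes {0,…,N-1}; its first-return map to {0,…,n} exchanges three intervals.
module FirstReturn (N a b p r c₁ i c₃ n : ℕ) ⦃ _ : NonZero N ⦄ (ab≡1+Np : a * b ≡ 1 + N * p)
  (a≡p+r : a ≡ p + r) (b≡c₃+i : b ≡ c₃ + i) (N≡ : N ≡ c₁ + i + (c₃ + i)) (1+n≡ : suc n ≡ c₁ + i + c₃) (c₃>0 : 0 < c₃) where

  open Rotation N a b p ab≡1+Np
  open Enumeration

  σ : ℕ → ℕ
  σ = compPerm c₁ i c₃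

  letter : ℕ → ℤ
  letter = compLetter c₁ i (- + p) (+ r ℤ.- + p) (+ r)

  1+n≤N : suc n ≤ N
  1+n≤N = subst₂ _≤_ (sym 1+n≡) (sym N≡) (ℕ.+-monoʳ-≤ (c₁ + i) (ℕ.m≤m+n c₃ i))

  -- θ is the κ-value that follows κ j among the κ x with x ≤ n, or N if there is none.
  record Gap (j θ : ℕ) : Set where
    field
      gap-< : κ j < θ
      gap-≤ : ∀ {x} → x ≤ n → κ j < κ x → θ ≤ κ x

  open Gap

  -- The cases match `V≡`: in `inner` the next index in the κ-order is `σ j` and the summand e is
  -- `- f (σ j)`; in `outer` there is none and e is 1. So `letter j` is the factor by which the
  -- entry of `V` at `j` differs from `S`.
  data Successor (j : ℕ) : Set where
    inner : σ j ≤ n → Gap j (κ (σ j)) → letter j ≡ + f j ℤ.- + f (σ j) → Successor j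
    outer : Gap j N → letter j ≡ + f j ℤ.+ 1ℤ → Successor j

  κ+b : ∀ j → (j + b) * a ≡ (κ j + 1) + (f j + p) * N
  κ+b j = begin
    (j + b) * a                     ≡⟨ lemma j b a ⟩
    j * a + a * b                   ≡⟨ cong₂ _+_ (κ+fN j) ab≡1+Np ⟩
    κ j + f j * N + (1 + N * p)     ≡⟨ lemma′ (κ j) (f j) N p ⟩
    (κ j + 1) + (f j + p) * N ∎
    where
    open ≡-Reasoning
    lemma : ∀ j b a → (j + b) * a ≡ j * a + a * b
    lemma = ℕSolver.solve-∀
    lemma′ : ∀ k f N p → k + f * N + (1 + N * p) ≡ (k + 1) + (f + p) * N
    lemma′ = ℕSolver.solve-∀

  b>0 : 0 < b
  b>0 = subst (0 <_) (sym b≡c₃+i) (ℕ.≤-trans c₃>0 (ℕ.m≤m+n c₃ i))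

  N>0 : 0 < N
  N>0 = ℕ.≤-<-trans z≤n (κ<N 0)

  rotate-< : ∀ {j} → j + b < N → κ j + 1 < N × κ (j + b) ≡ κ j + 1 × f (j + b) ≡ f j + p
  rotate-< {j} j+b<N = κj+1<N , divMod-unique N (κ+b j) κj+1<N
    where
    κj+1<N : κ j + 1 < N
    -- If `κ j + 1` were `N`, then `κ (j + b)` would be 0, a value taken below `N` only at the index
    -- 0.
    κj+1<N = ℕ.≤∧≢⇒< (subst (_≤ N) (ℕ.+-comm 1 (κ j)) (κ<N j)) λ eq →
      ℕ.<⇒≢ (ℕ.<-≤-trans b>0 (ℕ.m≤n+m b j)) (κ-injective N>0 j+b<N (trans κ-zero (sym (proj₁
        (divMod-unique {q = suc (f j + p)} {r = 0} N (trans (κ+b j) (cong (_+ (f j + p) * N) eq)) N>0)))))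

  gap-one : ∀ {j} → Gap j (κ j + 1)
  gap-one {j} = record { gap-< = ℕ.≤-reflexive (ℕ.+-comm 1 (κ j)) ; gap-≤ = λ {x} _ lt → subst (_≤ κ x)
      (ℕ.+-comm 1 (κ j)) lt }

  -- The value `κ j + 1` belongs to `j + b`, which lies beyond `n` and is skipped.
  gap-two : ∀ {j} → n < j + b → j + b < N → Gap j (κ j + 2)
  gap-two {j} n<j+b j+b<N = record
    { gap-< = ℕ.m<m+n (κ j) (s≤s z≤n)
    ; gap-≤ = λ {x} x≤n lt → subst (_≤ κ x) (sym (ℕ.+-suc (κ j) 1))
        (ℕ.≤∧≢⇒< (subst (_≤ κ x) (ℕ.+-comm 1 (κ j)) lt) λ eq →
        ℕ.<⇒≢ (ℕ.≤-<-trans x≤n n<j+b) (κ-injective (ℕ.≤-<-trans x≤n 1+n≤N) j+b<N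
            (trans (sym eq) (sym (proj₁ (proj₂ (rotate-< j+b<N)))))))
    }

  -- Covers the returns that pass `N`, after `d` steps of the rotation with total quotient `P`. If
  -- `κ j + d` reaches `N`, then `κ j′ = 0`, so `j′ = 0` and `j` is the last index in the κ-order.
  wrapped : ∀ {j j′ d P} ℓ → Gap j (κ j + d) → j′ ≤ n → σ j ≡ j′ → letter j ≡ ℓ → ℓ ≡ + a ℤ.- + P →
    (j′ + N) * a ≡ (κ j + d) + (f j + P) * N → κ j + d ≤ N → Successor j
  wrapped {j} {j′} {d} {P} ℓ gap j′≤n refl letter≡ ℓ≡ eq κj+d≤N with ℕ.m≤n⇒m<n∨m≡n κj+d≤N
  ... | inj₁ κj+d<N = inner j′≤n (subst (Gap j) (trans (sym (proj₁ dm)) κ+N) gap)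
      (trans letter≡ (trans ℓ≡ (difference (f j) (f j′) a P (trans (sym (proj₂ dm)) f+N))))
    where
    dm = divMod-unique {q = f j + P} N eq κj+d<N
    shifted : ∀ x → (x + N) * a ≡ κ x + (f x + a) * N
    shifted x = trans (lemma x N a) (trans (cong (_+ a * N) (κ+fN x)) (lemma′ (κ x) (f x) a N))
      where
      lemma : ∀ x N a → (x + N) * a ≡ x * a + a * N
      lemma = ℕSolver.solve-∀
      lemma′ : ∀ k f a N → k + f * N + a * N ≡ k + (f + a) * N
      lemma′ = ℕSolver.solve-∀
    κ+N : (j′ + N) * a % N ≡ κ j′
    κ+N = proj₁ (divMod-unique {q = f j′ + a} N (shifted j′) (κ<N j′))
    f+N : (j′ + N) * a / N ≡ f j′ + a
    f+N = proj₂ (divMod-unique {q = f j′ + a} N (shifted j′) (κ<N j′))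
    difference : ∀ x y a P → x + P ≡ y + a → + a ℤ.- + P ≡ + x ℤ.- + y
    difference x y a P eq = begin
      + a ℤ.- + P                       ≡⟨ lemma (+ a) (+ P) (+ y) ⟩
      + (y + a) ℤ.- (+ y ℤ.+ + P)       ≡⟨ cong (λ z → + z ℤ.- (+ y ℤ.+ + P)) eq ⟨
      + (x + P) ℤ.- (+ y ℤ.+ + P)       ≡⟨ lemma′ (+ x) (+ P) (+ y) ⟩
      + x ℤ.- + y ∎
      where
      open ≡-Reasoning
      lemma : ∀ a P y → a ℤ.- P ≡ (y ℤ.+ a) ℤ.- (y ℤ.+ P)
      lemma = ℤSolver.solve-∀
      lemma′ : ∀ x P y → (x ℤ.+ P) ℤ.- (y ℤ.+ P) ≡ x ℤ.- y
      lemma′ = ℤSolver.solve-∀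
  ... | inj₂ κj+d≡N = outer (subst (Gap j) κj+d≡N gap) (trans letter≡ (trans ℓ≡ value))
    where
    eq′ : (j′ + N) * a ≡ 0 + suc (f j + P) * N
    eq′ = trans eq (cong (_+ (f j + P) * N) κj+d≡N)
    κj′≡0 : κ j′ ≡ 0
    κj′≡0 = trans (sym (trans (cong (_% N) (trans (ℕ.*-distribʳ-+ a j′ N) (cong (_+_ (j′ * a)) (ℕ.*-comm N a))))
        (ℕ.[m+kn]%n≡m%n (j′ * a) a N)))
              (proj₁ (divMod-unique {q = suc (f j + P)} N eq′ N>0))
    j′≡0 : j′ ≡ 0
    j′≡0 = κ-injective (ℕ.≤-<-trans j′≤n 1+n≤N) N>0 (trans κj′≡0 (sym κ-zero))
    a≡ : a ≡ suc (f j + P)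
    a≡ = ℕ.*-cancelʳ-≡ a (suc (f j + P)) N (trans (ℕ.*-comm a N) (trans (sym (cong (λ x → (x + N) * a) j′≡0)) eq′))
    value : + a ℤ.- + P ≡ + f j ℤ.+ 1ℤ
    value = trans (cong (λ z → + z ℤ.- + P) a≡) (lemma (+ f j) (+ P))
      where
      lemma : ∀ f P → (1ℤ ℤ.+ (f ℤ.+ P)) ℤ.- P ≡ f ℤ.+ 1ℤ
      lemma = ℤSolver.solve-∀

  -- On the first interval `j + b ≤ n`. On the second `j + b` falls between `n` and `N`, and a
  -- second step wraps around. On the third the first step wraps. Each step adds `p` to the quotient
  -- and the wrap removes `a = p + r`, which gives the letters - p, a - 2p = r - p and a - p = r.
  successor : ∀ {j} → j ≤ n → Successor j
  successor {j} j≤n with j ℕ.<? c₁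
  ... | yes j<c₁ = inner (subst (_≤ n) (sym σj≡) j+b≤n)
      (subst (Gap j) (trans (sym (proj₁ (proj₂ rot))) (cong κ (sym σj≡))) gap-one)
      (trans (compLetter-I₁ j<c₁) (trans (lemma (+ f j) (+ p))
          (cong (λ x → + f j ℤ.- + x) (trans (sym (proj₂ (proj₂ rot))) (cong f (sym σj≡))))))
    where
    σj≡ : σ j ≡ j + b
    σj≡ = trans (compPerm-I₁ {c₁} {i} {c₃} j<c₁)
        (trans (ℕ.+-assoc j i c₃) (cong (_+_ j) (trans (ℕ.+-comm i c₃) (sym b≡c₃+i))))
    j+b≤n : j + b ≤ n
    j+b≤n = ℕ.≤-pred (subst₂ _≤_ (cong suc (cong (_+_ j) (sym b≡c₃+i))) (trans (comm c₁ c₃ i) (sym 1+n≡))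
        (ℕ.+-monoˡ-≤ (c₃ + i) j<c₁))
      where
      comm : ∀ x y z → x + (y + z) ≡ x + z + y
      comm = ℕSolver.solve-∀
    rot = rotate-< (ℕ.≤-<-trans j+b≤n 1+n≤N)
    lemma : ∀ f p → - p ≡ f ℤ.- (f ℤ.+ p)
    lemma = ℤSolver.solve-∀
  ... | no j≮c₁ with j ℕ.<? c₁ + i
  ...   | yes j<c₁+i = wrapped {j} {P = p + p} (+ r ℤ.- + p) (gap-two n<j+b j+b<N) j′≤n
      (compPerm-I₂ c₁≤j j<c₁+i) (compLetter-I₂ c₁≤j j<c₁+i)
      (trans (lemma (+ r) (+ p)) (cong (λ x → + x ℤ.- + (p + p)) (sym a≡p+r)))
      two-steps (subst (_≤ N) (sym (ℕ.+-suc (κ j) 1)) (proj₁ (rotate-< j+b<N)))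
    where
    c₁≤j = ℕ.≮⇒≥ j≮c₁
    c₁+[j-c₁] : c₁ + (j ∸ c₁) ≡ j
    c₁+[j-c₁] = ℕ.m+[n∸m]≡n c₁≤j
    n<j+b : n < j + b
    n<j+b = subst₂ _≤_ (trans (comm c₁ c₃ i) (sym 1+n≡)) (cong (_+_ j) (sym b≡c₃+i)) (ℕ.+-monoˡ-≤ (c₃ + i) c₁≤j)
      where
      comm : ∀ x y z → x + (y + z) ≡ x + z + y
      comm = ℕSolver.solve-∀
    j+b<N : j + b < N
    j+b<N = subst₂ _<_ (cong (_+_ j) (sym b≡c₃+i)) (sym N≡) (ℕ.+-monoˡ-< (c₃ + i) j<c₁+i)
    j′≤n : (j ∸ c₁) + c₃ ≤ n
    j′≤n = ℕ.≤-pred (subst (suc ((j ∸ c₁) + c₃) ≤_) (sym 1+n≡) (ℕ.+-monoˡ-≤ c₃ (ℕ.≤-<-trans (ℕ.m∸n≤m j c₁) j<c₁+i)))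
    lemma : ∀ r p → r ℤ.- p ≡ (p ℤ.+ r) ℤ.- (p ℤ.+ p)
    lemma = ℤSolver.solve-∀
    two-steps : ((j ∸ c₁) + c₃ + N) * a ≡ (κ j + 2) + (f j + (p + p)) * N
    two-steps = begin
      ((j ∸ c₁) + c₃ + N) * a ≡⟨ cong (_* a) (begin
        (j ∸ c₁) + c₃ + N                       ≡⟨ cong (_+_ ((j ∸ c₁) + c₃)) N≡ ⟩
        (j ∸ c₁) + c₃ + (c₁ + i + (c₃ + i))     ≡⟨ regroup (j ∸ c₁) c₃ c₁ i ⟩
        (c₁ + (j ∸ c₁)) + (c₃ + i) + (c₃ + i)   ≡⟨ cong₂ (λ x y → x + y + y) c₁+[j-c₁] (sym b≡c₃+i) ⟩
        j + b + b ∎) ⟩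
      (j + b + b) * a ≡⟨ ℕ.*-distribʳ-+ a (j + b) b ⟩
      (j + b) * a + b * a ≡⟨ cong₂ _+_ (κ+b j) (trans (ℕ.*-comm b a) ab≡1+Np) ⟩
      (κ j + 1) + (f j + p) * N + (1 + N * p) ≡⟨ collect (κ j) (f j) p N ⟩
      (κ j + 2) + (f j + (p + p)) * N ∎
      where
      open ≡-Reasoning
      regroup : ∀ x c₃ c₁ i → x + c₃ + (c₁ + i + (c₃ + i)) ≡ (c₁ + x) + (c₃ + i) + (c₃ + i)
      regroup = ℕSolver.solve-∀
      collect : ∀ k f p N → (k + 1) + (f + p) * N + (1 + N * p) ≡ (k + 2) + (f + (p + p)) * N
      collect = ℕSolver.solve-∀
  ...   | no j≮c₁+i = wrapped {j} {P = p} (+ r) gap-one (ℕ.≤-trans (ℕ.m∸n≤m j (c₁ + i)) j≤n)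
      (compPerm-I₃ {c₁} {i} {c₃} c₁+i≤j) (compLetter-I₃ {c₁ = c₁} {i} c₁+i≤j)
      (trans (lemma (+ r) (+ p)) (cong (λ x → + x ℤ.- + p) (sym a≡p+r)))
      (trans (cong (_* a) one-step) (κ+b j)) (subst (_≤ N) (ℕ.+-comm 1 (κ j)) (κ<N j))
    where
    c₁+i≤j = ℕ.≮⇒≥ j≮c₁+i
    lemma : ∀ r p → r ≡ (p ℤ.+ r) ℤ.- p
    lemma = ℤSolver.solve-∀
    one-step : (j ∸ (c₁ + i)) + N ≡ j + b
    one-step = begin
      (j ∸ (c₁ + i)) + N                         ≡⟨ cong (_+_ (j ∸ (c₁ + i))) N≡ ⟩
      (j ∸ (c₁ + i)) + (c₁ + i + (c₃ + i))       ≡⟨ ℕ.+-assoc (j ∸ (c₁ + i)) (c₁ + i) (c₃ + i) ⟨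
      (j ∸ (c₁ + i)) + (c₁ + i) + (c₃ + i)       ≡⟨ cong₂ _+_ (ℕ.m∸n+n≡m c₁+i≤j) (sym b≡c₃+i) ⟩
      j + b ∎
      where open ≡-Reasoning

  module _ {J} (E : Enumeration n J) where

    order-reflecting : ∀ {m m′} → κ (J m) < κ (J m′) → m Fin.< m′
    order-reflecting {m} {m′} lt with m Fin.<? m′
    ... | yes m<m′ = m<m′
    ... | no  m≮m′ = contradiction lt (ℕ.≤⇒≯ (increasing-mono-≤ {x = κ ∘ J} (sorted E) (ℕ.≮⇒≥ m≮m′)))

    J<N : ∀ m → J m < N
    J<N m = ℕ.≤-<-trans (bounded E m) 1+n≤N

    J-suc : ∀ {m m⁺} → toℕ m⁺ ≡ suc (toℕ m) → J m⁺ ≡ σ (J m) × letter (J m) ≡ + f (J m) ℤ.- + f (J m⁺)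
    J-suc {m} {m⁺} m⁺≡ with successor (bounded E m)
    ... | outer gap _ = contradiction (κ<N (J m⁺))
        (ℕ.≤⇒≯ (gap-≤ gap (bounded E m⁺) (sorted E (subst (toℕ m <_) (sym m⁺≡) (ℕ.n<1+n (toℕ m))))))
    ... | inner σj≤n gap letter≡ with surjective E σj≤n
    ... | m′ , Jm′≡ = Jm⁺≡ , trans letter≡ (cong (λ x → + f (J m) ℤ.- + f x) (sym Jm⁺≡))
      where
      m<m⁺ : m Fin.< m⁺
      m<m⁺ = subst (toℕ m <_) (sym m⁺≡) (ℕ.n<1+n (toℕ m))
      m<m′ : m Fin.< m′
      m<m′ = order-reflecting (subst (λ x → κ (J m) < κ x) (sym Jm′≡) (gap-< gap))
      Jm⁺≡ : J m⁺ ≡ σ (J m)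
      Jm⁺≡ = trans (κ-injective (J<N m⁺) (J<N m′) (ℕ.≤-antisym
        (increasing-mono-≤ {x = κ ∘ J} (sorted E) (subst (_≤ toℕ m′) (sym m⁺≡) m<m′))
        (subst (λ x → κ x ≤ κ (J m⁺)) (sym Jm′≡) (gap-≤ gap (bounded E m⁺) (sorted E m<m⁺))))) Jm′≡

    letter-last : ∀ {m} → toℕ m ≡ n → letter (J m) ≡ + f (J m) ℤ.+ 1ℤ
    letter-last {m} m≡n with successor (bounded E m)
    ... | outer _ letter≡ = letter≡
    ... | inner σj≤n gap _ with surjective E σj≤n
    ... | m′ , Jm′≡ = contradiction (order-reflecting (subst (λ x → κ (J m) < κ x) (sym Jm′≡) (gap-< gap)))
      (ℕ.≤⇒≯ (subst (toℕ m′ ≤_) (sym m≡n) (ℕ.≤-pred (Fin.toℕ<n m′))))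

    V≡letter : ∀ m → V J m ≡ letter (J m) ℤ.* S J
    V≡letter m with toℕ m ℕ.≟ n
    ... | yes m≡n = trans (V≡ E (next-last m≡n)) (cong (ℤ._* S J) (sym (letter-last m≡n)))
    ... | no  m≢n = trans (V≡ E (next-suc E (Fin.toℕ-fromℕ< lt)))
        (cong (ℤ._* S J) (sym (proj₂ (J-suc (Fin.toℕ-fromℕ< lt)))))
      where
      lt : suc (toℕ m) < suc n
      lt = s≤s (ℕ.≤∧≢⇒< (ℕ.≤-pred (Fin.toℕ<n m)) m≢n)

    J≡iterate : ∀ k (k<1+n : k < suc n) → J (fromℕ< k<1+n) ≡ iterate σ k 0
    J≡iterate zero    (s≤s z≤n) with surjective E {0} z≤n
    ... | m , Jm≡0 = κ-injective (J<N zero) N>0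
        (ℕ.≤-antisym (subst (λ x → κ (J zero) ≤ κ x) Jm≡0 (increasing-mono-≤ {x = κ ∘ J} (sorted E) {zero} {m} z≤n))
      (subst (_≤ κ (J zero)) (sym κ-zero) z≤n))
    J≡iterate (suc k) k<1+n = trans (proj₁ (J-suc
        (trans (Fin.toℕ-fromℕ< k<1+n) (cong suc (sym (Fin.toℕ-fromℕ< k<n)))))) (cong σ (J≡iterate k k<n))
      where k<n = ℕ.<-trans (ℕ.n<1+n k) k<1+n

    J-toℕ : ∀ m → J m ≡ iterate σ (toℕ m) 0
    J-toℕ m = trans (cong J (sym (Fin.fromℕ<-toℕ m (Fin.toℕ<n m)))) (J≡iterate (toℕ m) (Fin.toℕ<n m))

    single-cycle : IsSingleCycle c₁ i c₃
    single-cycle j k j< k< eq = trans (sym (Fin.toℕ-fromℕ< j<1+n))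
        (trans (cong toℕ (injective (trans (J≡iterate j j<1+n) (trans eq (sym (J≡iterate k k<1+n))))))
        (Fin.toℕ-fromℕ< k<1+n))
      where
      j<1+n = subst (j <_) (sym 1+n≡) j<
      k<1+n = subst (k <_) (sym 1+n≡) k<
      injective : ∀ {m m′} → J m ≡ J m′ → m ≡ m′
      injective {m} {m′} eq with Fin.<-cmp m m′
      ... | tri< lt _ _ = contradiction (cong κ eq) (ℕ.<⇒≢ (sorted E lt))
      ... | tri≈ _ m≡m′ _ = m≡m′
      ... | tri> _ _ lt = contradiction (cong κ (sym eq)) (ℕ.<⇒≢ (sorted E lt))

-- Factors of Sturmian sequences: right special factors and aperiodicity.

Word : Set
Word = List (Fin 2)

other : Fin 2 → Fin 2
other zero       = suc zero
other (suc zero) = zero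

is-or-other : ∀ x y → y ≡ x ⊎ y ≡ other x
is-or-other zero       zero       = inj₁ refl
is-or-other zero       (suc zero) = inj₂ refl
is-or-other (suc zero) zero       = inj₂ refl
is-or-other (suc zero) (suc zero) = inj₁ refl

other≢ : ∀ x → other x ≢ x
other≢ zero       ()
other≢ (suc zero) ()

bounded-search : ∀ {Q : ℕ → Set} → (∀ i → Dec (Q i)) → ∀ B → (∀ i → i < B → Q i) ⊎ (∃ λ i → ¬ Q i)
bounded-search Q? zero = inj₁ λ _ ()
bounded-search {Q} Q? (suc B) with bounded-search Q? B
... | inj₂ found = inj₂ found
... | inj₁ all with Q? B
...   | no ¬QB = inj₂ (B , ¬QB)
...   | yes QB = inj₁ λ i i≤B → case ℕ.m≤n⇒m<n∨m≡n (ℕ.≤-pred i≤B) of λ where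
        (inj₁ i<B)  → all i i<B
        (inj₂ refl) → QB

upper-bound : ∀ {n} (x : Fin n → ℕ) → ∃ λ B → ∀ i → x i ≤ B
upper-bound {zero}  x = 0 , λ ()
upper-bound {suc n} x with upper-bound (x ∘ suc)
... | B , x≤B = x zero ℕ.⊔ B , λ where
  zero    → ℕ.m≤m⊔n (x zero) B
  (suc i) → ℕ.≤-trans (x≤B i) (ℕ.m≤n⊔m (x zero) B)

module Factors (g : Seq) where

  Agree : ℕ → ℕ → ℕ → Set
  Agree p p′ m = ∀ j → j < m → g (p + j) ≡ g (p′ + j)

  factorAt⇒Agree : ∀ {p p′ m} → factorAt g p m ≡ factorAt g p′ m → Agree p p′ m
  factorAt⇒Agree {p} {p′} {m} eq j j<m = begin
    g (p + j)                             ≡⟨ cong (λ k → g (p + k)) (Fin.toℕ-fromℕ< j<m) ⟨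
    g (p + toℕ (fromℕ< j<m))              ≡⟨ Vec.lookup∘tabulate _ (fromℕ< j<m) ⟨
    lookup (factorAt g p m) (fromℕ< j<m)  ≡⟨ cong (λ u → lookup u (fromℕ< j<m)) eq ⟩
    lookup (factorAt g p′ m) (fromℕ< j<m) ≡⟨ Vec.lookup∘tabulate _ (fromℕ< j<m) ⟩
    g (p′ + toℕ (fromℕ< j<m))             ≡⟨ cong (λ k → g (p′ + k)) (Fin.toℕ-fromℕ< j<m) ⟩
    g (p′ + j) ∎
    where open ≡-Reasoning

  Agree⇒factorAt : ∀ {p p′ m} → Agree p p′ m → factorAt g p m ≡ factorAt g p′ m
  Agree⇒factorAt agree = Vec.tabulate-cong λ j → agree (toℕ j) (Fin.toℕ<n j)

  Agree-sym : ∀ {p p′ m} → Agree p p′ m → Agree p′ p m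
  Agree-sym agree j j<m = sym (agree j j<m)

  Agree-trans : ∀ {p p′ p″ m} → Agree p p′ m → Agree p′ p″ m → Agree p p″ m
  Agree-trans agree agree′ j j<m = trans (agree j j<m) (agree′ j j<m)

  Agree-shorten : ∀ {p p′ m} → Agree p p′ (suc m) → Agree p p′ m
  Agree-shorten agree j j<m = agree j (ℕ.m<n⇒m<1+n j<m)

  Occurs : Word → ℕ → Set
  Occurs []      p = ⊤
  Occurs (x ∷ W) p = g p ≡ x × Occurs W (suc p)

  Occurs? : ∀ W p → Dec (Occurs W p)
  Occurs? []      p = yes tt
  Occurs? (x ∷ W) p = (g p Fin.≟ x) ×-dec Occurs? W (suc p)

  Occurs-++⁺ : ∀ U {W p} → Occurs U p → Occurs W (p + length U) → Occurs (U ++ W) p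
  Occurs-++⁺ []      {W} {p} _        w = subst (Occurs W) (ℕ.+-identityʳ p) w
  Occurs-++⁺ (x ∷ U) {W} {p} (eq , u) w = eq , Occurs-++⁺ U u (subst (Occurs W) (ℕ.+-suc p (length U)) w)

  Occurs-++⁻ : ∀ U {W p} → Occurs (U ++ W) p → Occurs U p × Occurs W (p + length U)
  Occurs-++⁻ []      {W} {p} w        = tt , subst (Occurs W) (sym (ℕ.+-identityʳ p)) w
  Occurs-++⁻ (x ∷ U) {W} {p} (eq , w) with Occurs-++⁻ U w
  ... | u , w′ = (eq , u) , subst (Occurs W) (sym (ℕ.+-suc p (length U))) w′

  Occurs⇒Agree : ∀ W {p p′} → Occurs W p → Occurs W p′ → Agree p p′ (length W)
  Occurs⇒Agree (x ∷ W) {p} {p′} (eq , w) (eq′ , w′) zero    _         = trans (cong g (ℕ.+-identityʳ p))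
      (trans (trans eq (sym eq′)) (cong g (sym (ℕ.+-identityʳ p′))))
  Occurs⇒Agree (x ∷ W) {p} {p′} (eq , w) (eq′ , w′) (suc j) (s≤s j<W) = trans (cong g (ℕ.+-suc p j))
      (trans (Occurs⇒Agree W w w′ j j<W) (cong g (sym (ℕ.+-suc p′ j))))

  module _ (sturmian : Sturmian g) where

    positions : ∀ m → ∃ λ (k : Fin (suc m) → ℕ) → (∀ {i j} → Agree (k i) (k j) m → i ≡ j) ×
        (∀ p → ∃ λ i → Agree p (k i) m)
    positions m with sturmian m
    ... | factors , distinct , factor⇔ = pos , pos-injective , pos-surjective
      where
      isFactor : ∀ i → IsFactor g (lookup factors i)
      isFactor i = Equivalence.from (factor⇔ (lookup factors i)) (∈-lookup i factors)
      pos : Fin (suc m) → ℕ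
      pos i = proj₁ (isFactor i)
      pos-injective : ∀ {i j} → Agree (pos i) (pos j) m → i ≡ j
      pos-injective {i} {j} agree = distinct i j
          (trans (proj₂ (isFactor i)) (trans (Agree⇒factorAt agree) (sym (proj₂ (isFactor j)))))
      pos-surjective : ∀ p → ∃ λ i → Agree p (pos i) m
      pos-surjective p = index p∈ , factorAt⇒Agree (trans (lookup-index p∈) (proj₂ (isFactor (index p∈))))
        where p∈ = Equivalence.to (factor⇔ (factorAt g p m)) (p , refl)

    few-factors : ∀ m {k} (p : Fin k → ℕ) → suc m < k → ∃₂ λ i j → i Fin.< j × Agree (p i) (p j) m
    few-factors m p m<k with positions m
    ... | pos , _ , find with Fin.pigeonhole m<k (proj₁ ∘ find ∘ p)
    ...   | i , j , i<j , eq = i , j , i<j , Agree-trans (proj₂ (find (p i)))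
        (Agree-sym (subst (λ l → Agree (p j) (pos l) m) (sym eq) (proj₂ (find (p j)))))

    -- Fix one occurrence of each of the m+1 factors of length `m`. Two right special factors would
    -- each give one further factor of length `suc m`: m+3 distinct ones, where only m+2 exist.
    right-special-unique : ∀ m {p p′ r r′} → Agree p p′ m → g (p + m) ≢ g (p′ + m) →
      Agree r r′ m → g (r + m) ≢ g (r′ + m) → ¬ Agree p r m → ⊥
    right-special-unique m {p} {p′} {r} {r′} p~p′ p≢p′ r~r′ r≢r′ p≁r with positions m
    ... | pos , pos-injective , find = clash (few-factors (suc m) extended (ℕ.n<1+n _))
      where
      -- The fixed occurrence takes one of the two continuations; whichever of `p` and `p′` takes
      -- the other one is new.
      extraFor : ∀ {p p′} → Agree p p′ m → g (p + m) ≢ g (p′ + m) → ∃ λ e → Agree p e m ×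
          (∀ i → ¬ Agree e (pos i) (suc m))
      extraFor {p} {p′} p~p′ p≢p′ with find p
      ... | i , p~i with g (pos i + m) Fin.≟ g (p + m)
      ...   | no  i≢p = p , (λ _ _ → refl) , λ j p~j → i≢p
          (subst (λ l → g (pos l + m) ≡ g (p + m))
          (sym (pos-injective (Agree-trans (Agree-sym p~i) (Agree-shorten p~j)))) (sym (p~j m (ℕ.n<1+n m))))
      ...   | yes i≡p = p′ , p~p′ , λ j p′~j → p≢p′
          (trans (sym i≡p) (trans (cong (λ l → g (pos l + m))
          (pos-injective (Agree-trans (Agree-sym p~i) (Agree-trans p~p′ (Agree-shorten p′~j)))))
          (sym (p′~j m (ℕ.n<1+n m)))))
      extraₚ = extraFor p~p′ p≢p′
      extraᵣ = extraFor r~r′ r≢r′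
      extended : Fin (suc (suc (suc m))) → ℕ
      extended zero          = proj₁ extraₚ
      extended (suc zero)    = proj₁ extraᵣ
      extended (suc (suc i)) = pos i
      clash : (∃₂ λ i j → i Fin.< j × Agree (extended i) (extended j) (suc m)) → ⊥
      clash (zero , suc zero , _ , agree) = p≁r
          (Agree-trans (proj₁ (proj₂ extraₚ)) (Agree-trans (Agree-shorten agree) (Agree-sym (proj₁ (proj₂ extraᵣ)))))
      clash (zero , suc (suc j) , _ , agree) = proj₂ (proj₂ extraₚ) j agree
      clash (suc zero , suc (suc j) , _ , agree) = proj₂ (proj₂ extraᵣ) j agree
      clash (suc zero , suc zero , s≤s () , _)
      clash (suc (suc i) , suc zero , s≤s () , _)
      clash (suc (suc i) , suc (suc j) , i<j , agree) = ℕ.<-irrefl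
          (cong (λ l → suc (suc (toℕ l))) (pos-injective (Agree-shorten agree))) i<j

    -- If W repeated from p onwards, g would have at most p + |W| factors of each length.
    aperiodic : ∀ x W p → ∃ λ i → ¬ Occurs (x ∷ W) (p + i * suc (length W))
    aperiodic x W p with positions (p + suc (length W))
    ... | pos , pos-injective , find with upper-bound pos
    -- The fixed occurrences of all factors of length `m` start at or before `B`, so a repetition
    -- through `B + m` blocks already covers them. The bound makes the search decidable.
    ...   | B , pos≤B with bounded-search (λ i → Occurs? (x ∷ W) (p + i * suc (length W)))
        (suc (B + (p + suc (length W))))
    ...     | inj₂ found = found
    ...     | inj₁ periodic = ⊥-elim (clash (Fin.pigeonhole (ℕ.n<1+n m) code))
      where
      ℓ = suc (length W)
      m = p + ℓ
      reduce : ∀ t → t ≤ B + m → g (p + t) ≡ g (p + t % ℓ)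
      reduce t t≤ = begin
        g (p + t) ≡⟨ cong (λ s → g (p + s)) (trans (ℕ.m≡m%n+[m/n]*n t ℓ) (ℕ.+-comm (t % ℓ) (t / ℓ * ℓ))) ⟩
        g (p + (t / ℓ * ℓ + t % ℓ)) ≡⟨ cong g (ℕ.+-assoc p (t / ℓ * ℓ) (t % ℓ)) ⟨
        g (p + t / ℓ * ℓ + t % ℓ)   ≡⟨ Occurs⇒Agree (x ∷ W)
            (periodic (t / ℓ) (s≤s (ℕ.≤-trans (ℕ.m/n≤m t ℓ) t≤))) (periodic 0 (s≤s z≤n)) (t % ℓ) (ℕ.m%n<n t ℓ) ⟩
        g (p + 0 + t % ℓ)           ≡⟨ cong (λ s → g (s + t % ℓ)) (ℕ.+-identityʳ p) ⟩
        g (p + t % ℓ) ∎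
        where open ≡-Reasoning
      residue : ℕ → ℕ
      residue k = p + (k ∸ p) % ℓ
      residue< : ∀ k → residue k < m
      residue< k = ℕ.+-monoʳ-< p (ℕ.m%n<n (k ∸ p) ℓ)
      reduced : ∀ {k} → p ≤ k → k ≤ B → Agree k (residue k) m
      reduced {k} p≤k k≤B j j<m = begin
        g (k + j)                         ≡⟨ cong (λ s → g (s + j)) (ℕ.m+[n∸m]≡n p≤k) ⟨
        g (p + t + j)                     ≡⟨ cong g (ℕ.+-assoc p t j) ⟩
        g (p + (t + j))                   ≡⟨ reduce (t + j) (ℕ.+-mono-≤ t≤B (ℕ.<⇒≤ j<m)) ⟩
        g (p + (t + j) % ℓ)               ≡⟨ cong (λ s → g (p + s))
            (trans (ℕ.%-distribˡ-+ t j ℓ) (trans (cong (λ s → (s + j % ℓ) % ℓ) (sym (ℕ.m%n%n≡m%n t ℓ)))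
            (sym (ℕ.%-distribˡ-+ (t % ℓ) j ℓ)))) ⟩
        g (p + (t % ℓ + j) % ℓ)           ≡⟨ reduce (t % ℓ + j)
            (ℕ.+-mono-≤ (ℕ.≤-trans (ℕ.m%n≤m t ℓ) t≤B) (ℕ.<⇒≤ j<m)) ⟨
        g (p + (t % ℓ + j))               ≡⟨ cong g (ℕ.+-assoc p (t % ℓ) j) ⟨
        g (residue k + j) ∎
        where
        open ≡-Reasoning
        t = k ∸ p
        t≤B : t ≤ B
        t≤B = ℕ.≤-trans (ℕ.m∸n≤m k p) k≤B
      reduction : ∀ k → k ≤ B → ∃ λ k′ → k′ < m × Agree k k′ m
      reduction k k≤B with p ℕ.≤? k
      ... | yes p≤k = residue k , residue< k , reduced p≤k k≤B
      ... | no  p≰k = k , ℕ.<-≤-trans (ℕ.≰⇒> p≰k) (ℕ.m≤m+n p ℓ) , λ _ _ → refl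
      target : ∀ i → ∃ λ k′ → k′ < m × Agree (pos i) k′ m
      target i = reduction (pos i) (pos≤B i)
      code : Fin (suc m) → Fin m
      code i = fromℕ< (proj₁ (proj₂ (target i)))
      clash : (∃₂ λ i j → i Fin.< j × code i ≡ code j) → ⊥
      clash (i , j , i<j , eq) = ℕ.<-irrefl (cong toℕ (pos-injective (Agree-trans (proj₂ (proj₂ (target i)))
        (Agree-sym (subst (λ k → Agree (pos j) k m) (sym same) (proj₂ (proj₂ (target j)))))))) i<j
        where
        same : proj₁ (target i) ≡ proj₁ (target j)
        same = trans (sym (Fin.toℕ-fromℕ< _)) (trans (cong toℕ eq) (Fin.toℕ-fromℕ< _))

-- Bispecial factors and their return words.

ones : Word → ℕ
ones []      = 0
ones (x ∷ W) = toℕ x + ones W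

ones-++ : ∀ U W → ones (U ++ W) ≡ ones U + ones W
ones-++ []      W = refl
ones-++ (x ∷ U) W = trans (cong (_+_ (toℕ x)) (ones-++ U W)) (sym (ℕ.+-assoc (toℕ x) (ones U) (ones W)))

ones≤length : ∀ W → ones W ≤ length W
ones≤length []      = z≤n
ones≤length (x ∷ W) = ℕ.+-mono-≤ (ℕ.≤-pred (Fin.toℕ<n x)) (ones≤length W)

onesIn-+ : ∀ g p k l → onesIn g p (k + l) ≡ onesIn g p k + onesIn g (p + k) l
onesIn-+ g p k l = trans (sumTo-++ k l (λ j → toℕ (g (p + j))))
  (cong (_+_ (onesIn g p k)) (sumTo-cong l λ j _ → cong (toℕ ∘ g) (sym (ℕ.+-assoc p k j))))

zeros : Word → ℕ
zeros W = length W ∸ ones W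

-- The words between consecutive occurrences of the bispecial factor P are block 0 and block 1;
-- the letter after an occurrence of P tells which of the two starts there.
record Level (g : Seq) (block : Fin 2 → Word) (P : Word) : Set where
  open Factors g
  field
    return     : ∀ x {p} → Occurs (P ++ [ x ]) p → Occurs (block x ++ P) p
    block-P    : ∀ x → ∃ λ S → block x ++ P ≡ P ++ x ∷ S
    last       : ∀ x → ∃ λ Y → block x ≡ Y ++ [ x ]
    occurrence : ∃ (Occurs P)

open Level

singleton : Fin 2 → Word
singleton x = [ x ]

level-zero : ∀ g → Level g singleton []
level-zero g = record
  { return     = λ x occ → occ
  ; block-P    = λ x → [] , refl
  ; last       = λ x → [] , refl
  ; occurrence = 0 , tt
  }

substitute : Fin 2 → (Fin 2 → Word) → Fin 2 → Word
substitute x block y with y Fin.≟ x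
... | yes _ = block x
... | no  _ = block x ++ block y

substitute-≡ : ∀ x block → substitute x block x ≡ block x
substitute-≡ x block with x Fin.≟ x
... | yes _  = refl
... | no x≢x = contradiction refl x≢x

substitute-other : ∀ x block → substitute x block (other x) ≡ block x ++ block (other x)
substitute-other x block with other x Fin.≟ x
... | yes eq = contradiction eq (other≢ x)
... | no  _  = refl

module LevelStep {g block P} (level : Level g block P) where

  open Factors g

  block-nonempty : ∀ x → ∃₂ λ y W → block x ≡ y ∷ W
  block-nonempty x with last level x
  ... | []    , eq = x , [] , eq
  ... | y ∷ Y , eq = y , Y ++ [ x ] , eq

  snoc-occurs : ∀ {W x p} → Occurs W p → g (p + length W) ≡ x → Occurs (W ++ [ x ]) p
  snoc-occurs {W} occ eq = Occurs-++⁺ W occ (eq , tt)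

  typed : ∀ x {p} → Occurs P p → Occurs (P ++ [ x ]) p ⊎ Occurs (P ++ [ other x ]) p
  typed x {p} occ with is-or-other x (g (p + length P))
  ... | inj₁ eq = inj₁ (snoc-occurs {P} occ eq)
  ... | inj₂ eq = inj₂ (snoc-occurs {P} occ eq)

  head-block : ∀ x {p} → Occurs (P ++ [ x ]) p → Occurs (block x) p
  head-block x occ = proj₁ (Occurs-++⁻ (block x) (return level x occ))

  next-P : ∀ x {p} → Occurs (P ++ [ x ]) p → Occurs P (p + length (block x))
  next-P x occ = proj₂ (Occurs-++⁻ (block x) (return level x occ))

  module _ (sturmian : Sturmian g) where

    block-aperiodic : ∀ x p → ∃ λ i → ¬ Occurs (block x) (p + i * length (block x))
    block-aperiodic x p with block-nonempty x
    ... | y , W , eq rewrite eq = aperiodic sturmian y W p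

    -- If every `P` met on the way were followed by `other x`, then `block (other x)` would repeat,
    -- against aperiodicity.
    find-type : ∀ x → ∃ (Occurs (P ++ [ x ]))
    find-type x with occurrence level
    ... | p₀ , occ₀ with block-aperiodic (other x) p₀
    ...   | i₀ , ¬occ₀ = search i₀ p₀ occ₀ ¬occ₀
      where
      search : ∀ i p → Occurs P p → ¬ Occurs (block (other x)) (p + i * length (block (other x))) → ∃
          (Occurs (P ++ [ x ]))
      search i p occ ¬occ with typed x occ
      ... | inj₁ found = p , found
      search zero    p occ ¬occ | inj₂ occ′ = contradiction
          (subst (Occurs (block (other x))) (sym (ℕ.+-identityʳ p)) (head-block (other x) occ′)) ¬occ
      search (suc i) p occ ¬occ | inj₂ occ′ = search i (p + length (block (other x))) (next-P (other x) occ′)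
        (subst (λ q → ¬ Occurs (block (other x)) q)
            (sym (ℕ.+-assoc p (length (block (other x))) (i * length (block (other x))))) ¬occ)

    find-change : ∀ x y → other y ≡ x → other x ≡ y → ∃ (Occurs (block x ++ P ++ [ y ]))
    find-change x y y̅≡x x̅≡y with find-type x
    ... | p₀ , occ₀ with block-aperiodic x p₀
    ...   | i₀ , ¬occ₀ = search i₀ p₀ occ₀ ¬occ₀
      where
      search : ∀ i p → Occurs (P ++ [ x ]) p → ¬ Occurs (block x) (p + i * length (block x)) → ∃
          (Occurs (block x ++ P ++ [ y ]))
      search i p occ ¬occ with typed x (next-P x occ)
      ... | inj₂ occ′ = p , Occurs-++⁺ (block x) (head-block x occ)
          (subst (λ z → Occurs (P ++ [ z ]) (p + length (block x))) x̅≡y occ′)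
      search zero    p occ ¬occ | inj₁ occ′ = contradiction
          (subst (Occurs (block x)) (sym (ℕ.+-identityʳ p)) (head-block x occ)) ¬occ
      search (suc i) p occ ¬occ | inj₁ occ′ = search i (p + length (block x)) occ′
        (subst (λ q → ¬ Occurs (block x) q) (sym (ℕ.+-assoc p (length (block x)) (i * length (block x)))) ¬occ)

    -- The letter before `P` is the last letter of `block x`, which is `x`.
    bispecial-window : ∀ x y → ∃ (Occurs (block x ++ P ++ [ y ])) → ∃ λ p → Occurs (x ∷ P ++ [ y ]) p
    bispecial-window x y (p , occ) with last level x
    ... | Y , eq = p + length Y , proj₂ (Occurs-++⁻ Y
        (subst (λ W → Occurs W p) (trans (cong (_++ P ++ [ y ]) eq) (List.++-assoc Y [ x ] (P ++ [ y ]))) occ))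

    -- With all four words present, `zero ∷ P` and `suc zero ∷ P` would be two right special factors
    -- of the same length.
    not-all-pairs : (∀ x y → ∃ (Occurs (block x ++ P ++ [ y ]))) → ⊥
    not-all-pairs pairs = right-special-unique sturmian (suc (length P)) (agree zero) (differ zero)
        (agree (suc zero)) (differ (suc zero))
      λ agree → case trans (sym (proj₁ (occ zero zero)))
          (trans (cong g (sym (ℕ.+-identityʳ (pos zero zero))))
          (trans (agree 0 (s≤s z≤n)) (trans (cong g (ℕ.+-identityʳ (pos (suc zero) zero)))
          (proj₁ (occ (suc zero) zero))))) of λ ()
      where
      pos : Fin 2 → Fin 2 → ℕ
      pos x y = proj₁ (bispecial-window x y (pairs x y))
      occ : ∀ x y → Occurs (x ∷ P ++ [ y ]) (pos x y)
      occ x y = proj₂ (bispecial-window x y (pairs x y))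
      agree : ∀ x → Agree (pos x zero) (pos x (suc zero)) (suc (length P))
      agree x = Occurs⇒Agree (x ∷ P) (proj₁ (Occurs-++⁻ (x ∷ P) (occ x zero)))
          (proj₁ (Occurs-++⁻ (x ∷ P) (occ x (suc zero))))
      after : ∀ x y → g (pos x y + suc (length P)) ≡ y
      after x y = proj₁ (proj₂ (Occurs-++⁻ (x ∷ P) (occ x y)))
      differ : ∀ x → g (pos x zero + suc (length P)) ≢ g (pos x (suc zero) + suc (length P))
      differ x eq = case trans (sym (after x zero)) (trans eq (after x (suc zero))) of λ ()

    -- Both changes of block always occur, by `find-change`; a repetition of each block would
    -- complete the four forbidden pairs.
    no-repetition : ∀ x → ∃ (Occurs (block x ++ P ++ [ x ])) → ∀ p → ¬ Occurs (block (other x) ++ P ++ [ other x ]) p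
    no-repetition zero repeated p occ = not-all-pairs λ where
      zero       zero       → repeated
      zero       (suc zero) → find-change zero (suc zero) refl refl
      (suc zero) zero       → find-change (suc zero) zero refl refl
      (suc zero) (suc zero) → p , occ
    no-repetition (suc zero) repeated p occ = not-all-pairs λ where
      zero       zero       → p , occ
      zero       (suc zero) → find-change zero (suc zero) refl refl
      (suc zero) zero       → find-change (suc zero) zero refl refl
      (suc zero) (suc zero) → repeated

    -- Once `block x` repeats, `block (other x)` cannot. So `block x ++ P` is followed either by the
    -- start of another block `x`, or by a single block `other x` and then a block `x`. This makes
    -- `block x ++ P` the next bispecial word, with return words `block x` and
    -- `block x ++ block (other x)`.
    level-step : ∀ x → ∃ (Occurs (block x ++ P ++ [ x ])) → Level g (substitute x block) (block x ++ P)
    level-step x repeated = record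
      { return     = λ y → return′ y (is-or-other x y)
      ; block-P    = λ y → block-P′ y (is-or-other x y)
      ; last       = λ y → last′ y (is-or-other x y)
      ; occurrence = proj₁ found , return level x (proj₂ found)
      }
      where
      found = find-type x
      U = block x
      U̅ = block (other x)
      then-x : ∀ {p} → Occurs (P ++ [ other x ]) p → Occurs (U̅ ++ U ++ P) p
      then-x {p} occ with typed x (next-P (other x) occ)
      ... | inj₁ occ′ = Occurs-++⁺ U̅ (head-block (other x) occ) (return level x occ′)
      ... | inj₂ occ′ = contradiction (Occurs-++⁺ U̅ (head-block (other x) occ) occ′) (no-repetition x repeated p)
      return′ : ∀ y → y ≡ x ⊎ y ≡ other x → ∀ {p} → Occurs ((U ++ P) ++ [ y ]) p → Occurs
          (substitute x block y ++ U ++ P) p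
      return′ y (inj₁ refl) {p} occ with Occurs-++⁻ U (subst (λ W → Occurs W p) (List.++-assoc U P [ y ]) occ)
      ... | u , occ′ = subst (λ W → Occurs (W ++ U ++ P) p) (sym (substitute-≡ x block))
          (Occurs-++⁺ U u (return level x occ′))
      return′ y (inj₂ refl) {p} occ with Occurs-++⁻ U (subst (λ W → Occurs W p) (List.++-assoc U P [ y ]) occ)
      ... | u , occ′ = subst (λ W → Occurs W p)
          (trans (sym (List.++-assoc U U̅ (U ++ P))) (cong (_++ U ++ P) (sym (substitute-other x block))))
          (Occurs-++⁺ U u (then-x occ′))
      block-P′ : ∀ y → y ≡ x ⊎ y ≡ other x → ∃ λ S → substitute x block y ++ U ++ P ≡ (U ++ P) ++ y ∷ S
      block-P′ y (inj₁ refl) with block-P level x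
      ... | S , eq = S , trans (cong (_++ U ++ P) (substitute-≡ x block))
          (trans (cong (U ++_) eq) (sym (List.++-assoc U P (x ∷ S))))
      block-P′ y (inj₂ refl) with block-P level x | block-P level (other x)
      ... | S , eq | S̅ , eq̅ = S̅ ++ x ∷ S , (begin
        substitute x block (other x) ++ U ++ P  ≡⟨ cong (_++ U ++ P) (substitute-other x block) ⟩
        (U ++ U̅) ++ U ++ P                      ≡⟨ List.++-assoc U U̅ (U ++ P) ⟩
        U ++ U̅ ++ U ++ P                        ≡⟨ cong (λ W → U ++ U̅ ++ W) eq ⟩
        U ++ U̅ ++ P ++ x ∷ S                    ≡⟨ cong (U ++_) (List.++-assoc U̅ P (x ∷ S)) ⟨
        U ++ (U̅ ++ P) ++ x ∷ S                  ≡⟨ cong (λ W → U ++ W ++ x ∷ S) eq̅ ⟩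
        U ++ (P ++ other x ∷ S̅) ++ x ∷ S        ≡⟨ cong (U ++_) (List.++-assoc P (other x ∷ S̅) (x ∷ S)) ⟩
        U ++ P ++ other x ∷ S̅ ++ x ∷ S          ≡⟨ List.++-assoc U P (other x ∷ S̅ ++ x ∷ S) ⟨
        (U ++ P) ++ other x ∷ S̅ ++ x ∷ S ∎)
        where open ≡-Reasoning
      last′ : ∀ y → y ≡ x ⊎ y ≡ other x → ∃ λ Y → substitute x block y ≡ Y ++ [ y ]
      last′ y (inj₁ refl) = proj₁ (last level x) , trans (substitute-≡ x block) (proj₂ (last level x))
      last′ y (inj₂ refl) with last level (other x)
      ... | Y , eq = U ++ Y , trans (substitute-other x block)
          (trans (cong (U ++_) eq) (sym (List.++-assoc U Y [ other x ])))

  ones-occurs : ∀ W {p} → Occurs W p → onesIn g p (length W) ≡ ones W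
  ones-occurs []      _          = refl
  ones-occurs (x ∷ W) {p} (eq , occ) = trans (sumTo-suc (length W) (λ j → toℕ (g (p + j))))
    (cong₂ _+_ (cong toℕ (trans (cong g (ℕ.+-identityʳ p)) eq))
      (trans (sumTo-cong (length W) λ j _ → cong (toℕ ∘ g) (ℕ.+-suc p j)) (ones-occurs W occ)))

  -- G o z stands for a bound on the slope o/z; without two consecutive blocks x it extends to long windows.
  module _ (G : ℕ → ℕ → Set) (G-zero : G 0 0) (G-+ : ∀ {o z o′ z′} → G o z → G o′ z′ → G (o + o′) (z + z′))
    (x : Fin 2) (G-other : G (ones (block (other x))) (zeros (block (other x))))
    (G-both : G (ones (block x) + ones (block (other x))) (zeros (block x) + zeros (block (other x)))) where

    Window : ℕ → ℕ → Set
    Window p ℓ = ∃₂ λ o z → onesIn g p ℓ ≡ o × ℓ ≡ o + z × G o z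

    prepend : ∀ W {p ℓ} → Occurs W p → G (ones W) (zeros W) → Window (p + length W) ℓ → Window p (length W + ℓ)
    prepend W {p} {ℓ} occ GW (o , z , ones≡ , ℓ≡ , Goz) = ones W + o , zeros W + z ,
      trans (onesIn-+ g p (length W) ℓ) (cong₂ _+_ (ones-occurs W occ) ones≡) ,
      trans (cong₂ _+_ (sym (ℕ.m+[n∸m]≡n (ones≤length W))) ℓ≡) (interchange (ones W) (zeros W) o z) ,
      G-+ GW Goz
      where
      interchange : ∀ a b c d → a + b + (c + d) ≡ a + c + (b + d)
      interchange = ℕSolver.solve-∀

    block>0 : ∀ y → 1 ≤ length (block y)
    block>0 y with block-nonempty y
    ... | _ , _ , eq = subst (λ W → 1 ≤ length W) (sym eq) (s≤s z≤n)

    zeros-++ : ∀ U W → zeros U + zeros W ≡ zeros (U ++ W)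
    zeros-++ U W = sym (begin
      length (U ++ W) ∸ ones (U ++ W)                 ≡⟨ cong₂ _∸_ (List.length-++ U) (ones-++ U W) ⟩
      (length U + length W) ∸ (ones U + ones W)       ≡⟨ cong₂ (λ u w → (u + w) ∸ (ones U + ones W))
          (sym (ℕ.m+[n∸m]≡n (ones≤length U))) (sym (ℕ.m+[n∸m]≡n (ones≤length W))) ⟩
      (ones U + zeros U + (ones W + zeros W)) ∸ (ones U + ones W) ≡⟨ cong (_∸ (ones U + ones W))
          (interchange (ones U) (zeros U) (ones W) (zeros W)) ⟩
      (ones U + ones W + (zeros U + zeros W)) ∸ (ones U + ones W) ≡⟨ ℕ.m+n∸m≡n (ones U + ones W) (zeros U + zeros W) ⟩
      zeros U + zeros W ∎)
      where
      open ≡-Reasoning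
      interchange : ∀ a b c d → a + b + (c + d) ≡ a + c + (b + d)
      interchange = ℕSolver.solve-∀

    -- The blocks from `p` onwards are grouped into single blocks `other x` and pairs of `x` with
    -- `other x`; grouping fails only where two blocks `x` meet. Each group has at least one letter,
    -- so `K` groups suffice.
    long-window : ∀ K p → Occurs P p → ∃ (Occurs (block x ++ P ++ [ x ])) ⊎ (∃ λ ℓ → K ≤ ℓ × Window p ℓ)
    long-window zero    p occ = inj₂ (0 , z≤n , 0 , 0 , refl , refl , G-zero)
    long-window (suc K) p occ with typed x occ
    ... | inj₂ occ₀ with long-window K _ (next-P (other x) occ₀)
    ...   | inj₁ found = inj₁ found
    ...   | inj₂ (ℓ , K≤ℓ , window) = inj₂ (length (block (other x)) + ℓ , ℕ.+-mono-≤
        (block>0 (other x)) K≤ℓ , prepend (block (other x)) (head-block (other x) occ₀) G-other window)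
    long-window (suc K) p occ | inj₁ occ₁ with typed x (next-P x occ₁)
    ... | inj₁ occ₂ = inj₁ (p , Occurs-++⁺ (block x) (head-block x occ₁) occ₂)
    ... | inj₂ occ₂ with long-window K _ (next-P (other x) occ₂)
    ...   | inj₁ found = inj₁ found
    ...   | inj₂ (ℓ , K≤ℓ , window) = inj₂ (length W + ℓ , ℕ.+-mono-≤
        (subst (1 ≤_) (sym (List.length-++ (block x))) (ℕ.≤-trans (block>0 x) (ℕ.m≤m+n _ _))) K≤ℓ ,
        prepend W occW (subst₂ G (sym (ones-++ (block x) (block (other x))))
            (zeros-++ (block x) (block (other x))) G-both)
          (subst (λ q → Window q ℓ) (trans (ℕ.+-assoc p (length (block x)) (length (block (other x))))
              (cong (_+_ p) (sym (List.length-++ (block x))))) window))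
      where
      W = block x ++ block (other x)
      occW : Occurs W p
      occW = Occurs-++⁺ (block x) (head-block x occ₁) (head-block (other x) occ₂)

-- Prefix counts of central words.

pre : Word → ℕ → ℕ
pre W       zero    = 0
pre []      (suc j) = 0
pre (x ∷ W) (suc j) = toℕ x + pre W j

pre-++-≤ : ∀ U W {j} → j ≤ length U → pre (U ++ W) j ≡ pre U j
pre-++-≤ U       W {zero}  _         = refl
pre-++-≤ (x ∷ U) W {suc j} (s≤s j≤U) = cong (_+_ (toℕ x)) (pre-++-≤ U W j≤U)

pre-++-+ : ∀ U W j → pre (U ++ W) (length U + j) ≡ ones U + pre W j
pre-++-+ []      W j = refl
pre-++-+ (x ∷ U) W j = trans (cong (_+_ (toℕ x)) (pre-++-+ U W j)) (sym (ℕ.+-assoc (toℕ x) (ones U) (pre W j)))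

pre-snoc : ∀ U x S → pre (U ++ x ∷ S) (suc (length U)) ≡ toℕ x + ones U
pre-snoc U x S = trans (cong (pre (U ++ x ∷ S)) (ℕ.+-comm 1 (length U)))
    (trans (pre-++-+ U (x ∷ S) 1) (trans (cong (_+_ (ones U)) (ℕ.+-identityʳ (toℕ x))) (ℕ.+-comm (ones U) (toℕ x))))

onesIn≡pre : ∀ {g} W {p j} → Factors.Occurs g W p → j ≤ length W → onesIn g p j ≡ pre W j
onesIn≡pre         W       {j = zero}  _          _         = refl
onesIn≡pre {g = g} (x ∷ W) {p} {suc j} (eq , occ) (s≤s j≤W) = trans (sumTo-suc j (λ i → toℕ (g (p + i))))
  (cong₂ _+_ (cong toℕ (trans (cong g (ℕ.+-identityʳ p)) eq))
    (trans (sumTo-cong j λ i _ → cong (toℕ ∘ g) (ℕ.+-suc p i)) (onesIn≡pre W occ j≤W)))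

-- With the length N-2 supplied separately, this says that `P` is a Christoffel word of length `N`
-- with `a` ones, stripped of its first and last letters. The prefix counts are the floors of
-- (j+1)a/N, the shift standing for the missing initial 0, and no remainder inside is 0.
record Mechanical (N a : ℕ) (P : Word) : Set where
  field
    remainder : ∀ j → j ≤ length P → ∃ λ κ → 1 ≤ κ × κ < N × suc j * a ≡ κ + pre P j * N

open Mechanical

module _ {N a ℓ o : ℕ} where

  -- `o / ℓ` and `a / N` are Farey neighbours: their multiples by `t < N` differ by t/(Nℓ), less
  -- than 1/ℓ, so `h` serves as quotient for both. Here `o / ℓ` is the larger one and the remainder
  -- lies in 1, ..., ℓ; in `quotient₀` it is the smaller one and the remainder lies in 0, ..., ℓ-1.
  quotient₁ : o * N ≡ 1 + a * ℓ → ∀ {h κ t} → t * a ≡ κ + h * N → κ < N → 1 ≤ t → t < N →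
    ∃ λ y → t * o ≡ suc y + h * ℓ × suc y ≤ ℓ
  quotient₁ oN≡ {h} {κ} {t} ta≡ κ<N 1≤t t<N = positive (t * o ∸ h * ℓ) refl
    where
    open ℕ.≤-Reasoning
    scaled : (t * o) * N ≡ (h * ℓ) * N + (ℓ * κ + t)
    scaled = begin-equality
      (t * o) * N                   ≡⟨ ℕ.*-assoc t o N ⟩
      t * (o * N)                   ≡⟨ cong (t *_) oN≡ ⟩
      t * (1 + a * ℓ)               ≡⟨ lemma t a ℓ ⟩
      (t * a) * ℓ + t               ≡⟨ cong (λ x → x * ℓ + t) ta≡ ⟩
      (κ + h * N) * ℓ + t           ≡⟨ lemma′ κ h N ℓ t ⟩
      (h * ℓ) * N + (ℓ * κ + t) ∎
      where
      lemma : ∀ t a ℓ → t * (1 + a * ℓ) ≡ (t * a) * ℓ + t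
      lemma = ℕSolver.solve-∀
      lemma′ : ∀ κ h N ℓ t → (κ + h * N) * ℓ + t ≡ (h * ℓ) * N + (ℓ * κ + t)
      lemma′ = ℕSolver.solve-∀
    hℓ<to : h * ℓ < t * o
    hℓ<to = ℕ.*-cancelʳ-< N (h * ℓ) (t * o) (begin-strict
      (h * ℓ) * N                 <⟨ ℕ.m<m+n _ (ℕ.≤-trans 1≤t (ℕ.m≤n+m t (ℓ * κ))) ⟩
      (h * ℓ) * N + (ℓ * κ + t)   ≡⟨ scaled ⟨
      (t * o) * N ∎)
    positive : ∀ y → y ≡ t * o ∸ h * ℓ → ∃ λ y → t * o ≡ suc y + h * ℓ × suc y ≤ ℓ
    positive zero    eq = contradiction (ℕ.m∸n≡0⇒m≤n (sym eq)) (ℕ.<⇒≱ hℓ<to)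
    positive (suc y) eq = y , to≡ , ℕ.≤-pred (ℕ.*-cancelʳ-< N (suc y) (suc ℓ) (begin-strict
      suc y * N       ≡⟨ ℕ.+-cancelʳ-≡ ((h * ℓ) * N) (suc y * N) (ℓ * κ + t)
          (trans (sym (ℕ.*-distribʳ-+ N (suc y) (h * ℓ)))
          (trans (cong (_* N) (sym to≡)) (trans scaled (ℕ.+-comm ((h * ℓ) * N) _)))) ⟩
      ℓ * κ + t       <⟨ ℕ.+-mono-≤-< (ℕ.*-monoʳ-≤ ℓ (ℕ.<⇒≤ κ<N)) t<N ⟩
      ℓ * N + N       ≡⟨ ℕ.+-comm (ℓ * N) N ⟩
      suc ℓ * N ∎))
      where
      to≡ : t * o ≡ suc y + h * ℓ
      to≡ = trans (sym (ℕ.m∸n+n≡m (ℕ.<⇒≤ hℓ<to))) (cong (_+ h * ℓ) (sym eq))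

  quotient₀ : a * ℓ ≡ 1 + o * N → ∀ {h κ t} → t * a ≡ κ + h * N → κ < N → 1 ≤ t → t < N →
    ∃ λ y → t * o ≡ y + h * ℓ × y < ℓ
  quotient₀ aℓ≡ {h} {κ} {t} ta≡ κ<N 1≤t t<N = t * o ∸ h * ℓ , to≡ , ℕ.*-cancelʳ-< N (t * o ∸ h * ℓ) ℓ (begin-strict
      (t * o ∸ h * ℓ) * N        <⟨ ℕ.m<m+n _ 1≤t ⟩
      (t * o ∸ h * ℓ) * N + t    ≡⟨ ℕ.+-cancelʳ-≡ ((h * ℓ) * N) _ _
          (trans (lemma″ (t * o ∸ h * ℓ) N t (h * ℓ))
          (trans (cong (λ x → x * N + t) (sym to≡)) (trans scaled (ℕ.+-comm ((h * ℓ) * N) _)))) ⟩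
      ℓ * κ                      ≤⟨ ℕ.*-monoʳ-≤ ℓ (ℕ.<⇒≤ κ<N) ⟩
      ℓ * N ∎)
    where
    open ℕ.≤-Reasoning
    lemma″ : ∀ y N t z → y * N + t + z * N ≡ (y + z) * N + t
    lemma″ = ℕSolver.solve-∀
    scaled : (t * o) * N + t ≡ (h * ℓ) * N + ℓ * κ
    scaled = begin-equality
      (t * o) * N + t          ≡⟨ lemma t o N ⟩
      t * (1 + o * N)          ≡⟨ cong (t *_) aℓ≡ ⟨
      t * (a * ℓ)              ≡⟨ ℕ.*-assoc t a ℓ ⟨
      (t * a) * ℓ              ≡⟨ cong (_* ℓ) ta≡ ⟩
      (κ + h * N) * ℓ          ≡⟨ lemma′ κ h N ℓ ⟩
      (h * ℓ) * N + ℓ * κ ∎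
      where
      lemma : ∀ t o N → (t * o) * N + t ≡ t * (1 + o * N)
      lemma = ℕSolver.solve-∀
      lemma′ : ∀ κ h N ℓ → (κ + h * N) * ℓ ≡ (h * ℓ) * N + ℓ * κ
      lemma′ = ℕSolver.solve-∀
    hℓ≤to : h * ℓ ≤ t * o
    hℓ≤to = ℕ.≤-pred (ℕ.*-cancelʳ-< N (h * ℓ) (suc (t * o)) (begin-strict
      (h * ℓ) * N              ≤⟨ ℕ.m≤m+n _ (ℓ * κ) ⟩
      (h * ℓ) * N + ℓ * κ      ≡⟨ scaled ⟨
      (t * o) * N + t          <⟨ ℕ.+-monoʳ-< ((t * o) * N) t<N ⟩
      (t * o) * N + N          ≡⟨ ℕ.+-comm ((t * o) * N) N ⟩
      suc (t * o) * N ∎))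
    to≡ : t * o ≡ (t * o ∸ h * ℓ) + h * ℓ
    to≡ = sym (ℕ.m∸n+n≡m hℓ≤to)

module MechanicalStep {N a : ℕ} {U P : Word} {x : Fin 2} {S : Word}
  (mech : Mechanical N a P) (length-P : N ≡ 2 + length P) (ones-P : a ≡ 1 + ones P)
  (U-P : U ++ P ≡ P ++ x ∷ S) (U<N : length U < N) (U>0 : 1 ≤ length U) where

  private
    ℓ = length U
    o = ones U

  Goal : ℕ → Set
  Goal j = ∃ λ κ → 1 ≤ κ × κ < N + ℓ × suc j * (a + o) ≡ κ + pre (U ++ P) j * (N + ℓ)

  -- A prefix of `U ++ P` is a prefix of `P` while short, by `U-P`, and `U` followed by a prefix of
  -- `P` when long; `U<N` makes the two ranges meet.
  by-cases : (∀ j → j ≤ length P → Goal j) → Goal (suc (length P)) → (∀ j → j ≤ length P → Goal (ℓ + j)) →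
      Mechanical (N + ℓ) (a + o) (U ++ P)
  by-cases low mid high .remainder j j≤ with j ℕ.≤? length P
  ... | yes j≤P = low j j≤P
  ... | no  j≰P with j ℕ.≟ suc (length P)
  ...   | yes refl = mid
  ...   | no  j≢1+P = subst Goal (ℕ.m+[n∸m]≡n ℓ≤j)
      (high (j ∸ ℓ) (ℕ.+-cancelˡ-≤ ℓ _ _ (subst₂ _≤_ (sym (ℕ.m+[n∸m]≡n ℓ≤j)) (List.length-++ U) j≤)))
    where
    ℓ≤j : ℓ ≤ j
    ℓ≤j = ℕ.≤-trans (ℕ.≤-pred (subst (ℓ <_) length-P U<N)) (ℕ.≰⇒> j≰P)

  t<N : ∀ {j} → j ≤ length P → suc j < N
  t<N j≤P = subst (_ <_) (sym length-P) (s≤s (s≤s j≤P))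

  pre-low : ∀ {j} → j ≤ length P → pre (U ++ P) j ≡ pre P j
  pre-low {j} j≤P = trans (cong (λ W → pre W j) U-P) (pre-++-≤ P (x ∷ S) j≤P)

  pre-mid : pre (U ++ P) (suc (length P)) ≡ toℕ x + ones P
  pre-mid = trans (cong (λ W → pre W (suc (length P))) U-P) (pre-snoc P x S)

  low-sum : ∀ t κ h y → t * a ≡ κ + h * N → t * o ≡ y + h * ℓ → t * (a + o) ≡ (κ + y) + h * (N + ℓ)
  low-sum t κ h y ta≡ to≡ = trans (ℕ.*-distribˡ-+ t a o) (trans (cong₂ _+_ ta≡ to≡) (lemma κ h N y ℓ))
    where
    lemma : ∀ κ h N y ℓ → κ + h * N + (y + h * ℓ) ≡ (κ + y) + h * (N + ℓ)
    lemma = ℕSolver.solve-∀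

  step₁ : toℕ x ≡ 1 → o * N ≡ 1 + a * ℓ → Mechanical (N + ℓ) (a + o) (U ++ P)
  step₁ x≡1 oN≡ = by-cases low mid high
    where
    open ≡-Reasoning
    low : ∀ j → j ≤ length P → Goal j
    low j j≤P with remainder mech j j≤P
    ... | κ , 1≤κ , κ<N , ta≡ with quotient₁ oN≡ {pre P j} ta≡ κ<N (s≤s z≤n) (t<N j≤P)
    ...   | y , to≡ , y≤ℓ = κ + suc y , ℕ.≤-trans 1≤κ (ℕ.m≤m+n κ (suc y)) , ℕ.+-mono-<-≤ κ<N y≤ℓ ,
            subst (λ h → suc j * (a + o) ≡ (κ + suc y) + h * (N + ℓ)) (sym (pre-low j≤P))
                (low-sum (suc j) κ (pre P j) (suc y) ta≡ to≡)
    mid : Goal (suc (length P))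
    -- Here `suc j = N`, the quotient is `a`, and the remainder is the determinant oN - aℓ = 1.
    mid = 1 , s≤s z≤n , ℕ.+-mono-≤ (ℕ.≤-trans (s≤s z≤n) U<N) U>0 , (begin
      (2 + length P) * (a + o)   ≡⟨ cong (_* (a + o)) length-P ⟨
      N * (a + o)                ≡⟨ lemma N a o ⟩
      a * N + o * N              ≡⟨ cong (_+_ (a * N)) oN≡ ⟩
      a * N + (1 + a * ℓ)        ≡⟨ lemma′ a N ℓ ⟩
      1 + a * (N + ℓ)            ≡⟨ cong (λ h → 1 + h * (N + ℓ))
          (trans ones-P (sym (trans pre-mid (cong (_+ ones P) x≡1)))) ⟩
      1 + pre (U ++ P) (suc (length P)) * (N + ℓ) ∎)
      where
      lemma : ∀ N a o → N * (a + o) ≡ a * N + o * N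
      lemma = ℕSolver.solve-∀
      lemma′ : ∀ a N ℓ → a * N + (1 + a * ℓ) ≡ 1 + a * (N + ℓ)
      lemma′ = ℕSolver.solve-∀
    high : ∀ j → j ≤ length P → Goal (ℓ + j)
    high j j≤P with remainder mech j j≤P
    ... | κ , 1≤κ , κ<N , ta≡ with quotient₁ oN≡ {pre P j} ta≡ κ<N (s≤s z≤n) (t<N j≤P)
    ...   | y , to≡ , y≤ℓ = κ + y , ℕ.≤-trans 1≤κ (ℕ.m≤m+n κ y) , ℕ.+-mono-<-≤ κ<N (ℕ.<⇒≤ y≤ℓ) , ℕ.suc-injective
        (begin
      suc (suc (ℓ + j) * (a + o))                              ≡⟨ lemma ℓ j a o ⟩
      (1 + a * ℓ) + o * ℓ + suc j * (a + o)                    ≡⟨ cong₂ (λ u v → u + o * ℓ + v) (sym oN≡)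
          (low-sum (suc j) κ h (suc y) ta≡ to≡) ⟩
      o * N + o * ℓ + ((κ + suc y) + h * (N + ℓ))              ≡⟨ lemma′ o N ℓ κ y h ⟩
      suc ((κ + y) + (o + h) * (N + ℓ))                        ≡⟨ cong (λ k → suc ((κ + y) + k * (N + ℓ)))
          (pre-++-+ U P j) ⟨
      suc ((κ + y) + pre (U ++ P) (ℓ + j) * (N + ℓ)) ∎)
      where
      h = pre P j
      lemma : ∀ ℓ j a o → suc (suc (ℓ + j) * (a + o)) ≡ (1 + a * ℓ) + o * ℓ + suc j * (a + o)
      lemma = ℕSolver.solve-∀
      lemma′ : ∀ o N ℓ κ y h → o * N + o * ℓ + ((κ + suc y) + h * (N + ℓ)) ≡ suc ((κ + y) + (o + h) * (N + ℓ))
      lemma′ = ℕSolver.solve-∀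

  step₀ : toℕ x ≡ 0 → a * ℓ ≡ 1 + o * N → Mechanical (N + ℓ) (a + o) (U ++ P)
  step₀ x≡0 aℓ≡ = by-cases low (mid ℓ refl) high
    where
    open ≡-Reasoning
    low : ∀ j → j ≤ length P → Goal j
    low j j≤P with remainder mech j j≤P
    ... | κ , 1≤κ , κ<N , ta≡ with quotient₀ aℓ≡ {pre P j} ta≡ κ<N (s≤s z≤n) (t<N j≤P)
    ...   | y , to≡ , y<ℓ = κ + y , ℕ.≤-trans 1≤κ (ℕ.m≤m+n κ y) , ℕ.+-mono-<-≤ κ<N (ℕ.<⇒≤ y<ℓ) ,
            subst (λ h → suc j * (a + o) ≡ (κ + y) + h * (N + ℓ)) (sym (pre-low j≤P))
                (low-sum (suc j) κ (pre P j) y ta≡ to≡)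
    mid : ∀ k → k ≡ ℓ → Goal (suc (length P))
    mid zero     0≡ℓ = contradiction (subst (1 ≤_) (sym 0≡ℓ) U>0) λ ()
    -- Again `suc j = N`, but the determinant aℓ - oN = 1 has the other sign: the quotient is
    -- `a - 1 = ones P` and the remainder is N + ℓ - 1.
    mid (suc ℓ′) eq = N + ℓ′ , ℕ.≤-trans (ℕ.≤-trans (s≤s z≤n) U<N) (ℕ.m≤m+n N ℓ′) , subst
        (λ k → N + ℓ′ < N + k) eq (ℕ.+-monoʳ-< N (ℕ.n<1+n ℓ′)) , ℕ.suc-injective (begin
      suc ((2 + length P) * (a + o))                   ≡⟨ cong (λ n → suc (n * (a + o))) length-P ⟨
      suc (N * (a + o))                                ≡⟨ lemma N a o ⟩
      a * N + (1 + o * N)                              ≡⟨ cong (_+_ (a * N)) aℓ≡ ⟨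
      a * N + a * ℓ                                    ≡⟨ cong₂ (λ x y → x * N + x * y) ones-P (sym eq) ⟩
      (1 + w) * N + (1 + w) * suc ℓ′                   ≡⟨ lemma′ w N ℓ′ ⟩
      suc ((N + ℓ′) + w * (N + suc ℓ′))                ≡⟨ cong₂ (λ h k → suc ((N + ℓ′) + h * (N + k)))
          (sym (trans pre-mid (cong (_+ ones P) x≡0))) eq ⟩
      suc ((N + ℓ′) + pre (U ++ P) (suc (length P)) * (N + ℓ)) ∎)
      where
      w = ones P
      lemma : ∀ N a o → suc (N * (a + o)) ≡ a * N + (1 + o * N)
      lemma = ℕSolver.solve-∀
      lemma′ : ∀ w N ℓ′ → (1 + w) * N + (1 + w) * suc ℓ′ ≡ suc ((N + ℓ′) + w * (N + suc ℓ′))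
      lemma′ = ℕSolver.solve-∀
    high : ∀ j → j ≤ length P → Goal (ℓ + j)
    high j j≤P with remainder mech j j≤P
    ... | κ , 1≤κ , κ<N , ta≡ with quotient₀ aℓ≡ {pre P j} ta≡ κ<N (s≤s z≤n) (t<N j≤P)
    ...   | y , to≡ , y<ℓ = suc (κ + y) , s≤s z≤n , ℕ.+-mono-≤-< κ<N y<ℓ , (begin
      suc (ℓ + j) * (a + o)                              ≡⟨ lemma ℓ j a o ⟩
      a * ℓ + o * ℓ + suc j * (a + o)                    ≡⟨ cong₂ (λ u v → u + o * ℓ + v) aℓ≡
          (low-sum (suc j) κ h y ta≡ to≡) ⟩
      (1 + o * N) + o * ℓ + ((κ + y) + h * (N + ℓ))      ≡⟨ lemma′ o N ℓ κ y h ⟩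
      suc (κ + y) + (o + h) * (N + ℓ)                    ≡⟨ cong (λ k → suc (κ + y) + k * (N + ℓ)) (pre-++-+ U P j) ⟨
      suc (κ + y) + pre (U ++ P) (ℓ + j) * (N + ℓ) ∎)
      where
      h = pre P j
      lemma : ∀ ℓ j a o → suc (ℓ + j) * (a + o) ≡ a * ℓ + o * ℓ + suc j * (a + o)
      lemma = ℕSolver.solve-∀
      lemma′ : ∀ o N ℓ κ y h → (1 + o * N) + o * ℓ + ((κ + y) + h * (N + ℓ)) ≡ suc (κ + y) + (o + h) * (N + ℓ)
      lemma′ = ℕSolver.solve-∀

-- Descent along the Stern-Brocot path.

-- The blocks have the slopes A/B and C/D of the two bounds at a node. `P` together with one 0 and
-- one 1 has the length and number of ones of the Christoffel word of the mediant.
record Stage (g : Seq) (A B C D : ℕ) : Set where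
  field
    block   : Fin 2 → Word
    P       : Word
    level   : Level g block P
    ones₀   : ones (block zero) ≡ A
    length₀ : length (block zero) ≡ A + B
    ones₁   : ones (block (suc zero)) ≡ C
    length₁ : length (block (suc zero)) ≡ C + D
    length-P : A + B + (C + D) ≡ 2 + length P
    ones-P  : A + C ≡ 1 + ones P
    mech    : Mechanical (A + B + (C + D)) (A + C) P
    CB≡1+AD : C * B ≡ 1 + A * D

stage-zero : ∀ g → Stage g 0 1 1 0
stage-zero g = record
  { block = singleton ; P = [] ; level = level-zero g
  ; ones₀ = refl ; length₀ = refl ; ones₁ = refl ; length₁ = refl ; length-P = refl ; ones-P = refl
  ; mech = record { remainder = λ { zero z≤n → 1 , s≤s z≤n , s≤s (s≤s z≤n) , refl } }
  ; CB≡1+AD = refl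
  }

factor>0 : ∀ {m n k} → m * n ≡ suc k → 1 ≤ m × 1 ≤ n
factor>0 {zero}          ()
factor>0 {suc m} {zero}  eq = contradiction (trans (sym (ℕ.*-zeroʳ m)) eq) λ ()
factor>0 {suc m} {suc n} eq = s≤s z≤n , s≤s z≤n

module StageStep {g A B C D} (sturmian : Sturmian g) (stage : Stage g A B C D) where

  open Stage stage
  open Factors g
  open LevelStep level

  C>0 : 1 ≤ C
  C>0 = proj₁ (factor>0 CB≡1+AD)
  B>0 : 1 ≤ B
  B>0 = proj₂ (factor>0 {C} CB≡1+AD)

  zeros₀ : zeros (block zero) ≡ B
  zeros₀ = trans (cong₂ _∸_ length₀ ones₀) (ℕ.m+n∸m≡n A B)
  zeros₁ : zeros (block (suc zero)) ≡ D
  zeros₁ = trans (cong₂ _∸_ length₁ ones₁) (ℕ.m+n∸m≡n C D)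

  zerosIn≡ : ∀ {p ℓ o z} → onesIn g p ℓ ≡ o → ℓ ≡ o + z → zerosIn g p ℓ ≡ z
  zerosIn≡ {o = o} {z} o≡ ℓ≡ = trans (cong₂ _∸_ ℓ≡ o≡) (ℕ.m+n∸m≡n o z)

  AD≤CB : A * D ≤ C * B
  AD≤CB = subst (A * D ≤_) (sym CB≡1+AD) (ℕ.n≤1+n _)

  -- Otherwise there are arbitrarily long windows made of blocks 0, of slope A/B, and pairs of both
  -- blocks, of mediant slope. Their slope does not exceed the mediant, against the assumption.
  repeated₁ : SlopeGt g (A + C) (B + D) → ∃ (Occurs (block (suc zero) ++ P ++ [ suc zero ]))
  repeated₁ (α , β , 1≤β , nβ<αd , M , steep)
    with long-window (λ o z → o * (B + D) ≤ (A + C) * z) z≤n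
      (λ {o} {z} {o′} {z′} G G′ → subst₂ _≤_ (sym (ℕ.*-distribʳ-+ (B + D) o o′))
          (sym (ℕ.*-distribˡ-+ (A + C) z z′)) (ℕ.+-mono-≤ G G′))
      (suc zero)
      (subst₂ (λ o z → o * (B + D) ≤ (A + C) * z) (sym ones₀) (sym zeros₀)
        (subst₂ _≤_ (sym (ℕ.*-distribˡ-+ A B D)) (sym (ℕ.*-distribʳ-+ B A C)) (ℕ.+-monoʳ-≤ (A * B) AD≤CB)))
      (subst₂ (λ o z → o * (B + D) ≤ (A + C) * z) (trans (ℕ.+-comm A C) (cong₂ _+_ (sym ones₁) (sym ones₀)))
          (trans (ℕ.+-comm B D) (cong₂ _+_ (sym zeros₁) (sym zeros₀))) ℕ.≤-refl)
      M (proj₁ (occurrence level)) (proj₂ (occurrence level))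
  ... | inj₁ found = found
  ... | inj₂ (ℓ , M≤ℓ , o , z , ones≡ , ℓ≡ , od≤nz) = contradiction (steep p ℓ M≤ℓ)
      (subst₂ (λ z o → ¬ (α * z < o * β)) (sym (zerosIn≡ ones≡ ℓ≡)) (sym ones≡) flat)
    where
    p = proj₁ (occurrence level)
    flat : ¬ (α * z < o * β)
    flat αz<oβ = ℕ.<-irrefl refl (begin-strict
      (α * z) * (B + D)     <⟨ ℕ.*-monoˡ-< (B + D) ⦃ ℕ.>-nonZero (ℕ.≤-trans B>0 (ℕ.m≤m+n B D)) ⦄ αz<oβ ⟩
      (o * β) * (B + D)     ≡⟨ swap o β (B + D) ⟩
      o * (B + D) * β       ≤⟨ ℕ.*-monoˡ-≤ β od≤nz ⟩
      (A + C) * z * β       ≡⟨ swap (A + C) z β ⟩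
      (A + C) * β * z       ≤⟨ ℕ.*-monoˡ-≤ z (ℕ.<⇒≤ nβ<αd) ⟩
      α * (B + D) * z       ≡⟨ swap α (B + D) z ⟩
      (α * z) * (B + D) ∎)
      where
      open ℕ.≤-Reasoning
      swap : ∀ x y z → x * y * z ≡ x * z * y
      swap = ℕSolver.solve-∀

  repeated₀ : SlopeLt g (A + C) (B + D) → ∃ (Occurs (block zero ++ P ++ [ zero ]))
  repeated₀ (α , β , 1≤β , αd<nβ , M , gentle)
    with long-window (λ o z → (A + C) * z ≤ o * (B + D)) (subst (_≤ 0) (sym (ℕ.*-zeroʳ (A + C))) z≤n)
      (λ {o} {z} {o′} {z′} G G′ → subst₂ _≤_ (sym (ℕ.*-distribˡ-+ (A + C) z z′))
          (sym (ℕ.*-distribʳ-+ (B + D) o o′)) (ℕ.+-mono-≤ G G′))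
      zero
      (subst₂ (λ o z → (A + C) * z ≤ o * (B + D)) (sym ones₁) (sym zeros₁)
        (subst₂ _≤_ (sym (ℕ.*-distribʳ-+ D A C)) (sym (ℕ.*-distribˡ-+ C B D)) (ℕ.+-monoˡ-≤ (C * D) AD≤CB)))
      (subst₂ (λ o z → (A + C) * z ≤ o * (B + D)) (cong₂ _+_ (sym ones₀) (sym ones₁))
          (cong₂ _+_ (sym zeros₀) (sym zeros₁)) ℕ.≤-refl)
      M (proj₁ (occurrence level)) (proj₂ (occurrence level))
  ... | inj₁ found = found
  ... | inj₂ (ℓ , M≤ℓ , o , z , ones≡ , ℓ≡ , nz≤od) = contradiction (gentle p ℓ M≤ℓ)
      (subst₂ (λ o z → ¬ (o * β < α * z)) (sym ones≡) (sym (zerosIn≡ ones≡ ℓ≡)) flat)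
    where
    p = proj₁ (occurrence level)
    flat : ¬ (o * β < α * z)
    flat oβ<αz = ℕ.<-irrefl refl (begin-strict
      (o * β) * (B + D)     <⟨ ℕ.*-monoˡ-< (B + D) ⦃ ℕ.>-nonZero (ℕ.≤-trans B>0 (ℕ.m≤m+n B D)) ⦄ oβ<αz ⟩
      (α * z) * (B + D)     ≡⟨ swap α z (B + D) ⟩
      α * (B + D) * z       ≤⟨ ℕ.*-monoˡ-≤ z (ℕ.<⇒≤ αd<nβ) ⟩
      (A + C) * β * z       ≡⟨ swap (A + C) β z ⟩
      (A + C) * z * β       ≤⟨ ℕ.*-monoˡ-≤ β nz≤od ⟩
      o * (B + D) * β       ≡⟨ swap o (B + D) β ⟩
      (o * β) * (B + D) ∎)
      where
      open ℕ.≤-Reasoning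
      swap : ∀ x y z → x * y * z ≡ x * z * y
      swap = ℕSolver.solve-∀

  ℓ₀<N : A + B < A + B + (C + D)
  ℓ₀<N = ℕ.m<m+n (A + B) (ℕ.≤-trans C>0 (ℕ.m≤m+n C D))
  ℓ₁<N : C + D < A + B + (C + D)
  ℓ₁<N = ℕ.m<n+m (C + D) (ℕ.≤-trans B>0 (ℕ.m≤n+m B A))

  stage-R : SlopeGt g (A + C) (B + D) → Stage g (A + C) (B + D) C D
  stage-R slope = record
    { block = substitute (suc zero) block ; P = block (suc zero) ++ P
    ; level = level-step sturmian (suc zero) (repeated₁ slope)
    ; ones₀ = trans (ones-++ (block (suc zero)) (block zero)) (trans (cong₂ _+_ ones₁ ones₀) (ℕ.+-comm C A))
    ; length₀ = trans (List.length-++ (block (suc zero))) (trans (cong₂ _+_ length₁ length₀) (comm A B C D))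
    ; ones₁ = ones₁ ; length₁ = length₁
    ; length-P = trans (comm′ A B C D) (trans (cong₂ _+_ (sym length₁) length-P)
        (trans (comm″ (length (block (suc zero))) (length P))
        (cong (_+_ 2) (sym (List.length-++ (block (suc zero)))))))
    ; ones-P = trans (cong₂ _+_ ones-P (sym ones₁))
        (cong suc (trans (ℕ.+-comm (ones P) _) (sym (ones-++ (block (suc zero)) P))))
    ; mech = subst₂ (λ N a → Mechanical N a (block (suc zero) ++ P))
        (trans (cong (_+_ (A + B + (C + D))) length₁) (grow A B C D)) (cong (_+_ (A + C)) ones₁)
        (MechanicalStep.step₁ mech length-P ones-P (proj₂ (block-P level (suc zero)))
          (subst (_< A + B + (C + D)) (sym length₁) ℓ₁<N)
              (subst (1 ≤_) (sym length₁) (ℕ.≤-trans C>0 (ℕ.m≤m+n C D))) refl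
          (subst₂ (λ o ℓ → o * (A + B + (C + D)) ≡ 1 + (A + C) * ℓ) (sym ones₁) (sym length₁) det₁))
    ; CB≡1+AD = trans (ℕ.*-distribˡ-+ C B D) (trans (cong (_+ C * D) CB≡1+AD) (cong suc (sym (ℕ.*-distribʳ-+ D A C))))
    }
    where
    comm : ∀ A B C D → C + D + (A + B) ≡ A + C + (B + D)
    comm = ℕSolver.solve-∀
    comm′ : ∀ A B C D → A + C + (B + D) + (C + D) ≡ C + D + (A + B + (C + D))
    comm′ = ℕSolver.solve-∀
    comm″ : ∀ u p → u + (2 + p) ≡ 2 + (u + p)
    comm″ = ℕSolver.solve-∀
    grow : ∀ A B C D → A + B + (C + D) + (C + D) ≡ A + C + (B + D) + (C + D)
    grow = ℕSolver.solve-∀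
    det₁ : C * (A + B + (C + D)) ≡ 1 + (A + C) * (C + D)
    det₁ = trans (lemma A B C D) (trans (cong (λ x → C * A + x + C * (C + D)) CB≡1+AD) (lemma′ A C D))
      where
      lemma : ∀ A B C D → C * (A + B + (C + D)) ≡ C * A + C * B + C * (C + D)
      lemma = ℕSolver.solve-∀
      lemma′ : ∀ A C D → C * A + (1 + A * D) + C * (C + D) ≡ 1 + (A + C) * (C + D)
      lemma′ = ℕSolver.solve-∀

  -- Makes `b = A + B`, the length of block 0, inverse to `a = A + C` modulo `N`, with quotient
  -- `p = A`.
  det₀ : (A + C) * (A + B) ≡ 1 + A * (A + B + (C + D))
  det₀ = trans (lemma A B C) (trans (cong (λ x → A * (A + B) + C * A + x) CB≡1+AD) (lemma′ A B C D))
    where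
    lemma : ∀ A B C → (A + C) * (A + B) ≡ A * (A + B) + C * A + C * B
    lemma = ℕSolver.solve-∀
    lemma′ : ∀ A B C D → A * (A + B) + C * A + (1 + A * D) ≡ 1 + A * (A + B + (C + D))
    lemma′ = ℕSolver.solve-∀

  stage-L : SlopeLt g (A + C) (B + D) → Stage g A B (A + C) (B + D)
  stage-L slope = record
    { block = substitute zero block ; P = block zero ++ P
    ; level = level-step sturmian zero (repeated₀ slope)
    ; ones₀ = ones₀ ; length₀ = length₀
    ; ones₁ = trans (ones-++ (block zero) (block (suc zero))) (cong₂ _+_ ones₀ ones₁)
    ; length₁ = trans (List.length-++ (block zero)) (trans (cong₂ _+_ length₀ length₁) (comm A B C D))
    ; length-P = trans (cong (_+_ (A + B)) (sym (comm A B C D)))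
        (trans (cong₂ _+_ (sym length₀) length-P)
        (trans (comm″ (length (block zero)) (length P)) (cong (_+_ 2) (sym (List.length-++ (block zero))))))
    ; ones-P = trans (cong₂ _+_ (sym ones₀) ones-P)
        (trans (ℕ.+-suc _ (ones P)) (cong suc (sym (ones-++ (block zero) P))))
    ; mech = subst₂ (λ N a → Mechanical N a (block zero ++ P))
        (trans (cong (_+_ (A + B + (C + D))) length₀) (grow A B C D))
        (trans (cong (_+_ (A + C)) ones₀) (ℕ.+-comm (A + C) A))
        (MechanicalStep.step₀ mech length-P ones-P (proj₂ (block-P level zero))
          (subst (_< A + B + (C + D)) (sym length₀) ℓ₀<N)
              (subst (1 ≤_) (sym length₀) (ℕ.≤-trans B>0 (ℕ.m≤n+m B A))) refl
          (subst₂ (λ o ℓ → (A + C) * ℓ ≡ 1 + o * (A + B + (C + D))) (sym ones₀) (sym length₀) det₀))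
    ; CB≡1+AD = trans (ℕ.*-distribʳ-+ B A C)
        (trans (cong (_+_ (A * B)) CB≡1+AD) (trans (ℕ.+-suc (A * B) (A * D)) (cong suc (sym (ℕ.*-distribˡ-+ A B D)))))
    }
    where
    comm : ∀ A B C D → A + B + (C + D) ≡ A + C + (B + D)
    comm = ℕSolver.solve-∀
    comm″ : ∀ u p → u + (2 + p) ≡ 2 + (u + p)
    comm″ = ℕSolver.solve-∀
    grow : ∀ A B C D → A + B + (C + D) + (A + B) ≡ A + B + (A + C + (B + D))
    grow = ℕSolver.solve-∀

  -- Blocks 1 and 0 together have length `N` and `a` ones. Followed by `P` they give 2N-2 letters of
  -- the periodic word, enough for windows of every length below `N` at all `N` phases. As in
  -- `Mechanical`, the shift by one stands for the missing initial 0.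
  window : ⦃ _ : NonZero (A + B + (C + D)) ⦄ → ∃ λ p → ∀ j → suc j < A + B + (C + D) + (A + B + (C + D)) →
    onesIn g p j ≡ suc j * (A + C) / (A + B + (C + D))
  window with find-change sturmian (suc zero) zero refl refl | block-P level zero | block-P level (suc zero)
  ... | p , occ | S₀ , eq₀ | S₁ , eq₁ = p , λ j 1+j<2N → trans
      (onesIn≡pre W occW (ℕ.≤-pred (ℕ.≤-pred (subst (suc (suc j) ≤_) 2N≡ 1+j<2N)))) (prefixes j 1+j<2N)
    where
    N = A + B + (C + D)
    a = A + C
    V₁ = block (suc zero)
    V₀ = block zero
    W = V₁ ++ V₀ ++ P
    occW : Occurs W p
    occW with Occurs-++⁻ V₁ occ
    ... | v₁ , occ′ = Occurs-++⁺ V₁ v₁ (return level zero occ′)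
    length-V : length (V₁ ++ V₀) ≡ N
    length-V = trans (List.length-++ V₁) (trans (cong₂ _+_ length₁ length₀) (ℕ.+-comm (C + D) (A + B)))
    W≡ : W ≡ (V₁ ++ V₀) ++ P
    W≡ = sym (List.++-assoc V₁ V₀ P)
    2N≡ : N + N ≡ 2 + length W
    2N≡ = trans (cong₂ _+_ (sym length-V) length-P)
        (trans (comm (length (V₁ ++ V₀)) (length P))
        (cong (_+_ 2) (trans (sym (List.length-++ (V₁ ++ V₀))) (cong length (sym W≡)))))
      where
      comm : ∀ u p → u + (2 + p) ≡ 2 + (u + p)
      comm = ℕSolver.solve-∀
    W-prefix : W ≡ P ++ suc zero ∷ S₁ ++ zero ∷ S₀
    W-prefix = begin
      V₁ ++ V₀ ++ P                            ≡⟨ cong (V₁ ++_) eq₀ ⟩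
      V₁ ++ P ++ zero ∷ S₀                     ≡⟨ List.++-assoc V₁ P (zero ∷ S₀) ⟨
      (V₁ ++ P) ++ zero ∷ S₀                   ≡⟨ cong (_++ zero ∷ S₀) eq₁ ⟩
      (P ++ suc zero ∷ S₁) ++ zero ∷ S₀        ≡⟨ List.++-assoc P (suc zero ∷ S₁) (zero ∷ S₀) ⟩
      P ++ suc zero ∷ S₁ ++ zero ∷ S₀ ∎
      where open ≡-Reasoning
    ones-V : ones (V₁ ++ V₀) ≡ a
    ones-V = trans (ones-++ V₁ V₀) (trans (cong₂ _+_ ones₁ ones₀) (ℕ.+-comm C A))
    prefixes : ∀ j → suc j < N + N → pre W j ≡ suc j * a / N
    prefixes j 1+j<2N with j ℕ.≤? length P
    ... | yes j≤P with Mechanical.remainder mech j j≤P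
    ...   | κ , _ , κ<N , eq = trans (cong (λ w → pre w j) W-prefix)
        (trans (pre-++-≤ P _ j≤P) (sym (proj₂ (divMod-unique {q = pre P j} N eq κ<N))))
    prefixes j 1+j<2N | no j≰P with j ℕ.≟ suc (length P)
    -- At `suc j = N` the floor becomes `a = 1 + ones P`, so `P` must be followed by 1; this is why
    -- block 1 precedes block 0.
    ... | yes refl = trans (cong (λ w → pre w j) W-prefix) (trans (pre-snoc P (suc zero) _) (trans (sym ones-P) (sym
            (trans (cong (λ n → n * a / N) (sym length-P)) (trans (cong (_/ N) (ℕ.*-comm N a)) (ℕ.m*n/n≡m a N))))))
    ... | no  j≢ with Mechanical.remainder mech (j ∸ N) j-N≤P
      where
      j-N≤P : j ∸ N ≤ length P
      j-N≤P = ℕ.≤-trans (ℕ.∸-monoˡ-≤ N (ℕ.≤-pred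
          (ℕ.≤-pred (subst (suc (suc j) ≤_) (trans (cong (_+_ N) length-P) shift) 1+j<2N))))
          (ℕ.≤-reflexive (ℕ.m+n∸m≡n N (length P)))
        where
        shift : N + (2 + length P) ≡ 2 + (N + length P)
        shift = trans (ℕ.+-suc N (suc (length P))) (cong suc (ℕ.+-suc N (length P)))
    ...   | κ , _ , κ<N , eq = begin
      pre W j                                 ≡⟨ cong (pre W) (sym N+[j-N]) ⟩
      pre W (N + (j ∸ N))                     ≡⟨ cong₂ pre W≡ (cong (_+ (j ∸ N)) (sym length-V)) ⟩
      pre ((V₁ ++ V₀) ++ P) (length (V₁ ++ V₀) + (j ∸ N)) ≡⟨ pre-++-+ (V₁ ++ V₀) P (j ∸ N) ⟩
      ones (V₁ ++ V₀) + pre P (j ∸ N)         ≡⟨ cong (_+ pre P (j ∸ N)) ones-V ⟩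
      a + pre P (j ∸ N)                       ≡⟨ proj₂ (divMod-unique {q = a + pre P (j ∸ N)} N shifted κ<N) ⟨
      suc j * a / N ∎
      where
      open ≡-Reasoning
      N≤j : N ≤ j
      N≤j = subst (_≤ j) (sym length-P) (ℕ.≤∧≢⇒< (ℕ.≰⇒> j≰P) (j≢ ∘ sym))
      N+[j-N] : N + (j ∸ N) ≡ j
      N+[j-N] = ℕ.m+[n∸m]≡n N≤j
      shifted : suc j * a ≡ κ + (a + pre P (j ∸ N)) * N
      shifted = begin
        suc j * a                        ≡⟨ cong (λ x → suc x * a) N+[j-N] ⟨
        suc (N + (j ∸ N)) * a            ≡⟨ lemma N (j ∸ N) a ⟩
        a * N + suc (j ∸ N) * a          ≡⟨ cong (_+_ (a * N)) eq ⟩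
        a * N + (κ + pre P (j ∸ N) * N)  ≡⟨ lemma′ a N κ (pre P (j ∸ N)) ⟩
        κ + (a + pre P (j ∸ N)) * N ∎
        where
        lemma : ∀ N x a → suc (N + x) * a ≡ a * N + suc x * a
        lemma = ℕSolver.solve-∀
        lemma′ : ∀ a N κ h → a * N + (κ + h * N) ≡ κ + (a + h) * N
        lemma′ = ℕSolver.solve-∀

StageAt : Seq → SBState → Set
StageAt g (A , B , C , D) = Stage g A B C D

stage-step : ∀ {g} → Sturmian g → ∀ d {A B C D} → Toward g d (A + C) (B + D) → Stage g A B C D → StageAt g
    (sbStep d (A , B , C , D))
stage-step sturmian L slope stage = StageStep.stage-L sturmian stage slope
stage-step sturmian R slope stage = StageStep.stage-R sturmian stage slope

stages : ∀ {g} → Sturmian g → ∀ dir → IsPathTowardSlope g dir → ∀ k → StageAt g (sbState dir k)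
stages {g} sturmian dir path zero    = stage-zero g
stages {g} sturmian dir path (suc k) = stage-step sturmian (dir k) (path k) (stages sturmian dir path k)

-- Lexicographic order and sorted lists of factors.

>lex-irrefl : ∀ {m} {u : Vec (Fin 2) m} → ¬ (u >lex u)
>lex-irrefl {u = []}    ()
>lex-irrefl {u = x ∷ u} (inj₁ x<x)     = ℕ.<-irrefl refl x<x
>lex-irrefl {u = x ∷ u} (inj₂ (_ , >)) = >lex-irrefl >

>lex-trans : ∀ {m} {u v w : Vec (Fin 2) m} → u >lex v → v >lex w → u >lex w
>lex-trans {u = []} {[]} ()
>lex-trans {u = x ∷ u} {y ∷ v} {z ∷ w} (inj₁ y<x)        (inj₁ z<y)        = inj₁ (ℕ.<-trans z<y y<x)
>lex-trans {u = x ∷ u} {y ∷ v} {z ∷ w} (inj₁ y<x)        (inj₂ (refl , _)) = inj₁ y<x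
>lex-trans {u = x ∷ u} {y ∷ v} {z ∷ w} (inj₂ (refl , _)) (inj₁ z<y)        = inj₁ z<y
>lex-trans {u = x ∷ u} {y ∷ v} {z ∷ w} (inj₂ (refl , >)) (inj₂ (refl , >′)) = inj₂ (refl , >lex-trans > >′)

-- Dominating prefix sums put the larger letter on the left at the first difference; the strict
-- inequality at `j₀` ensures that there is a difference.
prefix-sums⇒>lex : ∀ m (h h′ : ℕ → Fin 2) →
  (∀ j → j ≤ m → sumTo j (toℕ ∘ h′) ≤ sumTo j (toℕ ∘ h)) →
  ∀ j₀ → j₀ ≤ m → sumTo j₀ (toℕ ∘ h′) < sumTo j₀ (toℕ ∘ h) →
  tabulate {n = m} (h ∘ toℕ) >lex tabulate (h′ ∘ toℕ)
prefix-sums⇒>lex m       h h′ le zero     _          ()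
prefix-sums⇒>lex (suc m) h h′ le (suc j₀) (s≤s j₀≤m) lt with ℕ.m≤n⇒m<n∨m≡n (le 1 (s≤s z≤n))
... | inj₁ h′0<h0 = inj₁ h′0<h0
... | inj₂ h′0≡h0 = inj₂ (sym (Fin.toℕ-injective h′0≡h0) , prefix-sums⇒>lex m (h ∘ suc) (h′ ∘ suc)
    (λ j j≤m → ℕ.+-cancelˡ-≤ (toℕ (h 0)) _ _
        (subst₂ _≤_ (trans (sumTo-suc j (toℕ ∘ h′)) (cong (_+ sumTo j (toℕ ∘ h′ ∘ suc)) h′0≡h0))
        (sumTo-suc j (toℕ ∘ h)) (le (suc j) (s≤s j≤m))))
    j₀ j₀≤m
    (ℕ.+-cancelˡ-< (toℕ (h 0)) _ _ (subst₂ _<_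
        (trans (sumTo-suc j₀ (toℕ ∘ h′)) (cong (_+ sumTo j₀ (toℕ ∘ h′ ∘ suc)) h′0≡h0)) (sumTo-suc j₀ (toℕ ∘ h)) lt)))

adjacent⇒decreasing : ∀ {m n} (rows : Vec (Vec (Fin 2) m) (suc n)) →
  (∀ i → lookup rows (Fin.inject₁ i) >lex lookup rows (suc i)) →
  ∀ {i i′} → i Fin.< i′ → lookup rows i >lex lookup rows i′
adjacent⇒decreasing {n = suc n} (r ∷ rows) adj {zero}  {suc zero}     _         = adj zero
adjacent⇒decreasing {n = suc n} (r ∷ rows) adj {zero}  {suc (suc i′)} _         = >lex-trans (adj zero)
    (adjacent⇒decreasing rows (adj ∘ suc) {zero} {suc i′} (s≤s z≤n))
adjacent⇒decreasing {n = suc n} (r ∷ rows) adj {suc i} {suc i′}       (s≤s i<i′) = adjacent⇒decreasing rows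
    (adj ∘ suc) i<i′
adjacent⇒decreasing {n = zero}  (r ∷ rows) adj {zero}  {zero}         ()

increasing-bounded : ∀ {n} (x : Fin n → ℕ) → Increasing x → (∀ i → x i < n) → ∀ i → x i ≡ toℕ i
increasing-bounded {suc zero}    x inc x<n zero    = ℕ.n<1⇒n≡0 (x<n zero)
increasing-bounded {suc (suc n)} x inc x<n = λ where
    zero    → ℕ.n<1⇒n≡0 (subst (x zero <_) (tail zero) (inc (s≤s z≤n)))
    (suc i) → tail i
  where
  x>0 : ∀ i → 0 < x (suc i)
  x>0 i = ℕ.≤-<-trans z≤n (inc {zero} {suc i} (s≤s z≤n))
  tail : ∀ i → x (suc i) ≡ suc (toℕ i)
  tail i = trans (sym (ℕ.suc-pred (x (suc i)) ⦃ ℕ.>-nonZero (x>0 i) ⦄))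
      (cong suc (increasing-bounded (ℕ.pred ∘ x ∘ suc)
    (λ {i} {i′} i<i′ → ℕ.pred-mono-< ⦃ ℕ.>-nonZero (x>0 i) ⦄ (inc (s≤s i<i′)))
    (λ i → ℕ.≤-pred (subst (_< suc (suc n)) (sym (ℕ.suc-pred (x (suc i)) ⦃ ℕ.>-nonZero (x>0 i) ⦄)) (x<n (suc i)))) i))

-- The indices at which the `r i` stand in `rows` form a strictly increasing map of a finite ordinal
-- to itself, hence the identity. So the matrix is known once n+1 decreasing factors are exhibited.
decreasing-unique : ∀ {m n} (rows : Vec (Vec (Fin 2) m) (suc n)) →
  (∀ i → lookup rows (Fin.inject₁ i) >lex lookup rows (suc i)) →
  ∀ (r : Fin (suc n) → Vec (Fin 2) m) → (∀ i → r i ∈ rows) → (∀ {i i′} → i Fin.< i′ → r i >lex r i′) →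
  ∀ i → lookup rows i ≡ r i
decreasing-unique rows adj r r∈ dec i = sym
    (trans (lookup-index (r∈ i)) (cong (lookup rows)
    (Fin.toℕ-injective (increasing-bounded (toℕ ∘ φ) φ-increasing (Fin.toℕ<n ∘ φ) i))))
  where
  φ : Fin _ → Fin _
  φ i = index (r∈ i)
  φ-increasing : Increasing (toℕ ∘ φ)
  φ-increasing {i} {i′} i<i′ with Fin.<-cmp (φ i) (φ i′)
  ... | tri< lt _ _ = lt
  ... | tri≈ _ eq _ = contradiction (subst (_>lex r i′)
      (trans (lookup-index (r∈ i)) (trans (cong (lookup rows) eq) (sym (lookup-index (r∈ i′)))))
      (dec i<i′)) >lex-irrefl
  ... | tri> _ _ gt = contradiction (>lex-trans (dec i<i′)
      (subst₂ _>lex_ (sym (lookup-index (r∈ i′))) (sym (lookup-index (r∈ i)))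
      (adjacent⇒decreasing rows adj gt))) >lex-irrefl

negOnePow-∸ : ∀ {m n} → m ≤ n → negOnePow (n ∸ m) ≡ negOnePow n ℤ.* negOnePow m
negOnePow-∸ {m} {n} m≤n = begin
  negOnePow (n ∸ m)                                           ≡⟨ ℤ.*-identityʳ _ ⟨
  negOnePow (n ∸ m) ℤ.* 1ℤ                                    ≡⟨ cong (negOnePow (n ∸ m) ℤ.*_) (negOnePow-square m) ⟨
  negOnePow (n ∸ m) ℤ.* (negOnePow m ℤ.* negOnePow m)         ≡⟨ ℤ.*-assoc (negOnePow (n ∸ m)) (negOnePow m)
      (negOnePow m) ⟨
  negOnePow (n ∸ m) ℤ.* negOnePow m ℤ.* negOnePow m           ≡⟨ cong (ℤ._* negOnePow m) (negOnePow-+ (n ∸ m) m) ⟨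
  negOnePow (n ∸ m + m) ℤ.* negOnePow m                       ≡⟨ cong (λ k → negOnePow k ℤ.* negOnePow m)
      (ℕ.m∸n+n≡m m≤n) ⟩
  negOnePow n ℤ.* negOnePow m ∎
  where open ≡-Reasoning

Dvec≡cofactors : ∀ {n} (A : Vec (Vec ℤ n) (suc n)) {B : Matrix (suc n) n} → (∀ i j → entries A i j ≡ B i j) →
  ∀ i → lookup (Dvec n A) i ≡ cofactors B i
Dvec≡cofactors {n} A {B} A≗B i = begin
  lookup (Dvec n A) i                                  ≡⟨ Vec.lookup∘tabulate
      (λ i → negOnePow (n ∸ toℕ i) ℤ.* det n (removeAt A i)) i ⟩
  negOnePow (n ∸ toℕ i) ℤ.* det n (removeAt A i)       ≡⟨ cong₂ ℤ._*_ (negOnePow-∸ (ℕ.≤-pred (Fin.toℕ<n i)))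
      (trans (det≡∣entries∣ n (removeAt A i))
     (∣∣ₘ-cong λ i′ j → trans (cong (λ r → lookup r j) (lookup-removeAt A i i′)) (A≗B (punchIn i i′) j))) ⟩
  negOnePow n ℤ.* sgn i ℤ.* ∣ dropRow i B ∣ₘ           ≡⟨ ℤ.*-assoc (negOnePow n) (sgn i) ∣ dropRow i B ∣ₘ ⟩
  cofactors B i ∎
  where open ≡-Reasoning

-- Identification of the rows of the factor matrix.

module FactorMatrix {N a b p : ℕ} ⦃ _ : NonZero N ⦄ (ab≡1+Np : a * b ≡ 1 + N * p) (g : Seq) {p₀ : ℕ}
  (window : ∀ j → suc j < N + N → onesIn g p₀ j ≡ suc j * a / N) where

  open Rotation N a b p ab≡1+Np
  open Enumeration

  start : ∀ r → r < N → ∃₂ λ s q → suc s ≤ N × suc s * a ≡ r + q * N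
  start r r<N with r * b % N in eq
  -- The window formula is indexed by `suc s`, so the residue 0 is represented by `N`.
  ... | zero  = ℕ.pred N , a , ℕ.≤-reflexive (ℕ.suc-pred N) , trans (cong (_* a) (ℕ.suc-pred N))
      (trans (ℕ.*-comm N a) (cong (_+ a * N) (sym r≡0)))
    where
    r≡0 : r ≡ 0
    r≡0 = trans (sym (Rotation.κb N b a p (trans (ℕ.*-comm b a) ab≡1+Np) r<N))
        (trans (cong (λ x → x * a % N) eq) κ-zero)
  ... | suc s = s , f (suc s) , subst (_≤ N) eq (ℕ.<⇒≤ (ℕ.m%n<n (r * b) N)) , trans (κ+fN (suc s))
      (cong (_+ f (suc s) * N)
      (trans (cong (λ x → x * a % N) (sym eq)) (Rotation.κb N b a p (trans (ℕ.*-comm b a) ab≡1+Np) r<N)))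

  -- The start is chosen so that `suc s * a` has remainder `r = N - 1 - k`. Adding `j * a` then
  -- produces a carry exactly when `r + κ j ≥ N`, that is, when `k < κ j`.
  row-position : ∀ k → k < N → ∃ λ pos → ∀ j → j < N → onesIn g pos j ≡ prefix k j
  row-position k k<N with start (N ∸ suc k) (ℕ.∸-monoʳ-< (s≤s z≤n) k<N)
  ... | s , q , s<N , sa≡ = p₀ + s , λ j j<N → ℕ.+-cancelˡ-≡ q _ _ (begin
      q + onesIn g (p₀ + s) j                       ≡⟨ cong (_+ onesIn g (p₀ + s) j) q≡ ⟨
      onesIn g p₀ s + onesIn g (p₀ + s) j           ≡⟨ onesIn-+ g p₀ s j ⟨
      onesIn g p₀ (s + j)                           ≡⟨ window (s + j) (ℕ.+-mono-≤-< s<N j<N) ⟩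
      suc (s + j) * a / N                           ≡⟨ quotient j ⟩
      q + prefix k j ∎)
    where
    open ≡-Reasoning
    r = N ∸ suc k
    r<N : r < N
    r<N = ℕ.∸-monoʳ-< (s≤s z≤n) k<N
    r+1+k≡N : r + suc k ≡ N
    r+1+k≡N = ℕ.m∸n+n≡m k<N
    q≡ : onesIn g p₀ s ≡ q
    q≡ = trans (window s (ℕ.≤-<-trans s<N (ℕ.m<m+n N (ℕ.≤-<-trans z≤n k<N))))
        (proj₂ (divMod-unique {q = q} N sa≡ r<N))
    sum≡ : ∀ j → suc (s + j) * a ≡ (r + κ j) + (q + f j) * N
    sum≡ j = begin
      suc (s + j) * a                      ≡⟨ ℕ.*-distribʳ-+ a (suc s) j ⟩
      suc s * a + j * a                    ≡⟨ cong₂ _+_ sa≡ (κ+fN j) ⟩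
      r + q * N + (κ j + f j * N)          ≡⟨ lemma r q N (κ j) (f j) ⟩
      (r + κ j) + (q + f j) * N ∎
      where
      lemma : ∀ r q N k f → r + q * N + (k + f * N) ≡ (r + k) + (q + f) * N
      lemma = ℕSolver.solve-∀
    quotient : ∀ j → suc (s + j) * a / N ≡ q + prefix k j
    quotient j with κ j ℕ.≤? k
    ... | yes κj≤k = trans (proj₂ (divMod-unique {q = q + f j} N (sum≡ j)
        (subst (r + κ j <_) r+1+k≡N (ℕ.+-monoʳ-< r (s≤s κj≤k)))))
        (cong (_+_ q) (sym (trans (cong (_+_ (f j)) (below-≥ κj≤k)) (ℕ.+-identityʳ (f j)))))
    ... | no  κj≰k = trans (proj₂ (divMod-unique {q = q + f j + 1} N carry
        (ℕ.≤-<-trans (ℕ.m∸n≤m (κ j) (suc k)) (κ<N j))))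
        (trans (ℕ.+-assoc q (f j) 1) (cong (λ x → q + (f j + x)) (sym (below-< k<κj))))
      where
      k<κj = ℕ.≰⇒> κj≰k
      carry : suc (s + j) * a ≡ (κ j ∸ suc k) + (q + f j + 1) * N
      carry = begin
        suc (s + j) * a                                       ≡⟨ sum≡ j ⟩
        (r + κ j) + (q + f j) * N                             ≡⟨ cong (λ x → r + x + (q + f j) * N)
            (ℕ.m+[n∸m]≡n k<κj) ⟨
        (r + (suc k + (κ j ∸ suc k))) + (q + f j) * N         ≡⟨ cong (_+ (q + f j) * N)
            (trans (sym (ℕ.+-assoc r (suc k) (κ j ∸ suc k))) (cong (_+ (κ j ∸ suc k)) r+1+k≡N)) ⟩
        (N + (κ j ∸ suc k)) + (q + f j) * N                   ≡⟨ lemma N (κ j ∸ suc k) (q + f j) ⟩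
        (κ j ∸ suc k) + (q + f j + 1) * N ∎
        where
        lemma : ∀ N x y → (N + x) + y * N ≡ x + (y + 1) * N
        lemma = ℕSolver.solve-∀

  module _ {n J} (n<N : n < N) (E : Enumeration n J) (G : Vec (Vec (Fin 2) n) (suc n)) (isG : IsGMatrix g n G) where

    private
      pos : Fin (suc n) → ℕ
      pos i = proj₁ (row-position (κ (J i)) (κ<N (J i)))

    onesIn-pos : ∀ i j → j ≤ n → onesIn g (pos i) j ≡ prefix (κ (J i)) j
    onesIn-pos i j j≤n = proj₂ (row-position (κ (J i)) (κ<N (J i))) j (ℕ.≤-<-trans j≤n n<N)

    below-antitone : ∀ {k k′} → k ≤ k′ → ∀ t → below k′ t ≤ below k t
    below-antitone {k} {k′} k≤k′ t with k′ ℕ.<? t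
    ... | yes k′<t = ℕ.≤-reflexive (trans (below-< k′<t) (sym (below-< (ℕ.≤-<-trans k≤k′ k′<t))))
    ... | no  k′≮t = subst (_≤ below k t) (sym (below-≥ (ℕ.≮⇒≥ k′≮t))) z≤n

    rows-decreasing : ∀ {i i′} → i Fin.< i′ → factorAt g (pos i) n >lex factorAt g (pos i′) n
    rows-decreasing {i} {i′} i<i′ = prefix-sums⇒>lex n (λ j → g (pos i + j)) (λ j → g (pos i′ + j))
      (λ j j≤n → subst₂ _≤_ (sym (onesIn-pos i′ j j≤n)) (sym (onesIn-pos i j j≤n))
          (ℕ.+-monoʳ-≤ (f j) (below-antitone (ℕ.<⇒≤ (sorted E i<i′)) (κ j))))
      -- At this length the counts differ: `κ (J i′)` exceeds the parameter of row `i` but not that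
      -- of row `i′`.
      (J i′) (bounded E i′)
      (subst₂ _<_ (sym (onesIn-pos i′ (J i′) (bounded E i′))) (sym (onesIn-pos i (J i′) (bounded E i′)))
        (ℕ.+-monoʳ-< (f (J i′)) (subst₂ _<_ (sym (below-≥ {κ (J i′)} ℕ.≤-refl)) (sym (below-< (sorted E i<i′)))
            (s≤s z≤n))))

    G-rows : ∀ i → lookup G i ≡ factorAt g (pos i) n
    G-rows = decreasing-unique G (proj₁ isG) (λ i → factorAt g (pos i) n)
      (λ i → Equivalence.to (proj₂ isG _) (pos i , refl)) rows-decreasing

    G-entries : ∀ i c → entries (toℤMat G) i c ≡ rows J i c
    G-entries i c = begin
      lookup (lookup (toℤMat G) i) c          ≡⟨ cong (λ r → lookup r c)
          (Vec.lookup-map i (Vec.map (λ x → + toℕ x)) G) ⟩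
      lookup (Vec.map (λ x → + toℕ x) (lookup G i)) c ≡⟨ Vec.lookup-map c (λ x → + toℕ x) (lookup G i) ⟩
      + toℕ (lookup (lookup G i) c)           ≡⟨ cong (λ r → + toℕ (lookup r c)) (G-rows i) ⟩
      + toℕ (lookup (factorAt g (pos i) n) c) ≡⟨ cong (λ x → + toℕ x)
          (Vec.lookup∘tabulate (λ j → g (pos i + toℕ j)) c) ⟩
      + toℕ (g (pos i + toℕ c))               ≡⟨ lemma (+ onesIn g (pos i) (toℕ c)) (+ toℕ (g (pos i + toℕ c))) ⟩
      + onesIn g (pos i) (suc (toℕ c)) ℤ.- + onesIn g (pos i) (toℕ c)
        ≡⟨ cong₂ (λ x y → + x ℤ.- + y) (onesIn-pos i (suc (toℕ c)) (Fin.toℕ<n c))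
            (onesIn-pos i (toℕ c) (ℕ.<⇒≤ (Fin.toℕ<n c))) ⟩
      rows J i c ∎
      where
      open ≡-Reasoning
      lemma : ∀ x y → y ≡ (x ℤ.+ y) ℤ.- x
      lemma = ℤSolver.solve-∀

    Dvec≡V : ∀ i → lookup (Dvec n (toℤMat G)) i ≡ V J i
    Dvec≡V = Dvec≡cofactors (toℤMat G) G-entries

-- Christoffel words and the standard factorization.

pre-length : ∀ W → pre W (length W) ≡ ones W
pre-length []      = refl
pre-length (x ∷ W) = cong (_+_ (toℕ x)) (pre-length W)

pre-applyUpTo : ∀ (h : ℕ → Fin 2) M {j} → j ≤ M → pre (applyUpTo h M) j ≡ sumTo j (toℕ ∘ h)
pre-applyUpTo h M       {zero}  _         = refl
pre-applyUpTo h (suc M) {suc j} (s≤s j≤M) = trans (cong (_+_ (toℕ (h 0))) (pre-applyUpTo (h ∘ suc) M j≤M))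
    (sym (sumTo-suc j (toℕ ∘ h)))

count1≡ones : ∀ W → count1 W ≡ ones W
count1≡ones []             = refl
count1≡ones (zero     ∷ W) = count1≡ones W
count1≡ones (suc zero ∷ W) = cong suc (count1≡ones W)

count0+ones : ∀ W → count0 W + ones W ≡ length W
count0+ones []             = refl
count0+ones (zero     ∷ W) = cong suc (count0+ones W)
count0+ones (suc zero ∷ W) = trans (ℕ.+-suc (count0 W) (ones W)) (cong suc (count0+ones W))

lower : ℕ → ℕ → Word
lower p q = christoffel p q zero (suc zero)

length-lower : ∀ p q → length (lower p q) ≡ p + q
length-lower p q = trans (List.length-map _ (upTo (p + q))) (List.length-upTo (p + q))

module _ (p q : ℕ) (p+q>0 : 1 ≤ p + q) where

  private instance
    p+q≢0 : NonZero (p + q)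
    p+q≢0 = ℕ.>-nonZero p+q>0

  private
    letterAt : ℕ → Fin 2
    letterAt i = if divN (i * q) (p + q) <ᵇ divN (suc i * q) (p + q) then suc zero else zero

  floor-suc : ∀ i → suc i * q / (p + q) ≤ suc (i * q / (p + q))
  floor-suc i = subst (suc i * q / (p + q) ≤_) (ℕ.+-comm (i * q / (p + q)) 1)
      (ℕ.≤-trans (ℕ./-monoˡ-≤ (p + q) (subst (suc i * q ≤_) (ℕ.+-comm (p + q) (i * q))
      (ℕ.+-monoˡ-≤ (i * q) (ℕ.m≤n+m q p))))
    (ℕ.≤-reflexive (trans (ℕ.+-distrib-/-∣ʳ (i * q) (divides 1 (sym (ℕ.*-identityˡ (p + q)))))
        (cong (_+_ (i * q / (p + q))) (ℕ.n/n≡1 (p + q))))))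

  letterAt+floor : ∀ i → i * q / (p + q) + toℕ (letterAt i) ≡ suc i * q / (p + q)
  letterAt+floor i with divN (i * q) (p + q) <ᵇ divN (suc i * q) (p + q) in eq
  ... | true  = trans (ℕ.+-comm (i * q / (p + q)) 1)
      (ℕ.≤-antisym (subst₂ _<_ (divN≡/ (i * q) (p + q)) (divN≡/ (suc i * q) (p + q))
      (ℕ.<ᵇ⇒< _ _ (subst T (sym eq) _))) (floor-suc i))
  ... | false = trans (ℕ.+-identityʳ _) (ℕ.≤-antisym (ℕ./-monoˡ-≤ (p + q) (ℕ.m≤n+m (i * q) q))
      (ℕ.≮⇒≥ λ lt → subst T eq (ℕ.<⇒<ᵇ (subst₂ _<_ (sym (divN≡/ (i * q) (p + q)))
          (sym (divN≡/ (suc i * q) (p + q))) lt))))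

  sum-letterAt : ∀ j → sumTo j (toℕ ∘ letterAt) ≡ j * q / (p + q)
  sum-letterAt zero    = sym (ℕ.0/n≡0 (p + q))
  sum-letterAt (suc j) = trans (cong (_+ toℕ (letterAt j)) (sum-letterAt j)) (letterAt+floor j)

  pre-lower : ∀ {j} → j ≤ p + q → pre (lower p q) j ≡ j * q / (p + q)
  pre-lower {j} j≤M = trans (cong (λ W → pre W j) (List.map-upTo letterAt (p + q)))
      (trans (pre-applyUpTo letterAt (p + q) j≤M) (sum-letterAt j))

  ones-lower : ones (lower p q) ≡ q
  ones-lower = trans (sym (pre-length (lower p q))) (trans (cong (pre (lower p q)) (length-lower p q))
    (trans (pre-lower ℕ.≤-refl) (trans (cong (_/ (p + q)) (ℕ.*-comm (p + q) q)) (ℕ.m*n/n≡m q (p + q)))))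

coprime-sum : ∀ {p q} → Coprime p q → Coprime (p + q) q
coprime-sum {p} {q} p⊥q = subst (λ M → Coprime M q) (ℕ.+-comm q p) (coprime-+ p⊥q)

no-proper-multiple : ∀ {M q c} → Coprime M q → 0 < c → c < M → ∀ {x} → c * q ≢ x * M
no-proper-multiple {M} {q} {c} M⊥q c>0 c<M {x} eq = contradiction c<M
    (ℕ.≤⇒≯ (∣⇒≤ ⦃ ℕ.>-nonZero c>0 ⦄ (coprime-divisor M⊥q (divides x (trans (ℕ.*-comm q c) eq)))))

≤-from-scaled : ∀ {N x y r s} → N * x + r ≡ N * y + s → s < N + r → x ≤ y
≤-from-scaled {N} {x} {y} {r} {s} eq s<N+r = ℕ.≮⇒≥ λ y<x → ℕ.<-irrefl refl (begin-strict
  N * y + s           <⟨ ℕ.+-monoʳ-< (N * y) s<N+r ⟩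
  N * y + (N + r)     ≡⟨ lemma N y r ⟩
  N * suc y + r       ≤⟨ ℕ.+-monoˡ-≤ r (ℕ.*-monoʳ-≤ N y<x) ⟩
  N * x + r           ≡⟨ eq ⟩
  N * y + s ∎)
  where
  open ℕ.≤-Reasoning
  lemma : ∀ N y r → N * y + (N + r) ≡ N * suc y + r
  lemma = ℕSolver.solve-∀

-- (b , p) is the lattice point nearest below the line of slope a/N; unless it is the cut point (M₁ , q₁),
-- it lies over the interior of a factor, hence weakly below its segment, and then on it, against coprimality.
standard-factorization : ∀ {p₁ q₁ p₂ q₂ d a b p N} → 1 ≤ p₁ + q₁ → 1 ≤ p₂ + q₂ → Coprime p₁ q₁ → Coprime p₂ q₂ →
  d + a ≡ N → 0 < b → b < N → a * b ≡ 1 + N * p →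
  lower p₁ q₁ ++ lower p₂ q₂ ≡ lower d a →
  p₁ + q₁ ≡ b × q₁ ≡ p
standard-factorization {p₁} {q₁} {p₂} {q₂} {d} {a} {b} {p} M₁>0 M₂>0 p₁⊥q₁ p₂⊥q₂ refl b>0 b<N ab≡ eq = result
    (ℕ.<-cmp b M₁)
  where
  M₁ = p₁ + q₁
  M₂ = p₂ + q₂
  N = d + a
  w₁ = lower p₁ q₁
  w₂ = lower p₂ q₂
  M₁⊥q₁ : Coprime M₁ q₁
  M₁⊥q₁ = coprime-sum p₁⊥q₁
  N>0 : 1 ≤ N
  N>0 = ℕ.≤-trans b>0 (ℕ.<⇒≤ b<N)
  instance
    M₁≢0 : NonZero M₁
    M₁≢0 = ℕ.>-nonZero M₁>0
    M₂≢0 : NonZero M₂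
    M₂≢0 = ℕ.>-nonZero M₂>0
    N≢0 : NonZero N
    N≢0 = ℕ.>-nonZero N>0
  length-w₁ : length w₁ ≡ M₁
  length-w₁ = length-lower p₁ q₁
  N≡ : M₁ + M₂ ≡ N
  N≡ = trans (cong₂ _+_ (sym length-w₁) (sym (length-lower p₂ q₂)))
      (trans (sym (List.length-++ w₁)) (trans (cong length eq) (length-lower d a)))
  M₁≤N : M₁ ≤ N
  M₁≤N = subst (M₁ ≤_) N≡ (ℕ.m≤m+n M₁ M₂)
  a≡ : q₁ + q₂ ≡ a
  a≡ = trans (cong₂ _+_ (sym (ones-lower p₁ q₁ M₁>0)) (sym (ones-lower p₂ q₂ M₂>0)))
      (trans (sym (ones-++ w₁ w₂)) (trans (cong ones eq) (ones-lower d a N>0)))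
  floor₁ : ∀ j → j ≤ M₁ → j * a / N ≡ j * q₁ / M₁
  floor₁ j j≤ = trans (sym (pre-lower d a N>0 (ℕ.≤-trans j≤ M₁≤N)))
      (trans (cong (λ W → pre W j) (sym eq)) (trans (pre-++-≤ w₁ w₂ (subst (j ≤_) (sym length-w₁) j≤))
      (pre-lower p₁ q₁ M₁>0 j≤)))
  floor₂ : ∀ j → j ≤ M₂ → (M₁ + j) * a / N ≡ q₁ + j * q₂ / M₂
  floor₂ j j≤ = trans (sym (pre-lower d a N>0 (subst (M₁ + j ≤_) N≡ (ℕ.+-monoʳ-≤ M₁ j≤))))
      (trans (cong₂ pre (sym eq) (cong (_+ j) (sym length-w₁)))
      (trans (pre-++-+ w₁ w₂ j) (cong₂ _+_ (ones-lower p₁ q₁ M₁>0) (pre-lower p₂ q₂ M₂>0 j≤))))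
  floor-b : b * a / N ≡ p
  floor-b = proj₂ (divMod-unique {q = p} {r = 1} N (trans (ℕ.*-comm b a) (trans ab≡ (cong suc (ℕ.*-comm N p))))
      (ℕ.≤-<-trans b>0 b<N))
  floor-M₁ : M₁ * a / N ≡ q₁
  floor-M₁ = trans (floor₁ M₁ ℕ.≤-refl) (trans (cong (_/ M₁) (ℕ.*-comm M₁ q₁)) (ℕ.m*n/n≡m q₁ M₁))
  -- The cut point `(M₁ , q₁)` lies κ/N below the line of slope a/N.
  κ = M₁ * a % N
  M₁a≡ : M₁ * a ≡ κ + q₁ * N
  M₁a≡ = trans (ℕ.m≡m%n+[m/n]*n (M₁ * a) N) (cong (λ x → κ + x * N) floor-M₁)

  result : _ → M₁ ≡ b × q₁ ≡ p
  result (tri≈ _ b≡M₁ _) = sym b≡M₁ , trans (sym floor-M₁) (trans (cong (λ x → x * a / N) (sym b≡M₁)) floor-b)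
  result (tri< b<M₁ _ _) = contradiction (ℕ.≤-antisym bq₁≤ ≤bq₁) (no-proper-multiple M₁⊥q₁ b>0 b<M₁ {p})
    where
    ≤bq₁ : p * M₁ ≤ b * q₁
    ≤bq₁ = subst (λ x → x * M₁ ≤ b * q₁) (trans (sym (floor₁ b (ℕ.<⇒≤ b<M₁))) floor-b) (ℕ.m/n*n≤m (b * q₁) M₁)
    bq₁≤ : b * q₁ ≤ p * M₁
    bq₁≤ = ≤-from-scaled {N} {r = b * κ} {s = M₁} (begin
      N * (b * q₁) + b * κ       ≡⟨ lemma N b q₁ κ ⟩
      b * (κ + q₁ * N)           ≡⟨ cong (b *_) M₁a≡ ⟨
      b * (M₁ * a)               ≡⟨ lemma′ b M₁ a ⟩
      (a * b) * M₁               ≡⟨ cong (_* M₁) ab≡ ⟩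
      (1 + N * p) * M₁           ≡⟨ lemma″ N p M₁ ⟩
      N * (p * M₁) + M₁ ∎) (ℕ.<-≤-trans (subst (M₁ <_) N≡ (ℕ.m<m+n M₁ M₂>0)) (ℕ.m≤m+n N (b * κ)))
      where
      open ≡-Reasoning
      lemma : ∀ N b q κ → N * (b * q) + b * κ ≡ b * (κ + q * N)
      lemma = ℕSolver.solve-∀
      lemma′ : ∀ b M a → b * (M * a) ≡ (a * b) * M
      lemma′ = ℕSolver.solve-∀
      lemma″ : ∀ N p M → (1 + N * p) * M ≡ N * (p * M) + M
      lemma″ = ℕSolver.solve-∀
  result (tri> _ _ M₁<b) = contradiction (ℕ.≤-antisym cq₂≤ ≤cq₂) (no-proper-multiple (coprime-sum p₂⊥q₂) c>0 c<M₂ {h})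
    where
    open ≡-Reasoning
    c = b ∸ M₁
    M₁+c≡b : M₁ + c ≡ b
    M₁+c≡b = ℕ.m+[n∸m]≡n (ℕ.<⇒≤ M₁<b)
    c>0 : 0 < c
    c>0 = ℕ.m<n⇒0<n∸m M₁<b
    c<M₂ : c < M₂
    c<M₂ = ℕ.+-cancelˡ-< M₁ c M₂ (subst₂ _<_ (sym M₁+c≡b) (sym N≡) b<N)
    h = c * q₂ / M₂
    p≡ : p ≡ q₁ + h
    p≡ = trans (sym floor-b) (trans (cong (λ x → x * a / N) (sym M₁+c≡b)) (floor₂ c (ℕ.<⇒≤ c<M₂)))
    ≤cq₂ : h * M₂ ≤ c * q₂
    ≤cq₂ = ℕ.m/n*n≤m (c * q₂) M₂
    ca+κ≡ : c * a + κ ≡ 1 + h * N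
    ca+κ≡ = ℕ.+-cancelʳ-≡ (q₁ * N) _ _ (begin
      c * a + κ + q₁ * N         ≡⟨ ℕ.+-assoc (c * a) κ (q₁ * N) ⟩
      c * a + (κ + q₁ * N)       ≡⟨ cong (_+_ (c * a)) M₁a≡ ⟨
      c * a + M₁ * a             ≡⟨ lemma c a M₁ ⟩
      a * (M₁ + c)               ≡⟨ cong (a *_) M₁+c≡b ⟩
      a * b                      ≡⟨ ab≡ ⟩
      1 + N * p                  ≡⟨ cong (λ x → 1 + N * x) p≡ ⟩
      1 + N * (q₁ + h)           ≡⟨ lemma′ N q₁ h ⟩
      1 + h * N + q₁ * N ∎)
      where
      lemma : ∀ c a M → c * a + M * a ≡ a * (M + c)
      lemma = ℕSolver.solve-∀
      lemma′ : ∀ N q h → 1 + N * (q + h) ≡ 1 + h * N + q * N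
      lemma′ = ℕSolver.solve-∀
    M₂a+κ≡ : M₂ * a + κ ≡ N * q₂
    M₂a+κ≡ = ℕ.+-cancelʳ-≡ (q₁ * N) _ _ (begin
      M₂ * a + κ + q₁ * N        ≡⟨ ℕ.+-assoc (M₂ * a) κ (q₁ * N) ⟩
      M₂ * a + (κ + q₁ * N)      ≡⟨ cong (_+_ (M₂ * a)) M₁a≡ ⟨
      M₂ * a + M₁ * a            ≡⟨ lemma M₂ M₁ a ⟩
      (M₁ + M₂) * a              ≡⟨ cong₂ _*_ N≡ (sym a≡) ⟩
      N * (q₁ + q₂)              ≡⟨ lemma′ N q₁ q₂ ⟩
      N * q₂ + q₁ * N ∎)
      where
      lemma : ∀ x y a → x * a + y * a ≡ (y + x) * a
      lemma = ℕSolver.solve-∀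
      lemma′ : ∀ N x y → N * (x + y) ≡ N * y + x * N
      lemma′ = ℕSolver.solve-∀
    cq₂≤ : c * q₂ ≤ h * M₂
    cq₂≤ = ≤-from-scaled {N} {r = M₂ * κ} {s = M₂ + c * κ} (begin
      N * (c * q₂) + M₂ * κ               ≡⟨ lemma N c q₂ (M₂ * κ) ⟩
      c * (N * q₂) + M₂ * κ               ≡⟨ cong (λ x → c * x + M₂ * κ) M₂a+κ≡ ⟨
      c * (M₂ * a + κ) + M₂ * κ           ≡⟨ lemma′ c M₂ a κ ⟩
      M₂ * (c * a + κ) + c * κ            ≡⟨ cong (λ x → M₂ * x + c * κ) ca+κ≡ ⟩
      M₂ * (1 + h * N) + c * κ            ≡⟨ lemma″ M₂ h N (c * κ) ⟩
      N * (h * M₂) + (M₂ + c * κ) ∎) (ℕ.+-mono-<-≤ (subst (M₂ <_) N≡ (ℕ.m<n+m M₂ M₁>0)) (ℕ.*-monoˡ-≤ κ (ℕ.<⇒≤ c<M₂)))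
      where
      lemma : ∀ N c q x → N * (c * q) + x ≡ c * (N * q) + x
      lemma = ℕSolver.solve-∀
      lemma′ : ∀ c M a κ → c * (M * a + κ) + M * κ ≡ M * (c * a + κ) + c * κ
      lemma′ = ℕSolver.solve-∀
      lemma″ : ∀ M h N x → M * (1 + h * N) + x ≡ N * (h * M) + (M + x)
      lemma″ = ℕSolver.solve-∀

-- From the rotation to the words of the theorem.

toList-lookup : ∀ {A : Set} {m} (v : Vec A m) (h : ℕ → A) → (∀ i → lookup v i ≡ h (toℕ i)) →
    Vec.toList v ≡ applyUpTo h m
toList-lookup []      h v≗h = refl
toList-lookup (x ∷ v) h v≗h = cong₂ _∷_ (v≗h zero) (toList-lookup v (h ∘ suc) (v≗h ∘ suc))

-- Depends on the words `w′` and `w″` only through numbers, so that `Conclusion-cong` can exchange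
-- their lengths and letter counts for expressions in `A`, `B`, `C`, `D` at once.
Conclusion : (N q a l′ l″ o′ o″ n : ℕ) → List ℤ → Set
Conclusion N q a l′ l″ o′ o″ n V =
  (n ≡ N ∸ 1 → V ≡ List.map (multSign N a ℤ.*_) (christoffel l″ l′ (- + o′) (+ o″))) ×
  (n < N ∸ 1 → let i = N ∸ 1 ∸ n in IsSingleCycle (l″ ∸ i) i (l′ ∸ i) ×
    V ≡ List.map ((multSign N a ℤ.* negOnePowℤ (tExp N q i)) ℤ.*_)
        (compWord (l″ ∸ i) i (l′ ∸ i) (- + o′) (+ o″ ℤ.- + o′) (+ o″)))

module Assembly {g A B C D} (sturmian : Sturmian g) (stage : Stage g A B C D)
  {n} (G : Vec (Vec (Fin 2) n) (suc n)) (isG : IsGMatrix g n G)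
  (N≤n+ℓ′ : A + B + (C + D) ≤ n + (A + B)) (N≤n+ℓ″ : A + B + (C + D) ≤ n + (C + D)) (n<N : n < A + B + (C + D)) where

  private
    N = A + B + (C + D)
    a = A + C
    b = A + B
    q = B + D

    instance
      N≢0 : NonZero N
      N≢0 = ℕ.>-nonZero (ℕ.≤-<-trans z≤n n<N)

  open StageStep sturmian stage

  ab≡1+NA : a * b ≡ 1 + N * A
  ab≡1+NA = trans det₀ (cong suc (ℕ.*-comm A N))

  a+q≡N : a + q ≡ N
  a+q≡N = comm A B C D
    where
    comm : ∀ A B C D → A + C + (B + D) ≡ A + B + (C + D)
    comm = ℕSolver.solve-∀

  open Rotation N a b A ab≡1+NA
  open RotationSign N a b A q ab≡1+NA a+q≡N
  open FactorMatrix ab≡1+NA g (proj₂ window)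

  determinantal-word : ∀ {J} (h : ℕ → ℤ) s → Enumeration n J → (∀ m → V J m ≡ h (toℕ m) ℤ.* S J) → S J ≡ s →
    ∀ {M} → suc n ≡ M → Vec.toList (Dvec n (toℤMat G)) ≡ List.map (s ℤ.*_) (List.map h (upTo M))
  determinantal-word {J} h s E V≡hS S≡s refl = begin
    Vec.toList (Dvec n (toℤMat G))             ≡⟨ toList-lookup (Dvec n (toℤMat G)) (λ k → s ℤ.* h k)
        (λ m → trans (Dvec≡V n<N E G isG m) (trans (V≡hS m)
        (trans (ℤ.*-comm (h (toℕ m)) (S J)) (cong (ℤ._* h (toℕ m)) S≡s)))) ⟩
    applyUpTo (λ k → s ℤ.* h k) (suc n)        ≡⟨ List.map-upTo (λ k → s ℤ.* h k) (suc n) ⟨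
    List.map (λ k → s ℤ.* h k) (upTo (suc n))  ≡⟨ List.map-∘ (upTo (suc n)) ⟩
    List.map (s ℤ.*_) (List.map h (upTo (suc n))) ∎
    where open ≡-Reasoning

  exchange : ∀ i → i + suc n ≡ N → i < b → i < C + D → ∀ {J} → Enumeration n J →
    let c₁ = C + D ∸ i ; c₃ = b ∸ i in
    suc n ≡ c₁ + i + c₃ × IsSingleCycle c₁ i c₃ × (∀ m → J m ≡ iterate (compPerm c₁ i c₃) (toℕ m) 0) ×
    (∀ m → V J m ≡ compLetter c₁ i (- + A) (+ C ℤ.- + A) (+ C) (J m) ℤ.* S J)
  exchange i i+1+n≡N i<b i<ℓ″ E = 1+n≡ , single-cycle E , J-toℕ E , V≡letter E
    where
    c₁ = C + D ∸ i
    c₃ = b ∸ i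
    c₁+i≡ : c₁ + i ≡ C + D
    c₁+i≡ = ℕ.m∸n+n≡m (ℕ.<⇒≤ i<ℓ″)
    c₃+i≡ : c₃ + i ≡ b
    c₃+i≡ = ℕ.m∸n+n≡m (ℕ.<⇒≤ i<b)
    N≡ : N ≡ c₁ + i + (c₃ + i)
    N≡ = trans (ℕ.+-comm b (C + D)) (cong₂ _+_ (sym c₁+i≡) (sym c₃+i≡))
    1+n≡ : suc n ≡ c₁ + i + c₃
    1+n≡ = ℕ.+-cancelˡ-≡ i _ _ (trans i+1+n≡N
        (trans N≡ (trans (sym (ℕ.+-assoc (c₁ + i) c₃ i)) (ℕ.+-comm (c₁ + i + c₃) i))))
    open FirstReturn N a b A C c₁ i c₃ n ab≡1+NA refl (sym c₃+i≡) N≡ 1+n≡ (ℕ.m<n⇒0<n∸m i<b)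

  -- The floor of mb/N rises at the next step exactly when the remainder of `m * b` is at least N -
  -- b = C + D. The Christoffel word thus codes the rotation by `b`, which is the interval exchange
  -- with empty middle interval.
  christoffel-letter : ∀ {A : Set} (x y z : A) m {M} → M ≡ N →
    compLetter (C + D) 0 x y z (m * b % N) ≡ (if divN (m * b) M <ᵇ divN (suc m * b) M then z else x)
  christoffel-letter x y z m refl with m * b % N ℕ.<? C + D
  ... | yes r<ℓ″ = trans (compLetter-I₁ r<ℓ″) (sym (cong (if_then z else x) (flat _ _ (ℕ.≤-reflexive same))))
    where
    r+b<N : m * b % N + b < N
    r+b<N = subst (m * b % N + b <_) (ℕ.+-comm (C + D) b) (ℕ.+-monoˡ-< b r<ℓ″)
    flat : ∀ u v → v ≤ u → (u <ᵇ v) ≡ false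
    flat u v v≤u with u <ᵇ v in eq
    ... | false = refl
    ... | true  = contradiction v≤u (ℕ.<⇒≱ (ℕ.<ᵇ⇒< u v (subst T (sym eq) _)))
    same : divN (suc m * b) N ≡ divN (m * b) N
    same = trans (divN≡/ (suc m * b) N) (trans (proj₂ (divMod-unique {q = m * b / N} N
      (trans (cong (_+_ b) (ℕ.m≡m%n+[m/n]*n (m * b) N)) (lemma b (m * b % N) (m * b / N * N))) r+b<N))
          (sym (divN≡/ (m * b) N)))
      where
      lemma : ∀ b r x → b + (r + x) ≡ r + b + x
      lemma = ℕSolver.solve-∀
  ... | no  r≮ℓ″ = trans (compLetter-I₃ {c₂ = 0}
      (subst (_≤ m * b % N) (sym (ℕ.+-identityʳ (C + D))) (ℕ.≮⇒≥ r≮ℓ″)))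
      (sym (cong (if_then z else x) (jump _ _ rises)))
    where
    jump : ∀ u v → u < v → (u <ᵇ v) ≡ true
    jump u v u<v with u <ᵇ v in eq
    ... | true  = refl
    ... | false = ⊥-elim (subst T eq (ℕ.<⇒<ᵇ u<v))
    rises : divN (m * b) N < divN (suc m * b) N
    rises = subst₂ _<_ (sym (divN≡/ (m * b) N))
        (trans (sym (proj₂ (divMod-unique {q = suc (m * b / N)} N carry remainder<N)))
        (sym (divN≡/ (suc m * b) N))) (ℕ.n<1+n (m * b / N))
      where
      r = m * b % N
      N≤r+b : N ≤ r + b
      N≤r+b = subst (_≤ r + b) (ℕ.+-comm (C + D) b) (ℕ.+-monoˡ-≤ b (ℕ.≮⇒≥ r≮ℓ″))
      remainder<N : r + b ∸ N < N
      remainder<N = ℕ.+-cancelʳ-< N (r + b ∸ N) N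
          (subst (_< N + N) (sym (ℕ.m∸n+n≡m N≤r+b)) (ℕ.+-mono-<-≤ (ℕ.m%n<n (m * b) N) (ℕ.m≤m+n b (C + D))))
      carry : suc m * b ≡ (r + b ∸ N) + suc (m * b / N) * N
      carry = begin
        b + m * b                              ≡⟨ cong (_+_ b) (ℕ.m≡m%n+[m/n]*n (m * b) N) ⟩
        b + (r + m * b / N * N)                ≡⟨ lemma b r (m * b / N * N) ⟩
        (r + b) + m * b / N * N                ≡⟨ cong (_+ m * b / N * N) (ℕ.m∸n+n≡m N≤r+b) ⟨
        (r + b ∸ N + N) + m * b / N * N        ≡⟨ ℕ.+-assoc (r + b ∸ N) N (m * b / N * N) ⟩
        (r + b ∸ N) + suc (m * b / N) * N ∎
        where
        open ≡-Reasoning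
        lemma : ∀ b r x → b + (r + x) ≡ r + b + x
        lemma = ℕSolver.solve-∀

  full : suc n ≡ N → Vec.toList (Dvec n (toℤMat G)) ≡ List.map (multSign N a ℤ.*_)
      (christoffel (C + D) b (- + A) (+ C))
  full 1+n≡N with exchange 0 1+n≡N (ℕ.≤-trans B>0 (ℕ.m≤n+m B A)) (ℕ.≤-trans C>0 (ℕ.m≤m+n C D))
      (orbit-enumeration 1+n≡N)
  ... | _ , _ , _ , V≡ = determinantal-word
    (λ k → if divN (k * b) (C + D + b) <ᵇ divN (suc k * b) (C + D + b) then + C else - + A) (multSign N a)
        (orbit-enumeration 1+n≡N)
    (λ m → trans (V≡ m) (cong (ℤ._* S (orbit {n}))
        (christoffel-letter (- + A) (+ C ℤ.- + A) (+ C) (toℕ m) (ℕ.+-comm (C + D) b))))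
    (trans (S≡sign 0 1+n≡N (orbit-enumeration 1+n≡N)) (ℤ.*-identityʳ (multSign N a)))
    (trans 1+n≡N (ℕ.+-comm b (C + D)))

  truncated : ∀ i → i + suc n ≡ N → i < b → i < C + D →
    IsSingleCycle (C + D ∸ i) i (b ∸ i) ×
    Vec.toList (Dvec n (toℤMat G)) ≡ List.map ((multSign N a ℤ.* negOnePowℤ (tExp N q i)) ℤ.*_)
      (compWord (C + D ∸ i) i (b ∸ i) (- + A) (+ C ℤ.- + A) (+ C))
  truncated i i+1+n≡N i<b i<ℓ″ with enumeration i i+1+n≡N
  ... | J , E with exchange i i+1+n≡N i<b i<ℓ″ E
  ...   | 1+n≡ , cycle , J≡ , V≡ = cycle , determinantal-word
    (λ k → letter (iterate (compPerm (C + D ∸ i) i (b ∸ i)) k 0)) (multSign N a ℤ.* negOnePowℤ (tExp N q i)) E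
    (λ m → trans (V≡ m) (cong (λ j → letter j ℤ.* S J) (J≡ m)))
    (S≡sign i i+1+n≡N E) 1+n≡
    where
    letter : ℕ → ℤ
    letter = compLetter (C + D ∸ i) i (- + A) (+ C ℤ.- + A) (+ C)

  conclusion : Conclusion N q a b (C + D) A C n (Vec.toList (Dvec n (toℤMat G)))
  conclusion = (λ n≡N-1 → full (trans (cong suc n≡N-1) (ℕ.suc-pred N))) ,
    λ n<N-1 → let i+1+n≡N = trans (ℕ.+-suc (N ∸ 1 ∸ n) n) (trans (cong suc (ℕ.m∸n+n≡m (ℕ.<⇒≤ n<N-1))) (ℕ.suc-pred N)) in
      truncated (N ∸ 1 ∸ n) i+1+n≡N (short i+1+n≡N N≤n+ℓ′) (short i+1+n≡N N≤n+ℓ″)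
    where
    short : ∀ {i ℓ} → i + suc n ≡ N → N ≤ n + ℓ → i < ℓ
    short {i} {ℓ} eq N≤n+ℓ = ℕ.+-cancelʳ-≤ n _ _ (subst₂ _≤_ (trans (sym eq) (ℕ.+-suc i n)) (ℕ.+-comm n ℓ) N≤n+ℓ)

Conclusion-cong : ∀ {N N₁ q q₁ a a₁ l′ l′₁ l″ l″₁ o′ o′₁ o″ o″₁ n V} →
  N₁ ≡ N → q₁ ≡ q → a₁ ≡ a → l′₁ ≡ l′ → l″₁ ≡ l″ → o′₁ ≡ o′ → o″₁ ≡ o″ →
  Conclusion N q a l′ l″ o′ o″ n V → Conclusion N₁ q₁ a₁ l′₁ l″₁ o′₁ o″₁ n V
Conclusion-cong refl refl refl refl refl refl refl c = c

-- `standard-factorization` gives `w′` the length `A + B` and `A` ones, as for block 0; the numbers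
-- for `w″` follow by subtraction.
theorem-at-stage : ∀ {g A B C D} → Sturmian g → Stage g A B C D →
  ∀ {n} (G : Vec (Vec (Fin 2) n) (suc n)) → IsGMatrix g n G →
  A + B + (C + D) ≤ n + (A + B) → A + B + (C + D) ≤ n + (C + D) → n < A + B + (C + D) →
  ∀ w′ w″ → IsChristoffel w′ → IsChristoffel w″ → w′ ++ w″ ≡ lower (B + D) (A + C) →
  let w = lower (B + D) (A + C) in
  Conclusion (length w) (count0 w) (count1 w) (length w′) (length w″) (count1 w′) (count1 w″) n
      (Vec.toList (Dvec n (toℤMat G)))
theorem-at-stage {g} {A} {B} {C} {D} sturmian stage {n} G isG N≤n+ℓ′ N≤n+ℓ″ n<N w′ w″
  (p₁ , q₁ , p₁⊥q₁ , M₁>0 , refl) (p₂ , q₂ , p₂⊥q₂ , M₂>0 , refl) w′w″≡w = Conclusion-cong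
    length-w (ℕ.+-cancelʳ-≡ (A + C) _ _ (trans (cong (_+_ (count0 w)) (sym ones-w))
        (trans (count0+ones w) (length-lower (B + D) (A + C)))))
    (trans (count1≡ones w) ones-w)
    (trans (length-lower p₁ q₁) M₁≡ℓ′)
    (trans (length-lower p₂ q₂) M₂≡ℓ″)
    (trans (count1≡ones w′) (trans (ones-lower p₁ q₁ M₁>0) q₁≡A))
    (trans (count1≡ones w″) (trans (ones-lower p₂ q₂ M₂>0) q₂≡C))
    (Assembly.conclusion sturmian stage G isG N≤n+ℓ′ N≤n+ℓ″ n<N)
  where
  open StageStep sturmian stage using (det₀; ℓ₀<N; B>0)
  w = lower (B + D) (A + C)
  N = A + B + (C + D)
  comm : B + D + (A + C) ≡ N
  comm = lemma A B C D
    where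
    lemma : ∀ A B C D → B + D + (A + C) ≡ A + B + (C + D)
    lemma = ℕSolver.solve-∀
  length-w : length w ≡ N
  length-w = trans (length-lower (B + D) (A + C)) comm
  ones-w : ones w ≡ A + C
  ones-w = ones-lower (B + D) (A + C) (subst (1 ≤_) (sym comm) (ℕ.≤-<-trans z≤n n<N))
  factorization : p₁ + q₁ ≡ A + B × q₁ ≡ A
  factorization = standard-factorization {p₁} {q₁} {p₂} {q₂} {B + D} {A + C} M₁>0 M₂>0 p₁⊥q₁ p₂⊥q₂ comm
    (ℕ.≤-trans B>0 (ℕ.m≤n+m B A)) ℓ₀<N (trans det₀ (cong suc (ℕ.*-comm A N))) w′w″≡w
  M₁≡ℓ′ = proj₁ factorization
  q₁≡A = proj₂ factorization
  M₂≡ℓ″ : p₂ + q₂ ≡ C + D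
  M₂≡ℓ″ = ℕ.+-cancelˡ-≡ (A + B) _ _ (trans (cong (_+ (p₂ + q₂)) (sym M₁≡ℓ′))
      (trans (cong₂ _+_ (sym (length-lower p₁ q₁)) (sym (length-lower p₂ q₂)))
    (trans (sym (List.length-++ (lower p₁ q₁))) (trans (cong length w′w″≡w) length-w))))
  q₂≡C : q₂ ≡ C
  q₂≡C = ℕ.+-cancelˡ-≡ A _ _ (trans (cong (_+ q₂) (sym q₁≡A))
      (trans (cong₂ _+_ (sym (ones-lower p₁ q₁ M₁>0)) (sym (ones-lower p₂ q₂ M₂>0)))
    (trans (sym (ones-++ (lower p₁ q₁) (lower p₂ q₂))) (trans (cong ones w′w″≡w) ones-w))))

-- One part of the new node is the old node itself, the other is a part of the old node; both have
-- length at most `n`. This is what keeps `i = N - 1 - n` below the lengths of both factors.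
parts-short : ∀ d {A B C D n} → B + D + (A + C) ≤ n → (let A′ , B′ , C′ , D′ = sbStep d (A , B , C , D)) →
  A′ + B′ + (C′ + D′) ≤ n + (A′ + B′) × A′ + B′ + (C′ + D′) ≤ n + (C′ + D′)
parts-short L {A} {B} {C} {D} {n} le =
  subst (_≤ n + (A + B)) (swap A B C D) (ℕ.+-monoˡ-≤ (A + B) le) ,
  ℕ.+-monoˡ-≤ (A + C + (B + D)) (ℕ.≤-trans (subst (A + B ≤_) (part A B C D) (ℕ.m≤m+n (A + B) (C + D))) le)
  where
  swap : ∀ A B C D → B + D + (A + C) + (A + B) ≡ A + B + (A + C + (B + D))
  swap = ℕSolver.solve-∀
  part : ∀ A B C D → A + B + (C + D) ≡ B + D + (A + C)
  part = ℕSolver.solve-∀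
parts-short R {A} {B} {C} {D} {n} le =
  subst (_≤ n + (A + C + (B + D))) (ℕ.+-comm (C + D) (A + C + (B + D)))
      (ℕ.+-monoˡ-≤ (A + C + (B + D)) (ℕ.≤-trans (subst (C + D ≤_) (part A B C D) (ℕ.m≤m+n (C + D) (A + B))) le)) ,
  ℕ.+-monoˡ-≤ (C + D) (subst (_≤ n) (ℕ.+-comm (B + D) (A + C)) le)
  where
  part : ∀ A B C D → C + D + (A + B) ≡ B + D + (A + C)
  part = ℕSolver.solve-∀

theorem9 : (g : Seq) → Sturmian g →
    (dir : ℕ → Dir) → IsPathTowardSlope g dir →
    (n : ℕ) → 2 ≤ n →
    (μ : ℕ) → length (chrW dir μ) ≤ n → n < length (chrW dir (suc μ)) →
    (rows : Vec (Vec (Fin 2) n) (suc n)) → IsGMatrix g n rows →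
    (w' w'' : List (Fin 2)) → IsChristoffel w' → IsChristoffel w'' →
    w' ++ w'' ≡ chrW dir (suc μ) →
    let wν = chrW dir (suc μ)
        N = length wν
        q = count0 wν
        ε = multSign N (count1 wν)
        V = toList (Dvec n (toℤMat rows))
    in (n ≡ N ∸ 1 →
         V ≡ List.map (ε ℤ.*_)
               (christoffel (length w'') (length w')
                 (- (+ count1 w')) (+ count1 w'')))
       ×
       (n < N ∸ 1 →
         let i = N ∸ 1 ∸ n
             c1 = length w'' ∸ i
             c2 = i
             c3 = length w' ∸ i
         in IsSingleCycle c1 c2 c3 ×
            V ≡ List.map ((ε ℤ.* negOnePowℤ (tExp N q i)) ℤ.*_)
                  (compWord c1 c2 c3
                    (- (+ count1 w')) ((+ count1 w'') ℤ.- (+ count1 w')) (+ count1 w'')))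
theorem9 g sturmian dir path n _ μ ≤n n< rows isG w' w'' w'-christoffel w''-christoffel w'w''≡w =
  theorem-at-stage sturmian (stages sturmian dir path (suc μ)) rows isG (proj₁ short) (proj₂ short)
    (subst (n <_) (trans (length-lower (nodeDen dir (suc μ)) (nodeNum dir (suc μ)))
      (let A , B , C , D = sbState dir (suc μ) in comm A B C D)) n<)
    w' w'' w'-christoffel w''-christoffel w'w''≡w
  where
  short = parts-short (dir μ) (subst (_≤ n) (length-lower (nodeDen dir μ) (nodeNum dir μ)) ≤n)
  comm : ∀ A B C D → B + D + (A + C) ≡ A + B + (C + D)
  comm = ℕSolver.solve-∀
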